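{- There is a constant $C$ such that for every sufficiently large integer $N$ there is a deterministic right triangular tile assembly system with at most $C\,\log N/\log\log N$ tiles that produces a full right triangle with shortest edge of length $N$.
   Context: Glues: a glue is a pair $(a,n)$ of a label $a$ and a strength $n\in\mathbb{N}=\{0,1,2,\dots\}$; there is a special non-interactive glue $\phi$. The strength function is $g((a,n),(a',n'))=n$ if $(a,n)=(a',n')$ and $0$ otherwise, and $g(\phi,\gamma)=g(\gamma,\phi)=0$ for every glue $\gamma$. Right triangular tile: an isosceles right triangle with legs of length $1$ and a glue on each side, written $(\gamma_1,\gamma_2,\gamma_3,k)$ with $k\in\{\mathtt{e},\mathtt{n},\mathtt{w},\mathtt{s}\}$ the direction (east, north, west, south) in which the right angle points (hypotenuse vertical for $\mathtt e,\mathtt w$, horizontal for $\mathtt n,\mathtt s$) and $\gamma_1,\gamma_2,\gamma_3$ the glues in counter-clockwise order starting from the hypotenuse. Tiles may be translated, but not rotated or flipped. A super-tile is a set of placed (translated) tiles with pairwise disjoint interiors such that any two of them are joined by a path of tiles in which consecutive tiles share a common side with positive strength. A tile can stick to a super-tile at temperature $\tau$ if it can be placed, without overlapping the super-tile, so that the sum of $g(\gamma_i,\gamma_i')$ over all sides it shares (coinciding sides of equal length) with tiles of the super-tile is at least $\tau$. A tile assembly system is a tuple $(T,s,g,\tau)$ with $T$ a finite set of tiles (each in unlimited supply), seed $s\in T$, strength function $g$ and temperature $\tau\in\mathbb{N}$; its number of tiles is $|T|$. Its produce is a super-tile obtained from the seed by finitely many steps, each sticking one tile of $T$ at temperature $\tau$,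 to which no tile of $T$ can stick any more. The system is deterministic if its produce is unique regardless of the choices made at each step. A system produces a full right triangle with shortest edge of length $N$ if its produce occupies exactly an upright isosceles right triangle (horizontal hypotenuse at the bottom, right angle on top) with legs of length $N$, and every two tiles of the produce sharing a side have positive strength on that common side. -}

module Defs where

open import Data.Bool using (if_then_else_)
open import Data.Fin using (Fin; zero; suc)
open import Data.Integer as ℤ using (ℤ; +_)
open import Data.List using (List; []; _∷_; [_]; length; map; sum; allFin; cartesianProductWith)
open import Data.List.Membership.Propositional using (_∈_)
open import Data.List.Relation.Unary.All using (All)
open import Data.List.Relation.Unary.AllPairs using (AllPairs)
open import Data.List.Relation.Unary.Unique.Propositional using (Unique)
open import Data.Nat as ℕ using (ℕ)
open import Data.Product using (_×_; _,_; ∃-syntax)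
open import Data.Product.Properties using (≡-dec)
open import Data.Rational as ℚ using (ℚ; 0ℚ; _/_)
open import Function.Bundles using (_⇔_)
open import Relation.Binary.Construct.Closure.ReflexiveTransitive using (Star)
open import Relation.Binary.Definitions using (DecidableEquality)
open import Relation.Binary.PropositionalEquality using (_≡_)
open import Relation.Nullary using (¬_; does)

-- Glue labels are drawn from a countable alphabet; a tile set is finite.
data Glue : Set where
  φ    : Glue
  glue : (label strength : ℕ) → Glue

g : Glue → Glue → ℕ
g (glue a n) (glue b m) = if does (≡-dec ℕ._≟_ ℕ._≟_ (a , n) (b , m)) then n else 0
g _          _          = 0

-- Coordinates are taken along two orthogonal unit axes: x points north-east
-- and y points north-west.  (x , y) is thus a positively oriented frame, the
-- legs of every tile are parallel to the axes, and hypotenuses are diagonals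
-- of unit squares (horizontal: x + y constant; vertical: x - y constant).
--
-- A tile is placed by giving its right-angle vertex, an integer point.  Every
-- tile connected to the seed through shared sides lies on this lattice.
-- Regions, on the other hand, are sets of points with rational coordinates.

Vertex : Set
Vertex = ℤ × ℤ

Point : Set
Point = ℚ × ℚ

data Direction : Set where
  east north west south : Direction

-- Coordinates of a point along the two legs, measured from the right-angle
-- vertex, for a right isosceles triangle whose right angle points in the given
-- direction.  For example, with the right angle north, the legs run
-- south-west (-x) and south-east (-y).
legCoordinates : Direction → Vertex → Point → ℚ × ℚ
legCoordinates d (a , b) (x , y) = signed d
  where
  x₊ x₋ y₊ y₋ : ℚ
  x₊ = x ℚ.- a / 1
  x₋ = a / 1 ℚ.- x
  y₊ = y ℚ.- b / 1
  y₋ = b / 1 ℚ.- y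
  signed : Direction → ℚ × ℚ
  signed east  = x₋ , y₊
  signed north = x₋ , y₋
  signed west  = x₊ , y₋
  signed south = x₊ , y₊

record Triangle : Set where
  constructor triangle
  field
    direction  : Direction
    rightAngle : Vertex
    leg        : ℕ

Inside : Triangle → Point → Set
Inside (triangle d v L) p =
  let (s , t) = legCoordinates d v p in
  (0ℚ ℚ.≤ s) × (0ℚ ℚ.≤ t) × (s ℚ.+ t ℚ.≤ + L / 1)

Interior : Triangle → Point → Set
Interior (triangle d v L) p =
  let (s , t) = legCoordinates d v p in
  (0ℚ ℚ.< s) × (0ℚ ℚ.< t) × (s ℚ.+ t ℚ.< + L / 1)

record Tile : Set where
  constructor tile
  field
    γ₁ γ₂ γ₃  : Glue
    direction : Direction

record Placed : Set where
  constructor _at_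
  field
    type       : Tile
    rightAngle : Vertex

shape : Placed → Triangle
shape (t at v) = triangle (Tile.direction t) v 1

Overlap : Placed → Placed → Set
Overlap p q = ∃[ z ] Interior (shape p) z × Interior (shape q) z

-- Sides are numbered counter-clockwise, the hypotenuse first.
Side : Set
Side = Fin 3

glueOn : Tile → Side → Glue
glueOn t zero             = Tile.γ₁ t
glueOn t (suc zero)       = Tile.γ₂ t
glueOn t (suc (suc zero)) = Tile.γ₃ t

Segment : Set
Segment = Vertex × Vertex

-- Endpoints of the hypotenuse in counter-clockwise order around the tile.
hypotenuse : Direction → Vertex → Segment
hypotenuse east  (a , b) = (a , ℤ.suc b)  , (ℤ.pred a , b)
hypotenuse north (a , b) = (ℤ.pred a , b) , (a , ℤ.pred b)
hypotenuse west  (a , b) = (a , ℤ.pred b) , (ℤ.suc a , b)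
hypotenuse south (a , b) = (ℤ.suc a , b)  , (a , ℤ.suc b)

segment : Placed → Side → Segment
segment (t at v) i =
  let (h₀ , h₁) = hypotenuse (Tile.direction t) v in side h₀ h₁ i
  where
  side : Vertex → Vertex → Side → Segment
  side h₀ h₁ zero             = h₀ , h₁
  side h₀ h₁ (suc zero)       = h₁ , v
  side h₀ h₁ (suc (suc zero)) = v , h₀

reverse : Segment → Segment
reverse (u , v) = v , u

_≟ₛ_ : DecidableEquality Segment
_≟ₛ_ = ≡-dec _≟ᵥ_ _≟ᵥ_
  where
  _≟ᵥ_ : DecidableEquality Vertex
  _≟ᵥ_ = ≡-dec ℤ._≟_ ℤ._≟_

-- Both tiles run through their sides counter-clockwise, so tiles with disjoint
-- interiors traverse a common side in opposite directions.
Share : (p : Placed) → Side → (q : Placed) → Side → Set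
Share p i q j = segment p i ≡ reverse (segment q j)

strengthAt : (p : Placed) → Side → (q : Placed) → Side → ℕ
strengthAt p i q j = g (glueOn (Placed.type p) i) (glueOn (Placed.type q) j)

-- Sum of strengths over all sides shared by two placed tiles.
bond : Placed → Placed → ℕ
bond p q = sum (cartesianProductWith contribution (allFin 3) (allFin 3))
  where
  contribution : Side → Side → ℕ
  contribution i j =
    if does (segment p i ≟ₛ reverse (segment q j)) then strengthAt p i q j else 0

-- A finite set of placed tiles.
Assembly : Set
Assembly = List Placed

_≈_ : Assembly → Assembly → Set
S ≈ S′ = ∀ p → (p ∈ S) ⇔ (p ∈ S′)

record IsSuperTile (S : Assembly) : Set where
  Linked : Placed → Placed → Set
  Linked p q = p ∈ S × q ∈ S ×
    ∃[ i ] ∃[ j ] Share p i q j × 0 ℕ.< strengthAt p i q j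
  field
    disjoint  : AllPairs (λ p q → ¬ Overlap p q) S
    connected : ∀ p q → p ∈ S → q ∈ S → Star Linked p q

record CanStick (τ : ℕ) (p : Placed) (S : Assembly) : Set where
  field
    free   : All (λ q → ¬ Overlap p q) S
    strong : τ ℕ.≤ sum (map (bond p) S)

Occupies : Assembly → Triangle → Set
Occupies S △ = ∀ z → (∃[ p ] p ∈ S × Inside (shape p) z) ⇔ Inside △ z

FullyBonded : Assembly → Set
FullyBonded S = ∀ p q → p ∈ S → q ∈ S → ∀ i j → Share p i q j →
                0 ℕ.< strengthAt p i q j

record System : Set where
  field
    tiles       : List Tile
    unique      : Unique tiles
    seed        : Tile
    seed∈tiles  : seed ∈ tiles
    temperature : ℕ

  size : ℕ
  size = length tiles

module _ (𝒯 : System) where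
  open System 𝒯

  data Step : Assembly → Assembly → Set where
    stick : ∀ {S t v} → t ∈ tiles → CanStick temperature (t at v) S →
            Step S ((t at v) ∷ S)

  Terminal : Assembly → Set
  Terminal S = ∀ t v → t ∈ tiles → ¬ CanStick temperature (t at v) S

  initial : Assembly
  initial = [ seed at (+ 0 , + 0) ]

  record Produce (S : Assembly) : Set where
    field
      reachable : Star Step initial S
      superTile : IsSuperTile S
      terminal  : Terminal S

  -- The second condition says that no choices made along the way prevent the
  -- produce from being reached; as all produces coincide, it also bounds the
  -- size of reachable assemblies, so there are no infinite growth sequences.
  record Deterministic : Set where
    field
      unique-produce : ∀ S S′ → Produce S → Produce S′ → S ≈ S′
      completes      : ∀ S → Star Step initial S →
                       ∃[ P ] Star Step S P × Produce P

  ProducesFullTriangle : ℕ → Set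
  ProducesFullTriangle N =
    ∃[ S ] Produce S × (∃[ v ] Occupies S (triangle north v N)) × FullyBonded S

{-# OPTIONS --safe #-}
-- The triangle is grown from its apex, row by row and boustrophedon.  A row
-- consists of up tiles, each carrying one symbol of a tape, alternating with
-- down tiles.  At temperature 20, the first tile of a row attaches to the end of
-- the row above by a single strong bond; every further down tile needs two weak
-- bonds (of strength 10 to 14), one with its neighbour in the sweep and one with
-- the tile above it, and so reads the state of the sweep and a symbol; up tiles
-- attach to down tiles by a strong bond.  Every row adds a symbol at its
-- beginning.
--
-- Rows swept to the left copy the tape.  Rows swept to the right first load m
-- digits in base b, one per row, each remembered by a tile on the left leg, and
-- then increment the resulting number, one unit per row.  An overflow reaches
-- the right end as a pending carry, which leaves no glue for a next row.  There
-- are O(b + m) tiles, and with b about the square root of log N and m about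
-- log N / log b, every N is the number of rows for a suitable initial number,
-- the parity of N being absorbed by an optional extra row.
module Submission where

open import Defs
open import Data.Nat using (ℕ; _*_; _≤_)
open import Data.Nat.Logarithm using (⌊log₂_⌋)
open import Data.Product using (_×_; _,_; ∃-syntax)

-- Determinism comes from orienting the edges. Every common side of two positions is an input of one
-- of them. An up triangle other than the apex has one input; a down triangle has its hypotenuse
-- and, unless it starts a row, the leg met earlier in the sweep. Every reachable assembly is a set
-- of positions closed under inputs. A bond through an output side would need a neighbour placed
-- before its own input, so a new tile is held by inputs alone, and the glues there name a single
-- tile. Hence every order of attachment fills in one fixed pattern. Since any two weak strengths
-- reach 20 and none does alone, an inner down tile waits for both of its inputs.
--
-- The same orientation yields full bonding: each edge of the triangle is an input somewhere, and
-- inputs have strength at least 10.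
--
-- The counter starts at `b ^ m` minus `c + 1`, so that exactly the last of `c + 1` increments
-- overflows. With the seed row, `p` (0 or 1) extra rows and `m + c + 1` pairs of rows,
-- `N = 3 + p + 2 (m + c)`.

-- Which sides of two tiles can coincide.

module Bonds where

  open import Data.Bool using (false; if_then_else_)
  open import Data.Empty using (⊥-elim)
  open import Data.Fin using (zero; suc)
  open import Data.Integer as ℤ using (ℤ; +_; 0ℤ; 1ℤ; -1ℤ)
  open import Data.Integer.Tactic.RingSolver using (solve-∀)
  open import Data.Nat using (ℕ; zero; suc; _+_)
  import Data.Nat.Properties as ℕₚ
  open import Data.Product using (_×_; _,_; proj₁; proj₂)
  open import Relation.Binary.PropositionalEquality
  open import Relation.Nullary using (yes; no; does)
  open import Relation.Nullary.Decidable using (dec-false; dec-true)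

  displacement : Segment → ℤ × ℤ
  displacement ((a , b) , (c , d)) = (c ℤ.- a , d ℤ.- b)

  sideVector : Direction → Side → ℤ × ℤ
  sideVector d i = displacement (segment (tile φ φ φ d at (0ℤ , 0ℤ)) i)

  i-i : ∀ a → a ℤ.- a ≡ 0ℤ
  i-i = solve-∀

  i-pred : ∀ a → a ℤ.- (-1ℤ ℤ.+ a) ≡ 1ℤ
  i-pred = solve-∀

  pred-i : ∀ a → (-1ℤ ℤ.+ a) ℤ.- a ≡ -1ℤ
  pred-i = solve-∀

  i-suc : ∀ a → a ℤ.- (1ℤ ℤ.+ a) ≡ -1ℤ
  i-suc = solve-∀

  suc-i : ∀ a → (1ℤ ℤ.+ a) ℤ.- a ≡ 1ℤ
  suc-i = solve-∀

  data Vertical : Direction → Set where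
    north : Vertical north
    south : Vertical south

  displacement-segment : ∀ t → Vertical (Tile.direction t) → ∀ v i →
    displacement (segment (t at v) i) ≡ sideVector (Tile.direction t) i
  displacement-segment (tile _ _ _ north) _ (a , b) zero             = cong₂ _,_ (i-pred a) (pred-i b)
  displacement-segment (tile _ _ _ north) _ (a , b) (suc zero)       = cong₂ _,_ (i-i a) (i-pred b)
  displacement-segment (tile _ _ _ north) _ (a , b) (suc (suc zero)) = cong₂ _,_ (pred-i a) (i-i b)
  displacement-segment (tile _ _ _ south) _ (a , b) zero             = cong₂ _,_ (i-suc a) (suc-i b)
  displacement-segment (tile _ _ _ south) _ (a , b) (suc zero)       = cong₂ _,_ (i-i a) (i-suc b)
  displacement-segment (tile _ _ _ south) _ (a , b) (suc (suc zero)) = cong₂ _,_ (suc-i a) (i-i b)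

  displacement-reverse : ∀ s → displacement (reverse s) ≡ (ℤ.- proj₁ (displacement s) , ℤ.- proj₂ (displacement s))
  displacement-reverse ((a , b) , (c , d)) = cong₂ _,_ (flip a c) (flip b d)
    where
    flip : ∀ x y → x ℤ.- y ≡ ℤ.- (y ℤ.- x)
    flip = solve-∀

  data Opposite : Direction → Direction → Set where
    north-south : Opposite north south
    south-north : Opposite south north

  share-vectors : ∀ t v i t′ v′ j → Vertical (Tile.direction t) → Vertical (Tile.direction t′) →
    Share (t at v) i (t′ at v′) j →
    sideVector (Tile.direction t) i ≡
    (ℤ.- proj₁ (sideVector (Tile.direction t′) j) , ℤ.- proj₂ (sideVector (Tile.direction t′) j))
  share-vectors t v i t′ v′ j x y s = begin
    sideVector (Tile.direction t) i                        ≡⟨ displacement-segment t x v i ⟨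
    displacement (segment (t at v) i)                      ≡⟨ cong displacement s ⟩
    displacement (reverse (segment (t′ at v′) j))          ≡⟨ displacement-reverse (segment (t′ at v′) j) ⟩
    negate (displacement (segment (t′ at v′) j))           ≡⟨ cong negate (displacement-segment t′ y v′ j) ⟩
    negate (sideVector (Tile.direction t′) j)              ∎
    where
    open ≡-Reasoning
    negate : ℤ × ℤ → ℤ × ℤ
    negate (a , b) = (ℤ.- a , ℤ.- b)

  -- Traversed counter-clockwise, a side has a vector that depends only on the direction and the
  -- side number. A common side needs opposite vectors, and the finite table of north and south
  -- tiles leaves only these pairs.
  share⇒opposite : ∀ t v i t′ v′ j → Vertical (Tile.direction t) → Vertical (Tile.direction t′) →
    Share (t at v) i (t′ at v′) j → Opposite (Tile.direction t) (Tile.direction t′) × i ≡ j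
  share⇒opposite t v i t′ v′ j x y s = table x y i j (share-vectors t v i t′ v′ j x y s)
    where
    table : ∀ {d d′} → Vertical d → Vertical d′ → ∀ i j →
      sideVector d i ≡ (ℤ.- proj₁ (sideVector d′ j) , ℤ.- proj₂ (sideVector d′ j)) →
      Opposite d d′ × i ≡ j
    table north south zero zero _ = north-south , refl
    table north south (suc zero) (suc zero) _ = north-south , refl
    table north south (suc (suc zero)) (suc (suc zero)) _ = north-south , refl
    table south north zero zero _ = south-north , refl
    table south north (suc zero) (suc zero) _ = south-north , refl
    table south north (suc (suc zero)) (suc (suc zero)) _ = south-north , refl
    table north south zero (suc zero) ()
    table north south zero (suc (suc zero)) ()
    table north south (suc zero) zero ()
    table north south (suc zero) (suc (suc zero)) ()
    table north south (suc (suc zero)) zero ()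
    table north south (suc (suc zero)) (suc zero) ()
    table south north zero (suc zero) ()
    table south north zero (suc (suc zero)) ()
    table south north (suc zero) zero ()
    table south north (suc zero) (suc (suc zero)) ()
    table south north (suc (suc zero)) zero ()
    table south north (suc (suc zero)) (suc zero) ()
    table north north zero zero ()
    table north north zero (suc zero) ()
    table north north zero (suc (suc zero)) ()
    table north north (suc zero) zero ()
    table north north (suc zero) (suc zero) ()
    table north north (suc zero) (suc (suc zero)) ()
    table north north (suc (suc zero)) zero ()
    table north north (suc (suc zero)) (suc zero) ()
    table north north (suc (suc zero)) (suc (suc zero)) ()
    table south south zero zero ()
    table south south zero (suc zero) ()
    table south south zero (suc (suc zero)) ()
    table south south (suc zero) zero ()
    table south south (suc zero) (suc zero) ()
    table south south (suc zero) (suc (suc zero)) ()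
    table south south (suc (suc zero)) zero ()
    table south south (suc (suc zero)) (suc zero) ()
    table south south (suc (suc zero)) (suc (suc zero)) ()

  bondVia : Side → Placed → Placed → ℕ
  bondVia i p q = if does (segment p i ≟ₛ reverse (segment q i)) then strengthAt p i q i else 0

  bondVia-shared : ∀ i {p q} → Share p i q i → bondVia i p q ≡ strengthAt p i q i
  bondVia-shared i {p} {q} s rewrite dec-true (segment p i ≟ₛ reverse (segment q i)) s = refl

  bondVia-positive : ∀ i {p q} → bondVia i p q ≢ 0 → Share p i q i
  bondVia-positive i {p} {q} ne with segment p i ≟ₛ reverse (segment q i)
  ... | yes s = s
  ... | no  _ = ⊥-elim (ne refl)

  -- Six of the nine pairs of sides vanish because coinciding sides carry the same number.
  bond-via : ∀ {p q} → Vertical (Tile.direction (Placed.type p)) → Vertical (Tile.direction (Placed.type q)) →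
    bond p q ≡ bondVia zero p q + (bondVia (suc zero) p q + bondVia (suc (suc zero)) p q)
  bond-via {p} {q} x y = reduce
    where
    off : ∀ i j → i ≢ j → does (segment p i ≟ₛ reverse (segment q j)) ≡ false
    off i j i≢j = dec-false (segment p i ≟ₛ reverse (segment q j))
      (λ s → i≢j (proj₂ (share⇒opposite (Placed.type p) (Placed.rightAngle p) i (Placed.type q) (Placed.rightAngle q) j x y s)))
    reduce : bond p q ≡ bondVia zero p q + (bondVia (suc zero) p q + bondVia (suc (suc zero)) p q)
    reduce
      rewrite off zero (suc zero) (λ ()) | off zero (suc (suc zero)) (λ ())
            | off (suc zero) zero (λ ()) | off (suc zero) (suc (suc zero)) (λ ())
            | off (suc (suc zero)) zero (λ ()) | off (suc (suc zero)) (suc zero) (λ ())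
            = cong (λ n → bondVia zero p q + (bondVia (suc zero) p q + n)) (ℕₚ.+-identityʳ _)

-- Lattice positions and the bonds of a tile with an assembly.

module Positions where

  open Bonds
  open import Data.Empty using (⊥-elim)
  open import Data.Fin using (zero; suc)
  open import Data.Integer as ℤ using (ℤ)
  import Data.Integer.Properties as ℤₚ
  open import Data.List using (List; []; _∷_; map)
  open import Data.Nat.ListAction using (sum)
  open import Data.List.Membership.Propositional using (_∈_)
  open import Data.List.Relation.Unary.All as All using (All)
  open import Data.List.Relation.Unary.AllPairs using (_∷_)
  open import Data.List.Relation.Unary.Any using (here; there)
  open import Data.List.Relation.Unary.Unique.Propositional using (Unique)
  open import Data.Maybe using (Maybe; just; nothing)
  open import Data.Nat using (ℕ; zero; suc; _+_; _≤_)
  import Data.Nat.Properties as ℕₚ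
  open import Data.Product using (_×_; _,_; proj₁; proj₂)
  open import Data.Sum using (_⊎_; inj₁; inj₂)
  open import Relation.Binary.PropositionalEquality

  module _ {A : Set} where

    -- Used for one side of a new tile: at most one placed tile can meet it, so the sum over the
    -- assembly collapses.
    sum-single : (f : A → ℕ) (xs : List A) → Unique xs →
      (∀ x y → f x ≢ 0 → f y ≢ 0 → x ≡ y) →
      sum (map f xs) ≡ 0 ⊎ ∃[ x ] x ∈ xs × f x ≢ 0 × sum (map f xs) ≡ f x
    sum-single f []       _          _   = inj₁ refl
    sum-single f (x ∷ xs) (x∉ ∷ uxs) one with f x in fx | sum-single f xs uxs one
    ... | zero  | inj₁ e                 = inj₁ e
    ... | zero  | inj₂ (y , y∈ , ne , e) = inj₂ (y , there y∈ , ne , e)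
    ... | suc n | inj₁ e                 =
      inj₂ (x , here refl , (λ z → ℕₚ.0≢1+n (trans (sym z) fx)) , trans (trans (cong (suc n +_) e) (ℕₚ.+-identityʳ _)) (sym fx))
    ... | suc n | inj₂ (y , y∈ , ne , e) =
      ⊥-elim (All.lookup x∉ y∈ (one x y (λ z → ℕₚ.0≢1+n (trans (sym z) fx)) ne))

    ≤-sum : (f : A → ℕ) {x : A} {xs : List A} → x ∈ xs → f x ≤ sum (map f xs)
    ≤-sum f (here refl) = ℕₚ.m≤m+n _ _
    ≤-sum f {xs = y ∷ _} (there x∈) = ℕₚ.≤-trans (≤-sum f x∈) (ℕₚ.m≤n+m _ (f y))

  -- up i j is the up triangle of row i + j with i up triangles to its right and j
  -- to its left; down i j is the down triangle below it, in row 1 + i + j.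
  data Pos : Set where
    up down : (i j : ℕ) → Pos

  neg : ℕ → ℤ
  neg n = ℤ.- (ℤ.+ n)

  pred-neg : ∀ n → ℤ.pred (neg n) ≡ neg (suc n)
  pred-neg zero    = refl
  pred-neg (suc n) = refl

  suc-neg : ∀ n → ℤ.suc (neg (suc n)) ≡ neg n
  suc-neg n = trans (cong ℤ.suc (sym (pred-neg n))) (ℤₚ.suc-pred (neg n))

  neg-injective : ∀ {m n} → neg m ≡ neg n → m ≡ n
  neg-injective e = ℤₚ.+-injective (ℤₚ.neg-injective e)

  directionOf : Pos → Direction
  directionOf (up _ _)   = north
  directionOf (down _ _) = south

  vertexOf : Pos → Vertex
  vertexOf (up i j)   = neg i , neg j
  vertexOf (down i j) = neg (suc i) , neg (suc j)

  vertexOf-injective : ∀ p q → directionOf p ≡ directionOf q → vertexOf p ≡ vertexOf q → p ≡ q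
  vertexOf-injective (up i j) (up i′ j′) _ e =
    cong₂ up (neg-injective (cong proj₁ e)) (neg-injective (cong proj₂ e))
  vertexOf-injective (down i j) (down i′ j′) _ e =
    cong₂ down (ℕₚ.suc-injective (neg-injective (cong proj₁ e))) (ℕₚ.suc-injective (neg-injective (cong proj₂ e)))

  rightOf leftOf : ℕ → ℕ → Maybe Pos
  rightOf zero    j       = nothing
  rightOf (suc i) j       = just (down i j)
  leftOf  i       zero    = nothing
  leftOf  i       (suc j) = just (down i j)

  neighbour : Pos → Side → Maybe Pos
  neighbour (up i j)   zero             = just (down i j)
  neighbour (up i j)   (suc zero)       = rightOf i j
  neighbour (up i j)   (suc (suc zero)) = leftOf i j
  neighbour (down i j) zero             = just (up i j)
  neighbour (down i j) (suc zero)       = just (up (suc i) j)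
  neighbour (down i j) (suc (suc zero)) = just (up i (suc j))

  -- Glues are attached to edges, each edge being a side of exactly one up
  -- position; a down position has edges with its three neighbours.
  module Lattice (bottom right left : ℕ → ℕ → Glue)
                 (right-boundary : ∀ j → right 0 j ≡ φ) (left-boundary : ∀ i → left i 0 ≡ φ) where

    tileOf : Pos → Tile
    tileOf (up i j)   = tile (bottom i j) (right i j) (left i j) north
    tileOf (down i j) = tile (bottom i j) (right (suc i) j) (left i (suc j)) south

    place : Pos → Placed
    place p = tileOf p at vertexOf p

    vertical-tileOf : ∀ p → Vertical (Tile.direction (tileOf p))
    vertical-tileOf (up _ _)   = north
    vertical-tileOf (down _ _) = south

    place-injective : ∀ p q → place p ≡ place q → p ≡ q
    place-injective p q e = vertexOf-injective p q (same p q e) (cong Placed.rightAngle e)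
      where
      same : ∀ p q → place p ≡ place q → directionOf p ≡ directionOf q
      same (up _ _)   (up _ _)   _ = refl
      same (down _ _) (down _ _) _ = refl

    -- Up and down triangles have opposite vectors on side `s`, so the segment reveals the
    -- direction; its endpoints then give the right-angle vertex.
    segment-injective : ∀ s p q → segment (place p) s ≡ segment (place q) s → p ≡ q
    segment-injective s p q e = vertexOf-injective p q same (vertices p q s same e)
      where
      vec : sideVector (directionOf p) s ≡ sideVector (directionOf q) s
      vec = trans (sym (side p)) (trans (cong displacement e) (side q))
        where
        side : ∀ r → displacement (segment (place r) s) ≡ sideVector (directionOf r) s
        side (up i j)   = displacement-segment (tileOf (up i j)) north _ s
        side (down i j) = displacement-segment (tileOf (down i j)) south _ s
      same : directionOf p ≡ directionOf q
      same = table p q s vec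
        where
        table : ∀ p q s → sideVector (directionOf p) s ≡ sideVector (directionOf q) s → directionOf p ≡ directionOf q
        table (up _ _)   (up _ _)   _ _ = refl
        table (down _ _) (down _ _) _ _ = refl
        table (up _ _)   (down _ _) zero ()
        table (up _ _)   (down _ _) (suc zero) ()
        table (up _ _)   (down _ _) (suc (suc zero)) ()
        table (down _ _) (up _ _)   zero ()
        table (down _ _) (up _ _)   (suc zero) ()
        table (down _ _) (up _ _)   (suc (suc zero)) ()
      vertices : ∀ p q s → directionOf p ≡ directionOf q →
        segment (place p) s ≡ segment (place q) s → vertexOf p ≡ vertexOf q
      vertices (up _ _)   (up _ _)   zero             _ e = cong₂ _,_ (cong (λ z → proj₁ (proj₂ z)) e) (cong (λ z → proj₂ (proj₁ z)) e)
      vertices (up _ _)   (up _ _)   (suc zero)       _ e = cong proj₂ e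
      vertices (up _ _)   (up _ _)   (suc (suc zero)) _ e = cong proj₁ e
      vertices (down _ _) (down _ _) zero             _ e = cong₂ _,_ (cong (λ z → proj₁ (proj₂ z)) e) (cong (λ z → proj₂ (proj₁ z)) e)
      vertices (down _ _) (down _ _) (suc zero)       _ e = cong proj₂ e
      vertices (down _ _) (down _ _) (suc (suc zero)) _ e = cong proj₁ e

    reverse-injective : ∀ {s s′} → reverse s ≡ reverse s′ → s ≡ s′
    reverse-injective = cong reverse

    -- A tile beside a position `q` either sits at a position itself, or lies across one of the two
    -- legs of the growing triangle. There the glue is φ and nothing can bond. Below the last row no
    -- such case is needed, as positions extend downwards without bound.
    data Touches (d : Direction) (v : Vertex) (s : Side) (q : Pos) : Set where
      inner    : ∀ p → directionOf p ≡ d → vertexOf p ≡ v → neighbour p s ≡ just q → Touches d v s q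
      boundary : glueOn (tileOf q) s ≡ φ → Touches d v s q

    touches : ∀ {t v} s q → Vertical (Tile.direction t) → Share (t at v) s (place q) s → Touches (Tile.direction t) v s q
    touches {t} {v} s q x e = table {t} x s q e (proj₁ (share⇒opposite t v s (tileOf q) (vertexOf q) s x (vertical-tileOf q) e))
      where
      table : ∀ {t v} → Vertical (Tile.direction t) → ∀ s q → Share (t at v) s (place q) s →
        Opposite (Tile.direction t) (Tile.direction (tileOf q)) → Touches (Tile.direction t) v s q
      table {tile _ _ _ north} {a , b} _ zero (down i j) e north-south =
        inner (up i j) refl (cong₂ _,_ (trans (sym (suc-neg i)) (sym (cong (λ z → proj₁ (proj₂ z)) e)))
                                       (trans (sym (suc-neg j)) (sym (cong (λ z → proj₂ (proj₁ z)) e)))) refl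
      table {tile _ _ _ north} {a , b} _ (suc zero) (down i j) e north-south =
        inner (up (suc i) j) refl (cong₂ _,_ (sym (cong (λ z → proj₁ (proj₂ z)) e))
                                       (trans (sym (suc-neg j)) (sym (cong (λ z → proj₂ (proj₂ z)) e)))) refl
      table {tile _ _ _ north} {a , b} _ (suc (suc zero)) (down i j) e north-south =
        inner (up i (suc j)) refl (cong₂ _,_ (trans (sym (suc-neg i)) (sym (cong (λ z → proj₁ (proj₁ z)) e)))
                                       (sym (cong (λ z → proj₂ (proj₁ z)) e))) refl
      table {tile _ _ _ south} {c , d} _ zero (up i j) e south-north =
        inner (down i j) refl (cong₂ _,_ (trans (sym (pred-neg i)) (sym (cong (λ z → proj₁ (proj₂ z)) e)))
                                       (trans (sym (pred-neg j)) (sym (cong (λ z → proj₂ (proj₁ z)) e)))) refl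
      table {tile _ _ _ south} {c , d} _ (suc zero) (up zero j) e south-north = boundary (right-boundary j)
      table {tile _ _ _ south} {c , d} _ (suc zero) (up (suc i) j) e south-north =
        inner (down i j) refl (cong₂ _,_ (sym (cong (λ z → proj₁ (proj₂ z)) e))
                                       (trans (sym (pred-neg j)) (sym (cong (λ z → proj₂ (proj₂ z)) e)))) refl
      table {tile _ _ _ south} {c , d} _ (suc (suc zero)) (up i zero) e south-north = boundary (left-boundary i)
      table {tile _ _ _ south} {c , d} _ (suc (suc zero)) (up i (suc j)) e south-north =
        inner (down i j) refl (cong₂ _,_ (trans (sym (pred-neg i)) (sym (cong (λ z → proj₁ (proj₁ z)) e)))
                                       (sym (cong (λ z → proj₂ (proj₁ z)) e))) refl

    glue-neighbour : ∀ p s q → neighbour p s ≡ just q → glueOn (tileOf q) s ≡ glueOn (tileOf p) s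
    glue-neighbour (up i j)       zero             _ refl = refl
    glue-neighbour (up (suc i) j) (suc zero)       _ refl = refl
    glue-neighbour (up i (suc j)) (suc (suc zero)) _ refl = refl
    glue-neighbour (down i j)     zero             _ refl = refl
    glue-neighbour (down i j)     (suc zero)       _ refl = refl
    glue-neighbour (down i j)     (suc (suc zero)) _ refl = refl

    share-neighbour : ∀ p s q → neighbour p s ≡ just q → Share (place p) s (place q) s
    share-neighbour (up i j) zero _ refl =
      cong₂ _,_ (cong₂ _,_ (pred-neg i) (sym (suc-neg j))) (cong₂ _,_ (sym (suc-neg i)) (pred-neg j))
    share-neighbour (up (suc i) j) (suc zero) _ refl =
      cong₂ _,_ (cong₂ _,_ refl (pred-neg j)) (cong₂ _,_ refl (sym (suc-neg j)))
    share-neighbour (up i (suc j)) (suc (suc zero)) _ refl =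
      cong₂ _,_ (cong₂ _,_ (sym (suc-neg i)) refl) (cong₂ _,_ (pred-neg i) refl)
    share-neighbour (down i j) zero _ refl =
      cong₂ _,_ (cong₂ _,_ (suc-neg i) (sym (pred-neg j))) (cong₂ _,_ (sym (pred-neg i)) (suc-neg j))
    share-neighbour (down i j) (suc zero) _ refl =
      cong₂ _,_ (cong₂ _,_ refl (suc-neg j)) (cong₂ _,_ refl (sym (pred-neg j)))
    share-neighbour (down i j) (suc (suc zero)) _ refl =
      cong₂ _,_ (cong₂ _,_ (sym (pred-neg i)) refl) (cong₂ _,_ (suc-neg i) refl)

    viaSum : Side → Placed → List Pos → ℕ
    viaSum s p ps = sum (map (λ q → bondVia s p (place q)) ps)

    bond-sum : ∀ t v ps → Vertical (Tile.direction t) →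
      sum (map (bond (t at v)) (map place ps)) ≡
      viaSum zero (t at v) ps + (viaSum (suc zero) (t at v) ps + viaSum (suc (suc zero)) (t at v) ps)
    bond-sum t v []       x = refl
    bond-sum t v (q ∷ ps) x = begin
      bond (t at v) (place q) + sum (map (bond (t at v)) (map place ps))
        ≡⟨ cong₂ _+_ (bond-via {t at v} {place q} x (vertical-tileOf q)) (bond-sum t v ps x) ⟩
      (a + (b + c)) + (a′ + (b′ + c′))  ≡⟨ interchange a (b + c) a′ (b′ + c′) ⟩
      (a + a′) + ((b + c) + (b′ + c′))  ≡⟨ cong (a + a′ +_) (interchange b c b′ c′) ⟩
      (a + a′) + ((b + b′) + (c + c′))  ∎
      where
      open ≡-Reasoning
      open import Algebra.Properties.CommutativeSemigroup ℕₚ.+-commutativeSemigroup using (interchange)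
      a = bondVia zero (t at v) (place q)
      b = bondVia (suc zero) (t at v) (place q)
      c = bondVia (suc (suc zero)) (t at v) (place q)
      a′ = viaSum zero (t at v) ps
      b′ = viaSum (suc zero) (t at v) ps
      c′ = viaSum (suc (suc zero)) (t at v) ps

    g-φʳ : ∀ x → g x φ ≡ 0
    g-φʳ φ          = refl
    g-φʳ (glue _ _) = refl

    viaSum-cases : ∀ t v ps s → Vertical (Tile.direction t) → Unique ps →
      viaSum s (t at v) ps ≡ 0 ⊎
      ∃[ p ] ∃[ q ] q ∈ ps × directionOf p ≡ Tile.direction t × vertexOf p ≡ v × neighbour p s ≡ just q
        × viaSum s (t at v) ps ≡ g (glueOn t s) (glueOn (tileOf p) s)
    viaSum-cases t v ps s x ups with sum-single (λ q → bondVia s (t at v) (place q)) ps ups one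
      where
      one : ∀ q q′ → bondVia s (t at v) (place q) ≢ 0 → bondVia s (t at v) (place q′) ≢ 0 → q ≡ q′
      one q q′ n n′ = segment-injective s q q′ (reverse-injective
        (trans (sym (bondVia-positive s {t at v} {place q} n)) (bondVia-positive s {t at v} {place q′} n′)))
    ... | inj₁ e = inj₁ e
    ... | inj₂ (q , q∈ , n , e) = cases (touches {t} s q x shared)
      where
      shared : Share (t at v) s (place q) s
      shared = bondVia-positive s {t at v} {place q} n
      value : viaSum s (t at v) ps ≡ g (glueOn t s) (glueOn (tileOf q) s)
      value = trans e (bondVia-shared s {t at v} {place q} shared)
      cases : Touches (Tile.direction t) v s q → _
      cases (inner p d w nb) = inj₂ (p , q , q∈ , d , w , nb , trans value (cong (g (glueOn t s)) (glue-neighbour p s q nb)))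
      cases (boundary b) = inj₁ (trans value (trans (cong (g (glueOn t s)) b) (g-φʳ (glueOn t s))))

    Via : Tile → Pos → List Pos → Side → ℕ → Set
    Via t p ps s n = n ≡ 0 ⊎ ∃[ q ] q ∈ ps × neighbour p s ≡ just q × n ≡ g (glueOn t s) (glueOn (tileOf p) s)

    -- A nonzero bond goes through some common side, which pins the tile to a position. All
    -- contributing sides pin it to the same one, since direction and vertex determine a position.
    -- Placements outside the quadrant of positions are thereby excluded.
    bound : ∀ t v ps → Vertical (Tile.direction t) → Unique ps → sum (map (bond (t at v)) (map place ps)) ≢ 0 →
      ∃[ p ] directionOf p ≡ Tile.direction t × vertexOf p ≡ v ×
      ∃[ a ] ∃[ b ] ∃[ c ] sum (map (bond (t at v)) (map place ps)) ≡ a + (b + c)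
        × Via t p ps zero a × Via t p ps (suc zero) b × Via t p ps (suc (suc zero)) c
    bound t v ps x ups n = locate (case zero) (case (suc zero)) (case (suc (suc zero)))
      where
      case : ∀ s → _
      case s = viaSum-cases t v ps s x ups
      finish : ∀ p → directionOf p ≡ Tile.direction t → vertexOf p ≡ v → _
      finish p d w = p , d , w , _ , _ , _ , bond-sum t v ps x , at-p zero , at-p (suc zero) , at-p (suc (suc zero))
        where
        at-p : ∀ s → Via t p ps s (viaSum s (t at v) ps)
        at-p s with case s
        ... | inj₁ e = inj₁ e
        ... | inj₂ (p′ , q , q∈ , d′ , w′ , nb , e)
            with refl ← vertexOf-injective p p′ (trans d (sym d′)) (trans w (sym w′)) = inj₂ (q , q∈ , nb , e)
      locate : _ → _ → _ → _
      locate (inj₂ (p , _ , _ , d , w , _)) _ _ = finish p d w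
      locate (inj₁ _) (inj₂ (p , _ , _ , d , w , _)) _ = finish p d w
      locate (inj₁ _) (inj₁ _) (inj₂ (p , _ , _ , d , w , _)) = finish p d w
      locate (inj₁ a) (inj₁ b) (inj₁ c) = ⊥-elim (n (trans (bond-sum t v ps x) (cong₂ _+_ a (cong₂ _+_ b c))))

-- Rational geometry: disjointness of the small triangles and the region they cover.

module Geometry where

  open Bonds
  open Positions
  open import Data.Empty using (⊥; ⊥-elim)
  open import Data.Integer as ℤ using (ℤ)
  import Data.Integer.Properties as ℤₚ
  open import Data.List using (map)
  open import Data.List.Membership.Propositional using (_∈_)
  open import Data.List.Membership.Propositional.Properties using (∈-map⁺; ∈-map⁻)
  open import Function.Bundles using (mk⇔)
  open import Data.Nat as ℕ using (ℕ; zero; suc)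
  import Data.Nat.Properties as ℕₚ
  open import Data.Product using (_×_; _,_; proj₁; proj₂)
  open import Data.Rational as ℚ using (ℚ; 0ℚ; 1ℚ; _/_)
  import Data.Rational.Properties as ℚₚ
  open import Data.Maybe using (Maybe; just; nothing)
  open import Level using (0ℓ)
  open import Tactic.RingSolver using (solve-∀)
  open import Tactic.RingSolver.Core.AlmostCommutativeRing using (AlmostCommutativeRing; fromCommutativeRing)
  open import Data.Rational.Unnormalised as ℚᵘ using (mkℚᵘ; *≡*)
  import Data.Rational.Unnormalised.Properties as ℚᵘₚ
  open import Relation.Binary.PropositionalEquality
  open import Relation.Nullary using (Dec; yes; no)
  open import Relation.Nullary.Decidable using (from-yes)

  opaque
    -- Kept opaque so that normalised fractions do not unfold; later arithmetic goes through the
    -- lemmas of this block.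
    fromℕ : ℕ → ℚ
    fromℕ n = ℤ.+ n / 1

    fromℕ-≃ : ∀ n → ℚ.toℚᵘ (fromℕ n) ℚᵘ.≃ mkℚᵘ (ℤ.+ n) 0
    fromℕ-≃ n = ℚₚ.toℚᵘ-fromℚᵘ (mkℚᵘ (ℤ.+ n) 0)

    fromℕ-suc : ∀ n → fromℕ (suc n) ≡ 1ℚ ℚ.+ fromℕ n
    fromℕ-suc n = ℚₚ.toℚᵘ-injective (begin
      ℚ.toℚᵘ (fromℕ (suc n))                     ≈⟨ fromℕ-≃ (suc n) ⟩
      mkℚᵘ (ℤ.+ suc n) 0                         ≈⟨ *≡* (trans (ℤₚ.*-identityʳ _) (trans (sym (cong (λ z → ℤ.+ 1 ℤ.+ z) (ℤₚ.*-identityʳ (ℤ.+ n)))) (sym (ℤₚ.*-identityʳ _)))) ⟩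
      ℚ.toℚᵘ 1ℚ ℚᵘ.+ mkℚᵘ (ℤ.+ n) 0              ≈⟨ ℚᵘₚ.+-congʳ (ℚ.toℚᵘ 1ℚ) (ℚᵘₚ.≃-sym (fromℕ-≃ n)) ⟩
      ℚ.toℚᵘ 1ℚ ℚᵘ.+ ℚ.toℚᵘ (fromℕ n)            ≈⟨ ℚᵘₚ.≃-sym (ℚₚ.toℚᵘ-homo-+ 1ℚ (fromℕ n)) ⟩
      ℚ.toℚᵘ (1ℚ ℚ.+ fromℕ n)                    ∎)
      where open ℚᵘₚ.≃-Reasoning

    fromℕ-/1 : ∀ n → fromℕ n ≡ ℤ.+ n / 1
    fromℕ-/1 n = refl

    fromℕ-0 : fromℕ 0 ≡ 0ℚ
    fromℕ-0 = refl

    fromℕ-≥0 : ∀ n → 0ℚ ℚ.≤ fromℕ n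
    fromℕ-≥0 n = ℚₚ.nonNegative⁻¹ (fromℕ n) {{ℚₚ.normalize-nonNeg n 1}}

    neg-/1 : ∀ n → neg n / 1 ≡ ℚ.- fromℕ n
    neg-/1 zero    = refl
    neg-/1 (suc n) = refl

  fromℕ-+ : ∀ m n → fromℕ (m ℕ.+ n) ≡ fromℕ m ℚ.+ fromℕ n
  fromℕ-+ zero    n = sym (trans (cong (ℚ._+ fromℕ n) fromℕ-0) (ℚₚ.+-identityˡ (fromℕ n)))
  fromℕ-+ (suc m) n = begin
    fromℕ (suc (m ℕ.+ n))              ≡⟨ fromℕ-suc (m ℕ.+ n) ⟩
    1ℚ ℚ.+ fromℕ (m ℕ.+ n)             ≡⟨ cong (1ℚ ℚ.+_) (fromℕ-+ m n) ⟩
    1ℚ ℚ.+ (fromℕ m ℚ.+ fromℕ n)       ≡⟨ sym (ℚₚ.+-assoc 1ℚ (fromℕ m) (fromℕ n)) ⟩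
    (1ℚ ℚ.+ fromℕ m) ℚ.+ fromℕ n       ≡⟨ cong (ℚ._+ fromℕ n) (sym (fromℕ-suc m)) ⟩
    fromℕ (suc m) ℚ.+ fromℕ n          ∎
    where open ≡-Reasoning

  fromℕ-mono-≤ : ∀ {m n} → m ℕ.≤ n → fromℕ m ℚ.≤ fromℕ n
  fromℕ-mono-≤ {m} {n} m≤n = subst (fromℕ m ℚ.≤_) (trans (sym (fromℕ-+ m (n ℕ.∸ m))) (cong fromℕ (ℕₚ.m+[n∸m]≡n m≤n)))
    (subst (ℚ._≤ fromℕ m ℚ.+ fromℕ (n ℕ.∸ m)) (ℚₚ.+-identityʳ (fromℕ m)) (ℚₚ.+-monoʳ-≤ (fromℕ m) (fromℕ-≥0 (n ℕ.∸ m))))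

  fromℕ-cancel-< : ∀ {m n} → fromℕ m ℚ.< fromℕ n → m ℕ.< n
  fromℕ-cancel-< {m} {n} m<n with n ℕ.≤? m
  ... | no  n≰m = ℕₚ.≰⇒> n≰m
  ... | yes n≤m = ⊥-elim (ℚₚ.<-irrefl refl (ℚₚ.<-≤-trans m<n (fromℕ-mono-≤ n≤m)))

  fromℕ-n<1+n : ∀ n → fromℕ n ℚ.< fromℕ (suc n)
  fromℕ-n<1+n n = subst₂ ℚ._<_ (ℚₚ.+-identityˡ (fromℕ n)) (sym (fromℕ-suc n)) (ℚₚ.+-monoˡ-< (fromℕ n) (from-yes (0ℚ ℚₚ.<? 1ℚ)))

  fromℕ-cancel-≤ : ∀ {m n} → fromℕ m ℚ.≤ fromℕ n → m ℕ.≤ n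
  fromℕ-cancel-≤ {m} {n} m≤n = ℕₚ.≤-pred (fromℕ-cancel-< (ℚₚ.≤-<-trans m≤n (fromℕ-n<1+n n)))

  floor-below : ∀ n {x} → 0ℚ ℚ.≤ x → x ℚ.< fromℕ n → ∃[ i ] fromℕ i ℚ.≤ x × x ℚ.< fromℕ (suc i)
  floor-below zero    {x} 0≤x x<n = ⊥-elim (ℚₚ.<-irrefl (sym fromℕ-0) (ℚₚ.≤-<-trans 0≤x x<n))
  floor-below (suc n) {x} 0≤x x<n with fromℕ n ℚₚ.≤? x
  ... | yes n≤x = n , n≤x , x<n
  ... | no  n≰x = floor-below n 0≤x (ℚₚ.≰⇒> n≰x)

  -- Leg coordinates at a lattice position, as functions of the negated
  -- coordinates of the point.
  legs : Pos → ℚ → ℚ → ℚ × ℚ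
  legs (up i j)   x y = x ℚ.- fromℕ i , y ℚ.- fromℕ j
  legs (down i j) x y = (1ℚ ℚ.+ fromℕ i) ℚ.- x , (1ℚ ℚ.+ fromℕ j) ℚ.- y

  private
    isZero : ∀ x → Maybe (0ℚ ≡ x)
    isZero x with 0ℚ ℚₚ.≟ x
    ... | yes e = just e
    ... | no  _ = nothing

    ring : AlmostCommutativeRing 0ℓ 0ℓ
    ring = fromCommutativeRing ℚₚ.+-*-commutativeRing isZero

    neg-minus-comm : ∀ n x → (ℚ.- n) ℚ.- x ≡ (ℚ.- x) ℚ.- n
    neg-minus-comm = solve-∀ ring

    minus-neg : ∀ n x → x ℚ.- (ℚ.- n) ≡ n ℚ.- (ℚ.- x)
    minus-neg = solve-∀ ring

    minus-plus : ∀ a b → (b ℚ.- a) ℚ.+ a ≡ b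
    minus-plus = solve-∀ ring

    up-slackˡ : ∀ i j x y → (1ℚ ℚ.- ((x ℚ.- i) ℚ.+ (y ℚ.- j))) ℚ.+ (y ℚ.- j) ≡ (1ℚ ℚ.+ i) ℚ.- x
    up-slackˡ = solve-∀ ring

    up-slackʳ : ∀ i j x y → (1ℚ ℚ.- ((x ℚ.- i) ℚ.+ (y ℚ.- j))) ℚ.+ (x ℚ.- i) ≡ (1ℚ ℚ.+ j) ℚ.- y
    up-slackʳ = solve-∀ ring

    down-slackˡ : ∀ i j x y → (1ℚ ℚ.- (((1ℚ ℚ.+ i) ℚ.- x) ℚ.+ ((1ℚ ℚ.+ j) ℚ.- y))) ℚ.+ ((1ℚ ℚ.+ j) ℚ.- y) ≡ x ℚ.- i
    down-slackˡ = solve-∀ ring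

    down-slackʳ : ∀ i j x y → (1ℚ ℚ.- (((1ℚ ℚ.+ i) ℚ.- x) ℚ.+ ((1ℚ ℚ.+ j) ℚ.- y))) ℚ.+ ((1ℚ ℚ.+ i) ℚ.- x) ≡ y ℚ.- j
    down-slackʳ = solve-∀ ring

    up+down : ∀ i j x y → ((x ℚ.- i) ℚ.+ (y ℚ.- j)) ℚ.+ (((1ℚ ℚ.+ i) ℚ.- x) ℚ.+ ((1ℚ ℚ.+ j) ℚ.- y)) ≡ 1ℚ ℚ.+ 1ℚ
    up+down = solve-∀ ring

    add-back : ∀ x i → (x ℚ.- i) ℚ.+ i ≡ x ℚ.- 0ℚ
    add-back = solve-∀ ring

    up-hypotenuse : ∀ i j x y → 1ℚ ℚ.- ((x ℚ.- i) ℚ.+ (y ℚ.- j)) ≡ (1ℚ ℚ.+ (i ℚ.+ j)) ℚ.- (x ℚ.+ y)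
    up-hypotenuse = solve-∀ ring

    down-boundˡ : ∀ i j x y → (1ℚ ℚ.- (((1ℚ ℚ.+ i) ℚ.- x) ℚ.+ ((1ℚ ℚ.+ j) ℚ.- y))) ℚ.+ ((1ℚ ℚ.+ j) ℚ.- y) ℚ.+ i ≡ x ℚ.- 0ℚ
    down-boundˡ = solve-∀ ring

    down-boundʳ : ∀ i j x y → (1ℚ ℚ.- (((1ℚ ℚ.+ i) ℚ.- x) ℚ.+ ((1ℚ ℚ.+ j) ℚ.- y))) ℚ.+ ((1ℚ ℚ.+ i) ℚ.- x) ℚ.+ j ≡ y ℚ.- 0ℚ
    down-boundʳ = solve-∀ ring

    down-hypotenuse : ∀ i j x y → ((1ℚ ℚ.+ i) ℚ.- x) ℚ.+ ((1ℚ ℚ.+ j) ℚ.- y) ≡ (1ℚ ℚ.+ (1ℚ ℚ.+ (i ℚ.+ j))) ℚ.- (x ℚ.+ y)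
    down-hypotenuse = solve-∀ ring

    minus-sumˡ : ∀ n x y → (n ℚ.- (x ℚ.+ y)) ℚ.+ y ≡ n ℚ.- x
    minus-sumˡ = solve-∀ ring

    minus-sumʳ : ∀ n x y → (n ℚ.- (x ℚ.+ y)) ℚ.+ x ≡ n ℚ.- y
    minus-sumʳ = solve-∀ ring

    up-excess : ∀ i j x y → ((x ℚ.- i) ℚ.+ (y ℚ.- j)) ℚ.- 1ℚ ≡ (x ℚ.+ y) ℚ.- (1ℚ ℚ.+ (i ℚ.+ j))
    up-excess = solve-∀ ring

    up-excess-down : ∀ i j x y → ((x ℚ.- i) ℚ.+ (y ℚ.- j)) ℚ.- 1ℚ ≡ 1ℚ ℚ.- (((1ℚ ℚ.+ i) ℚ.- x) ℚ.+ ((1ℚ ℚ.+ j) ℚ.- y))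
    up-excess-down = solve-∀ ring

    shift-leg : ∀ i x → (x ℚ.- (1ℚ ℚ.+ i)) ℚ.+ 1ℚ ≡ (x ℚ.- i) ℚ.- 0ℚ
    shift-leg = solve-∀ ring

    shift-hypotenuseˡ : ∀ i j x y → ((1ℚ ℚ.+ i) ℚ.+ j) ℚ.- (x ℚ.+ y) ≡ 1ℚ ℚ.- ((x ℚ.- i) ℚ.+ (y ℚ.- j))
    shift-hypotenuseˡ = solve-∀ ring

    shift-hypotenuseʳ : ∀ i j x y → (i ℚ.+ (1ℚ ℚ.+ j)) ℚ.- (x ℚ.+ y) ≡ 1ℚ ℚ.- ((x ℚ.- i) ℚ.+ (y ℚ.- j))
    shift-hypotenuseʳ = solve-∀ ring

    minus-minus : ∀ a h → a ℚ.- (a ℚ.- h) ≡ h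
    minus-minus = solve-∀ ring

    plus-minus : ∀ a h → (a ℚ.+ h) ℚ.- a ≡ h
    plus-minus = solve-∀ ring

  private
    up-leg : ∀ n x → ℚ.- n ℚ.- x ≡ ℚ.- x ℚ.- n
    up-leg = neg-minus-comm

    down-leg : ∀ n x → x ℚ.- ℚ.- n ≡ n ℚ.- ℚ.- x
    down-leg = minus-neg

  legCoordinates-legs : ∀ p x y → legCoordinates (directionOf p) (vertexOf p) (x , y) ≡ legs p (ℚ.- x) (ℚ.- y)
  legCoordinates-legs (up i j) x y = cong₂ _,_ (side i x) (side j y)
    where
    side : ∀ n x → neg n / 1 ℚ.- x ≡ ℚ.- x ℚ.- fromℕ n
    side n x = trans (cong (λ z → z ℚ.- x) (neg-/1 n)) (up-leg (fromℕ n) x)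
  legCoordinates-legs (down i j) x y = cong₂ _,_ (side i x) (side j y)
    where
    side : ∀ n x → x ℚ.- neg (suc n) / 1 ≡ (1ℚ ℚ.+ fromℕ n) ℚ.- ℚ.- x
    side n x = trans (cong (λ z → x ℚ.- z) (neg-/1 (suc n))) (trans (down-leg (fromℕ (suc n)) x) (cong (λ z → z ℚ.- ℚ.- x) (fromℕ-suc n)))

  private
    0≤- : ∀ {a b} → a ℚ.≤ b → 0ℚ ℚ.≤ b ℚ.- a
    0≤- {a} {b} h = subst (ℚ._≤ b ℚ.- a) (ℚₚ.+-inverseʳ a) (ℚₚ.+-monoˡ-≤ (ℚ.- a) h)

    0<- : ∀ {a b} → a ℚ.< b → 0ℚ ℚ.< b ℚ.- a
    0<- {a} {b} h = subst (ℚ._< b ℚ.- a) (ℚₚ.+-inverseʳ a) (ℚₚ.+-monoˡ-< (ℚ.- a) h)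

    cancel : ∀ a b → (b ℚ.- a) ℚ.+ a ≡ b
    cancel = minus-plus

    -- Linear inequalities are proved by certificates: one of the ring identities above writes the
    -- wanted slack as a sum of slacks already known to be nonnegative.
    from-0≤ : ∀ {d a b} → 0ℚ ℚ.≤ d → d ≡ b ℚ.- a → a ℚ.≤ b
    from-0≤ {_} {a} {b} h refl = subst₂ ℚ._≤_ (ℚₚ.+-identityˡ a) (cancel a b) (ℚₚ.+-monoˡ-≤ a h)

    from-0< : ∀ {d a b} → 0ℚ ℚ.< d → d ≡ b ℚ.- a → a ℚ.< b
    from-0< {_} {a} {b} h refl = subst₂ ℚ._<_ (ℚₚ.+-identityˡ a) (cancel a b) (ℚₚ.+-monoˡ-< a h)

    infixl 6 _⊕_ _⊞_
    _⊕_ : ∀ {a b} → 0ℚ ℚ.≤ a → 0ℚ ℚ.≤ b → 0ℚ ℚ.≤ a ℚ.+ b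
    _⊕_ = ℚₚ.+-mono-≤

    _⊞_ : ∀ {a b} → 0ℚ ℚ.< a → 0ℚ ℚ.< b → 0ℚ ℚ.< a ℚ.+ b
    _⊞_ = ℚₚ.+-mono-<

  Interior′ : Pos → ℚ → ℚ → Set
  Interior′ p x y = let (s , t) = legs p x y in (0ℚ ℚ.< s) × (0ℚ ℚ.< t) × (s ℚ.+ t ℚ.< 1ℚ)

  Inside′ : Pos → ℚ → ℚ → Set
  Inside′ p x y = let (s , t) = legs p x y in (0ℚ ℚ.≤ s) × (0ℚ ℚ.≤ t) × (s ℚ.+ t ℚ.≤ 1ℚ)

  cell : Pos → ℕ × ℕ
  cell (up i j)   = i , j
  cell (down i j) = i , j

  -- One bound on each coordinate is the positivity of a leg coordinate; the opposite bound adds the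
  -- slack of the hypotenuse to the other leg coordinate.
  interior-cell : ∀ p {x y} → Interior′ p x y →
    (fromℕ (proj₁ (cell p)) ℚ.< x × x ℚ.< 1ℚ ℚ.+ fromℕ (proj₁ (cell p))) ×
    (fromℕ (proj₂ (cell p)) ℚ.< y × y ℚ.< 1ℚ ℚ.+ fromℕ (proj₂ (cell p)))
  interior-cell (up i j) {x} {y} (s , t , u) =
    (from-0< s refl , from-0< (0<- u ⊞ t) (up-slackˡ (fromℕ i) (fromℕ j) x y)) ,
    (from-0< t refl , from-0< (0<- u ⊞ s) (up-slackʳ (fromℕ i) (fromℕ j) x y))
  interior-cell (down i j) {x} {y} (s , t , u) =
    (from-0< (0<- u ⊞ t) (down-slackˡ (fromℕ i) (fromℕ j) x y) , from-0< s refl) ,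
    (from-0< (0<- u ⊞ s) (down-slackʳ (fromℕ i) (fromℕ j) x y) , from-0< t refl)

  unit-interval : ∀ {i k x} → fromℕ i ℚ.< x × x ℚ.< 1ℚ ℚ.+ fromℕ i → fromℕ k ℚ.< x × x ℚ.< 1ℚ ℚ.+ fromℕ k → i ≡ k
  unit-interval {i} {k} {x} (a , b) (c , d) = ℕₚ.≤-antisym (≤-of a d) (≤-of c b)
    where
    ≤-of : ∀ {m n} → fromℕ m ℚ.< x → x ℚ.< 1ℚ ℚ.+ fromℕ n → m ℕ.≤ n
    ≤-of {m} {n} l u = ℕₚ.≤-pred (fromℕ-cancel-< (ℚₚ.<-trans l (subst (x ℚ.<_) (sym (fromℕ-suc n)) u)))

  -- The four leg coordinates of the two triangles in one unit square add up to 2, while each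
  -- triangle keeps its own two below 1.
  up-down-disjoint : ∀ i j {x y} → Interior′ (up i j) x y → Interior′ (down i j) x y → ⊥
  up-down-disjoint i j {x} {y} (_ , _ , u) (_ , _ , d) =
    ℚₚ.<-irrefl (up+down (fromℕ i) (fromℕ j) x y)
      (ℚₚ.+-mono-< u d)

  interior′-unique : ∀ p q {x y} → Interior′ p x y → Interior′ q x y → p ≡ q
  interior′-unique p q a b with interior-cell p a | interior-cell q b
  ... | (i , j) | (i′ , j′) = table p q (unit-interval i i′) (unit-interval j j′) a b
    where
    table : ∀ p q {x y} → proj₁ (cell p) ≡ proj₁ (cell q) → proj₂ (cell p) ≡ proj₂ (cell q) →
      Interior′ p x y → Interior′ q x y → p ≡ q
    table (up i j)   (up _ _)   refl refl _ _ = refl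
    table (down i j) (down _ _) refl refl _ _ = refl
    table (up i j)   (down _ _) refl refl a b = ⊥-elim (up-down-disjoint i j a b)
    table (down i j) (up _ _)   refl refl a b = ⊥-elim (up-down-disjoint i j b a)

  Inside-at : ℕ → ℚ × ℚ → Set
  Inside-at n (s , t) = (0ℚ ℚ.≤ s) × (0ℚ ℚ.≤ t) × (s ℚ.+ t ℚ.≤ fromℕ n)

  Interior-at : ℚ × ℚ → Set
  Interior-at (s , t) = (0ℚ ℚ.< s) × (0ℚ ℚ.< t) × (s ℚ.+ t ℚ.< 1ℚ)

  interior-legs : ∀ d v {x y} s t → legCoordinates d v (x , y) ≡ (s , t) →
    Interior (triangle d v 1) (x , y) → (0ℚ ℚ.< s) × (0ℚ ℚ.< t) × (s ℚ.+ t ℚ.< 1ℚ)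
  interior-legs d v s t refl h = h

  overlap-unique : ∀ t t′ p q → Tile.direction t ≡ directionOf p → Tile.direction t′ ≡ directionOf q →
    Overlap (t at vertexOf p) (t′ at vertexOf q) → p ≡ q
  overlap-unique (tile _ _ _ _) (tile _ _ _ _) p q refl refl ((x , y) , a , b) =
    interior′-unique p q {ℚ.- x} {ℚ.- y}
      (interior-legs (directionOf p) (vertexOf p) _ _ (legCoordinates-legs p x y) a)
      (interior-legs (directionOf q) (vertexOf q) _ _ (legCoordinates-legs q x y) b)

  overlap-self : ∀ t t′ v → Tile.direction t ≡ Tile.direction t′ → Vertical (Tile.direction t) → Overlap (t at v) (t′ at v)
  overlap-self (tile _ _ _ north) (tile _ _ _ _) (a , b) refl _ = (a / 1 ℚ.- h , b / 1 ℚ.- h) , inside , inside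
    where
    -- Leg coordinates `(1/3 , 1/3)` give a common interior point.
    h = ℤ.+ 1 / 3
    back : ∀ a → a ℚ.- (a ℚ.- h) ≡ h
    back a = minus-minus a h
    inside : Interior-at (a / 1 ℚ.- (a / 1 ℚ.- h) , b / 1 ℚ.- (b / 1 ℚ.- h))
    inside = subst₂ (λ s t → Interior-at (s , t)) (sym (back (a / 1))) (sym (back (b / 1))) (from-yes (0ℚ ℚₚ.<? h) , from-yes (0ℚ ℚₚ.<? h) , from-yes (h ℚ.+ h ℚₚ.<? 1ℚ))
  overlap-self (tile _ _ _ south) (tile _ _ _ _) (a , b) refl _ = (a / 1 ℚ.+ h , b / 1 ℚ.+ h) , inside , inside
    where
    h = ℤ.+ 1 / 3
    back : ∀ a → (a ℚ.+ h) ℚ.- a ≡ h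
    back a = plus-minus a h
    inside : Interior-at ((a / 1 ℚ.+ h) ℚ.- a / 1 , (b / 1 ℚ.+ h) ℚ.- b / 1)
    inside = subst₂ (λ s t → Interior-at (s , t)) (sym (back (a / 1))) (sym (back (b / 1))) (from-yes (0ℚ ℚₚ.<? h) , from-yes (0ℚ ℚₚ.<? h) , from-yes (h ℚ.+ h ℚₚ.<? 1ℚ))

  -- `R` is the index of the last row, counted from 0, so the leg has length `suc R`. A down
  -- triangle belongs to the row below that of the up triangle with the same indices.
  data InTriangle (R : ℕ) : Pos → Set where
    up   : ∀ {i j} → i ℕ.+ j ℕ.≤ R → InTriangle R (up i j)
    down : ∀ {i j} → suc (i ℕ.+ j) ℕ.≤ R → InTriangle R (down i j)

  private
    0≤1 : 0ℚ ℚ.≤ 1ℚ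
    0≤1 = from-yes (0ℚ ℚₚ.≤? 1ℚ)

  fromℕ-1+[i+j] : ∀ i j → fromℕ (suc (i ℕ.+ j)) ≡ 1ℚ ℚ.+ (fromℕ i ℚ.+ fromℕ j)
  fromℕ-1+[i+j] i j = trans (fromℕ-suc (i ℕ.+ j)) (cong (1ℚ ℚ.+_) (fromℕ-+ i j))

  inside-triangle : ∀ {R p x y} → InTriangle R p → Inside′ p x y → Inside-at (suc R) (x , y)
  inside-triangle {R} {up i j} {x} {y} (up i+j≤R) (s , t , u) =
    from-0≤ (s ⊕ fromℕ-≥0 i) (add-back x (fromℕ i)) ,
    from-0≤ (t ⊕ fromℕ-≥0 j) (add-back y (fromℕ j)) ,
    ℚₚ.≤-trans
      (from-0≤ (0≤- u) (up-hypotenuse (fromℕ i) (fromℕ j) x y))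
      (ℚₚ.≤-trans (ℚₚ.≤-reflexive (sym (fromℕ-1+[i+j] i j))) (fromℕ-mono-≤ (ℕ.s≤s i+j≤R)))
  inside-triangle {R} {down i j} {x} {y} (down i+j<R) (s , t , u) =
    from-0≤ (0≤- u ⊕ t ⊕ fromℕ-≥0 i) (down-boundˡ (fromℕ i) (fromℕ j) x y) ,
    from-0≤ (0≤- u ⊕ s ⊕ fromℕ-≥0 j) (down-boundʳ (fromℕ i) (fromℕ j) x y) ,
    ℚₚ.≤-trans
      (from-0≤ (s ⊕ t) (down-hypotenuse (fromℕ i) (fromℕ j) x y))
      (ℚₚ.≤-trans (ℚₚ.≤-reflexive (sym (trans (fromℕ-suc (suc (i ℕ.+ j))) (cong (1ℚ ℚ.+_) (fromℕ-1+[i+j] i j)))))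
        (fromℕ-mono-≤ (ℕ.s≤s i+j<R)))

  private
    -- The degenerate case of the covering: the integer parts add up to `suc R` only for a lattice
    -- point on the long hypotenuse. It is a corner of an up triangle of the last row.
    corner : ∀ {R x y} i j → i ℕ.+ j ≡ suc R → fromℕ i ℚ.≤ x → fromℕ j ℚ.≤ y → x ℚ.+ y ℚ.≤ fromℕ i ℚ.+ fromℕ j →
      ∃[ p ] InTriangle R p × Inside′ p x y
    corner {R} {x} {y} (suc i) j e i≤x j≤y h =
      up i j , up (ℕₚ.≤-reflexive (ℕₚ.suc-injective e)) ,
      from-0≤ (0≤- (ℚₚ.≤-trans (ℚₚ.≤-reflexive (sym (fromℕ-suc i))) i≤x) ⊕ 0≤1) (shift-leg (fromℕ i) x) ,
      0≤- j≤y ,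
      from-0≤ (0≤- (ℚₚ.≤-trans h (ℚₚ.≤-reflexive (cong (ℚ._+ fromℕ j) (fromℕ-suc i))))) (shift-hypotenuseˡ (fromℕ i) (fromℕ j) x y)
    corner {R} {x} {y} zero (suc j) e i≤x j≤y h =
      up zero j , up (ℕₚ.≤-reflexive (ℕₚ.suc-injective e)) ,
      0≤- i≤x ,
      from-0≤ (0≤- (ℚₚ.≤-trans (ℚₚ.≤-reflexive (sym (fromℕ-suc j))) j≤y) ⊕ 0≤1) (shift-leg (fromℕ j) y) ,
      from-0≤ (0≤- (ℚₚ.≤-trans h (ℚₚ.≤-reflexive (cong (fromℕ zero ℚ.+_) (fromℕ-suc j))))) (shift-hypotenuseʳ (fromℕ zero) (fromℕ j) x y)

  triangle-covered : ∀ {R x y} → Inside-at (suc R) (x , y) → ∃[ p ] InTriangle R p × Inside′ p x y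
  triangle-covered {R} {x} {y} (0≤x , 0≤y , x+y≤N) =
    -- The bound is `suc (suc R)` because the search needs a strict one and a coordinate may equal
    -- `suc R`.
    locate (floor-below (suc (suc R)) 0≤x (below (from-0≤ (0≤- x+y≤N ⊕ 0≤y) (minus-sumˡ (fromℕ (suc R)) x y))))
           (floor-below (suc (suc R)) 0≤y (below (from-0≤ (0≤- x+y≤N ⊕ 0≤x) (minus-sumʳ (fromℕ (suc R)) x y))))
    where
    below : ∀ {z} → z ℚ.≤ fromℕ (suc R) → z ℚ.< fromℕ (suc (suc R))
    below h = ℚₚ.≤-<-trans h (fromℕ-n<1+n (suc R))
    locate : ∃[ i ] fromℕ i ℚ.≤ x × x ℚ.< fromℕ (suc i) → ∃[ j ] fromℕ j ℚ.≤ y × y ℚ.< fromℕ (suc j) →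
      ∃[ p ] InTriangle R p × Inside′ p x y
    -- The diagonal of the unit square decides: fractional parts with sum at most 1 lie in the up
    -- triangle, the others in the down triangle.
    locate (i , i≤x , x<i) (j , j≤y , y<j) = split ((x ℚ.- fromℕ i) ℚ.+ (y ℚ.- fromℕ j) ℚₚ.≤? 1ℚ)
      where
      lower : Dec (i ℕ.+ j ℕ.≤ R) → (x ℚ.- fromℕ i) ℚ.+ (y ℚ.- fromℕ j) ℚ.≤ 1ℚ → ∃[ p ] InTriangle R p × Inside′ p x y
      lower (yes i+j≤R) ≤1 = up i j , up i+j≤R , 0≤- i≤x , 0≤- j≤y , ≤1
      lower (no  i+j≰R) _  = corner i j i+j≡N i≤x j≤y
        (ℚₚ.≤-trans x+y≤N (ℚₚ.≤-reflexive (trans (cong fromℕ (sym i+j≡N)) (fromℕ-+ i j))))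
        where
        i+j≡N : i ℕ.+ j ≡ suc R
        i+j≡N = ℕₚ.≤-antisym (fromℕ-cancel-≤ (ℚₚ.≤-trans (ℚₚ.≤-reflexive (fromℕ-+ i j))
          (ℚₚ.≤-trans (ℚₚ.+-mono-≤ i≤x j≤y) x+y≤N))) (ℕₚ.≰⇒> i+j≰R)
      split : Dec ((x ℚ.- fromℕ i) ℚ.+ (y ℚ.- fromℕ j) ℚ.≤ 1ℚ) → ∃[ p ] InTriangle R p × Inside′ p x y
      split (yes ≤1) = lower (i ℕ.+ j ℕ.≤? R) ≤1
      split (no  ≰1) = down i j , down in-triangle ,
        0≤- (ℚₚ.≤-trans (ℚₚ.<⇒≤ x<i) (ℚₚ.≤-reflexive (fromℕ-suc i))) ,
        0≤- (ℚₚ.≤-trans (ℚₚ.<⇒≤ y<j) (ℚₚ.≤-reflexive (fromℕ-suc j))) ,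
        from-0≤ (0≤- (ℚₚ.<⇒≤ 1<sum)) (up-excess-down (fromℕ i) (fromℕ j) x y)
        where
        1<sum = ℚₚ.≰⇒> ≰1
        in-triangle : suc (i ℕ.+ j) ℕ.≤ R
        in-triangle = ℕₚ.≤-pred (fromℕ-cancel-< (ℚₚ.<-≤-trans
          (ℚₚ.≤-<-trans (ℚₚ.≤-reflexive (fromℕ-1+[i+j] i j)) (from-0< (0<- 1<sum) (up-excess (fromℕ i) (fromℕ j) x y)))
          x+y≤N))

  inside-legs : ∀ d v n {x y} s t → legCoordinates d v (x , y) ≡ (s , t) →
    Inside (triangle d v n) (x , y) → (0ℚ ℚ.≤ s) × (0ℚ ℚ.≤ t) × (s ℚ.+ t ℚ.≤ ℤ.+ n / 1)
  inside-legs d v n s t refl h = h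

  legs-inside : ∀ d v n {x y} s t → legCoordinates d v (x , y) ≡ (s , t) →
    (0ℚ ℚ.≤ s) × (0ℚ ℚ.≤ t) × (s ℚ.+ t ℚ.≤ ℤ.+ n / 1) → Inside (triangle d v n) (x , y)
  legs-inside d v n s t refl h = h

  origin : Vertex
  origin = ℤ.+ 0 , ℤ.+ 0

  legCoordinates-origin : ∀ x y → legCoordinates north origin (x , y) ≡ (ℚ.- x , ℚ.- y)
  legCoordinates-origin x y = cong₂ _,_ (ℚₚ.+-identityˡ (ℚ.- x)) (ℚₚ.+-identityˡ (ℚ.- y))

  module Occupancy (bottom right left : ℕ → ℕ → Glue)
                   (right-boundary : ∀ j → right 0 j ≡ φ) (left-boundary : ∀ i → left i 0 ≡ φ) where
    open Lattice bottom right left right-boundary left-boundary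

    inside-place : ∀ p {x y} → Inside (shape (place p)) (x , y) → Inside′ p (ℚ.- x) (ℚ.- y)
    inside-place p@(up _ _)   {x} {y} = inside-legs north (vertexOf p) 1 {x} {y} _ _ (legCoordinates-legs p x y)
    inside-place p@(down _ _) {x} {y} = inside-legs south (vertexOf p) 1 {x} {y} _ _ (legCoordinates-legs p x y)

    place-inside : ∀ p {x y} → Inside′ p (ℚ.- x) (ℚ.- y) → Inside (shape (place p)) (x , y)
    place-inside p@(up _ _)   {x} {y} = legs-inside north (vertexOf p) 1 {x} {y} _ _ (legCoordinates-legs p x y)
    place-inside p@(down _ _) {x} {y} = legs-inside south (vertexOf p) 1 {x} {y} _ _ (legCoordinates-legs p x y)

    occupies : ∀ R ps → (∀ {p} → p ∈ ps → InTriangle R p) → (∀ {p} → InTriangle R p → p ∈ ps) →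
      Occupies (map place ps) (triangle north origin (suc R))
    occupies R ps sound complete (x , y) = mk⇔ to from
      where
      to : ∃[ q ] q ∈ map place ps × Inside (shape q) (x , y) → Inside (triangle north origin (suc R)) (x , y)
      to (q , q∈ , h) = unpack (∈-map⁻ place q∈) h
        where
        unpack : ∀ {q} → ∃[ p ] p ∈ ps × q ≡ place p → Inside (shape q) (x , y) → Inside (triangle north origin (suc R)) (x , y)
        unpack (p , p∈ , refl) h = finish (inside-triangle (sound p∈) (inside-place p h))
          where
          finish : Inside-at (suc R) (ℚ.- x , ℚ.- y) → Inside (triangle north origin (suc R)) (x , y)
          finish (a , b , c) = legs-inside north origin (suc R) {x} {y} _ _ (legCoordinates-origin x y)
            (a , b , ℚₚ.≤-trans c (ℚₚ.≤-reflexive (fromℕ-/1 (suc R))))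
      from : Inside (triangle north origin (suc R)) (x , y) → ∃[ q ] q ∈ map place ps × Inside (shape q) (x , y)
      from h = locate (start (inside-legs north origin (suc R) {x} {y} _ _ (legCoordinates-origin x y) h))
        where
        start : (0ℚ ℚ.≤ ℚ.- x) × (0ℚ ℚ.≤ ℚ.- y) × ((ℚ.- x) ℚ.+ (ℚ.- y) ℚ.≤ ℤ.+ suc R / 1) →
          ∃[ p ] InTriangle R p × Inside′ p (ℚ.- x) (ℚ.- y)
        start (a , b , c) = triangle-covered (a , b , ℚₚ.≤-trans c (ℚₚ.≤-reflexive (sym (fromℕ-/1 (suc R)))))
        locate : ∃[ p ] InTriangle R p × Inside′ p (ℚ.- x) (ℚ.- y) → ∃[ q ] q ∈ map place ps × Inside (shape q) (x , y)
        locate (p , in-△ , h) = place p , ∈-map⁺ place (complete in-△) , place-inside p h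

-- Glues, rows of the target pattern, and the tile set.

module TileSet where

  open Bonds
  open Positions
  open Geometry
  open import Data.Bool using (Bool; true; false)
  open import Data.Empty using (⊥-elim)
  open import Data.Fin using (zero; suc)
  open import Data.List using (List; []; _∷_; _++_; upTo; cartesianProductWith)
  open import Data.List.Membership.Propositional using (_∈_)
  open import Data.List.Membership.Propositional.Properties using (∈-++⁺ˡ; ∈-++⁺ʳ; ∈-cartesianProductWith⁺; ∈-upTo⁺)
  open import Data.Nat using (ℕ; zero; suc; pred; _≤_; _<_; _<?_; s≤s)
  import Data.Nat.Properties as ℕₚ
  open import Data.Product using (_×_; _,_; proj₁; proj₂)
  open import Relation.Binary.PropositionalEquality
  open import Relation.Nullary using (¬_; Dec; yes; no)
  open import Relation.Nullary.Decidable using (True; toWitness)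

  -- The strength of a glue tells its role, so that labels need not encode it.
  symbolG markG startRG upMarkG upLG upStartG : ℕ → Glue
  symbolG σ  = glue σ 10
  markG κ    = glue κ 11
  startRG κ  = glue κ 21
  upMarkG κ  = glue κ 26
  upLG σ     = glue σ 27
  upStartG κ = glue κ 28

  rightMarkG returnG seedG startLG upRightMarkG : Glue
  rightMarkG   = glue 0 12
  returnG      = glue 0 14
  seedG        = glue 0 20
  startLG      = glue 0 22
  upRightMarkG = glue 0 29

  bit : Bool → ℕ
  bit false = 0
  bit true  = 1

  stateG upEndG endG : Bool → Glue
  stateG s = glue (bit s) 13
  upEndG s = glue (bit s) 25
  endG false = startLG
  endG true  = φ

  -- This glue transmits a pair. The state goes into the strength and the symbol into the label,
  -- which avoids a pairing function.
  upRG : Bool → ℕ → Glue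
  upRG false σ = glue σ 23
  upRG true  σ = glue σ 24

  -- Symbols: 0 is a blank and suc d is the digit d.  States: true means that a
  -- carry is pending.  Rows of type L are swept leftwards and copied, rows of
  -- type R are swept rightwards.  A row stores its left mark κ, its tape u and,
  -- for type R, the states st of the sweep.
  data Row : Set where
    S : Row
    L : (κ : ℕ) (u : ℕ → ℕ) → Row
    R : (κ : ℕ) (st : ℕ → Bool) (u : ℕ → ℕ) → Row

  -- The arguments after the row are those of the position up i j.
  bottomG rightG leftG : Row → ℕ → ℕ → Glue
  bottomG S          i       j       = seedG
  bottomG (L κ u)    i       zero    = startRG κ
  bottomG (L κ u)    zero    (suc x) = rightMarkG
  bottomG (L κ u)    (suc i) (suc x) = symbolG (u x)
  bottomG (R κ st u) i       zero    = markG κ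
  -- In row `suc x` the last symbol is number `x - 1`. Row 1 has no symbol; the truncated `pred`
  -- then refers to a state that is constantly `false`.
  bottomG (R κ st u) zero    (suc x) = endG (st (pred x))
  bottomG (R κ st u) (suc i) (suc x) = symbolG (u x)

  rightG S          i       j       = φ
  rightG (L κ u)    zero    j       = φ
  rightG (L κ u)    (suc i) zero    = upStartG κ
  rightG (L κ u)    (suc i) (suc x) = upLG (u x)
  rightG (R κ st u) zero    j       = φ
  rightG (R κ st u) (suc i) zero    = upMarkG κ
  rightG (R κ st u) (suc i) (suc x) = stateG (st x)

  leftG S          i       j       = φ
  leftG (L κ u)    i       zero    = φ
  leftG (L κ u)    zero    (suc x) = upRightMarkG
  leftG (L κ u)    (suc i) (suc x) = returnG
  leftG (R κ st u) i       zero    = φ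
  leftG (R κ st u) zero    (suc x) = upEndG (st (pred x))
  leftG (R κ st u) (suc i) (suc x) = upRG (st x) (u x)

  -- The side through which the up triangle is meant to attach; its other common sides are outputs.
  data UpInput : Row → ℕ → ℕ → Side → Set where
    R-start : ∀ {κ st u i}   → UpInput (R κ st u) (suc i) zero (suc zero)
    R-sweep : ∀ {κ st u i j} → UpInput (R κ st u) i (suc j) (suc (suc zero))
    L-start : ∀ {κ u j}      → UpInput (L κ u) zero (suc j) (suc (suc zero))
    L-sweep : ∀ {κ u i j}    → UpInput (L κ u) (suc i) j (suc zero)

  -- Here the row is the one containing the down triangle, one below that of `up i j`.
  data DownInput : Row → ℕ → ℕ → Side → Set where
    top     : ∀ {ρ i j}      → DownInput ρ i j zero
    R-sweep : ∀ {κ st u i j} → DownInput (R κ st u) i (suc j) (suc zero)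
    L-sweep : ∀ {κ u i j}    → DownInput (L κ u) (suc i) j (suc (suc zero))

  strength : Glue → ℕ
  strength φ          = 0
  strength (glue _ n) = n

  too-weak : ∀ n {_ : True (n <? 20)} → ¬ 20 ≤ n
  too-weak n {n<20} = ℕₚ.<⇒≱ (toWitness n<20)

  module Machine (b m : ℕ) (digit : ℕ → ℕ) (parity : Bool) where

    increment : ∀ d → Dec (suc d < b) → Bool × ℕ
    increment d (yes _) = false , suc (suc d)
    increment d (no  _) = true , 1

    step : Bool → ℕ → Bool × ℕ
    step false σ       = false , σ
    step true  zero    = true , zero
    step true  (suc d) = increment d (suc d <? b)

    -- The mark counts the digits still to be loaded. While loading there is no carry, so the rest
    -- of the tape is copied; afterwards the carry released here is the increment.
    load : ℕ → Bool × ℕ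
    load zero    = true , 0
    load (suc κ) = false , suc (digit κ)

    sweep : ℕ → (ℕ → ℕ) → ℕ → Bool × ℕ
    sweep κ u zero    = load κ
    sweep κ u (suc x) = step (proj₁ (sweep κ u x)) (u x)

    -- The row of type R is the optional extra one. It holds no symbol, and its states `false` allow
    -- the next row to start.
    first : Bool → Row
    first false = L m (λ _ → 0)
    first true  = R m (λ _ → false) (λ _ → 0)

    next : Row → Row
    next S          = first parity
    next (L κ u)    = R (pred κ) (λ x → proj₁ (sweep κ u x)) (λ x → proj₂ (sweep κ u x))
    next (R κ st u) = L κ u

    row : ℕ → Row
    row zero    = S
    row (suc r) = next (row r)

    data Kind : Set where
      seed uRM dSeed dStartL         : Kind
      uEnd dEnd                      : Bool → Kind
      uR dR                          : Bool → ℕ → Kind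
      uL dL uMark uStart dStartR dMark : ℕ → Kind

    toTile : Kind → Tile
    toTile seed        = tile seedG φ φ north
    toTile uRM         = tile rightMarkG φ upRightMarkG north
    toTile (uEnd s)    = tile (endG s) φ (upEndG s) north
    toTile (uR s σ)    = tile (symbolG σ) (stateG s) (upRG s σ) north
    toTile (uL σ)      = tile (symbolG σ) (upLG σ) returnG north
    toTile (uMark κ)   = tile (markG κ) (upMarkG κ) φ north
    toTile (uStart κ)  = tile (startRG κ) (upStartG κ) φ north
    -- The parity enters the tile set only through this tile.
    toTile dSeed       = tile seedG (rightG (first parity) 1 0) (leftG (first parity) 0 1) south
    -- The symbol added by a leftward row, at the far end of the tape, is a blank.
    toTile dStartL     = tile startLG (upLG 0) upRightMarkG south
    toTile (dEnd s)    = tile rightMarkG (stateG s) (upEndG s) south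
    toTile (dR s σ)    = tile (symbolG σ) (stateG s) (upRG (proj₁ (step s σ)) (proj₂ (step s σ))) south
    toTile (dL σ)      = tile (symbolG σ) (upLG σ) returnG south
    toTile (dStartR κ) = tile (startRG κ) (upMarkG (pred κ)) (upRG (proj₁ (load κ)) (proj₂ (load κ))) south
    toTile (dMark κ)   = tile (markG κ) (upStartG κ) returnG south

    kinds : List Kind
    kinds = constants ++ (symbolKinds ++ markKinds)
      module Kinds where
      constants symbolKinds markKinds : List Kind
      constants = seed ∷ uRM ∷ dSeed ∷ dStartL ∷ uEnd false ∷ uEnd true ∷ dEnd false ∷ dEnd true ∷ []
      symbolFamilies markFamilies : List (ℕ → Kind)
      symbolFamilies = uR false ∷ uR true ∷ dR false ∷ dR true ∷ uL ∷ dL ∷ []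
      markFamilies   = uMark ∷ uStart ∷ dStartR ∷ dMark ∷ []
      -- `suc b` symbols: the blank and `b` digits.
      symbolKinds = cartesianProductWith (λ f σ → f σ) symbolFamilies (upTo (suc b))
      markKinds   = cartesianProductWith (λ f κ → f κ) markFamilies (upTo (suc m))
    open Kinds

    constant∈ : ∀ {k} → k ∈ constants → k ∈ kinds
    constant∈ = ∈-++⁺ˡ

    symbol∈ : ∀ {f σ} → f ∈ symbolFamilies → σ ≤ b → f σ ∈ kinds
    symbol∈ f∈ σ≤b = ∈-++⁺ʳ constants (∈-++⁺ˡ (∈-cartesianProductWith⁺ (λ f σ → f σ) f∈ (∈-upTo⁺ (s≤s σ≤b))))

    mark∈ : ∀ {f κ} → f ∈ markFamilies → κ ≤ m → f κ ∈ kinds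
    mark∈ f∈ κ≤m = ∈-++⁺ʳ constants (∈-++⁺ʳ symbolKinds (∈-cartesianProductWith⁺ (λ f κ → f κ) f∈ (∈-upTo⁺ (s≤s κ≤m))))

    upTile downTile : Row → ℕ → ℕ → Tile
    upTile ρ i j   = tile (bottomG ρ i j) (rightG ρ i j) (leftG ρ i j) north
    downTile ρ i j = tile (bottomG ρ i j) (rightG (next ρ) (suc i) j) (leftG (next ρ) i (suc j)) south

    North South : Kind → Set
    North k = Tile.direction (toTile k) ≡ north
    South k = Tile.direction (toTile k) ≡ south

    -- In this group of lemmas the glues on input sides alone identify the kind. As roles have
    -- distinct strengths, unification discards almost all other kinds.
    match-uMark : ∀ k {κ} → North k → Tile.γ₂ (toTile k) ≡ upMarkG κ → k ≡ uMark κ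
    match-uMark (uMark κ) refl refl = refl

    match-uStart : ∀ k {κ} → North k → Tile.γ₂ (toTile k) ≡ upStartG κ → k ≡ uStart κ
    match-uStart (uStart κ) refl refl = refl

    match-uL : ∀ k {κ} → North k → Tile.γ₂ (toTile k) ≡ upLG κ → k ≡ uL κ
    match-uL (uL κ) refl refl = refl

    match-uEnd : ∀ k s → North k → Tile.γ₃ (toTile k) ≡ upEndG s → k ≡ uEnd s
    match-uEnd (uEnd false) false refl refl = refl
    match-uEnd (uEnd true)  true  refl refl = refl
    match-uEnd (uR false _) true refl ()
    match-uEnd (uR true _)  true refl ()
    match-uEnd (uR false _) false refl ()
    match-uEnd (uR true _)  false refl ()

    match-uR : ∀ k s {σ} → North k → Tile.γ₃ (toTile k) ≡ upRG s σ → k ≡ uR s σ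
    match-uR (uR false _) false refl refl = refl
    match-uR (uR true _)  true  refl refl = refl

    match-uRM : ∀ k → North k → Tile.γ₃ (toTile k) ≡ upRightMarkG → k ≡ uRM
    match-uRM uRM refl refl = refl
    match-uRM (uR false _) refl ()
    match-uRM (uR true _)  refl ()

    match-dSeed : ∀ k → South k → Tile.γ₁ (toTile k) ≡ seedG → k ≡ dSeed
    match-dSeed dSeed refl refl = refl

    match-dStartR : ∀ k {κ} → South k → Tile.γ₁ (toTile k) ≡ startRG κ → k ≡ dStartR κ
    match-dStartR (dStartR κ) refl refl = refl

    match-dStartL : ∀ k → South k → Tile.γ₁ (toTile k) ≡ startLG → k ≡ dStartL
    match-dStartL dStartL refl refl = refl

    match-dMark : ∀ k {κ} → South k → Tile.γ₁ (toTile k) ≡ markG κ → k ≡ dMark κ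
    match-dMark (dMark κ) refl refl = refl

    match-dEnd : ∀ k s → South k → Tile.γ₁ (toTile k) ≡ rightMarkG → Tile.γ₂ (toTile k) ≡ stateG s → k ≡ dEnd s
    match-dEnd (dEnd false) false refl refl refl = refl
    match-dEnd (dEnd true)  true  refl refl refl = refl

    match-dR : ∀ k s {σ} → South k → Tile.γ₁ (toTile k) ≡ symbolG σ → Tile.γ₂ (toTile k) ≡ stateG s → k ≡ dR s σ
    match-dR (dR false _) false refl refl refl = refl
    match-dR (dR true _)  true  refl refl refl = refl

    -- The symbol alone does not separate this kind from `dR`, which reads it too. The third glue
    -- does: that of `dR` has strength 23 or 24, never 14.
    match-dL : ∀ k {σ} → South k → Tile.γ₁ (toTile k) ≡ symbolG σ → Tile.γ₃ (toTile k) ≡ returnG → k ≡ dL σ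
    match-dL (dL _)   refl refl refl = refl
    match-dL (dR s σ) refl refl e    = ⊥-elim (upR≢return (proj₁ (step s σ)) e)
      where
      upR≢return : ∀ s {σ} → upRG s σ ≢ returnG
      upR≢return false ()
      upR≢return true  ()

    record ValidL (Rf r κ : ℕ) (u : ℕ → ℕ) : Set where
      field
        positive : 1 ≤ r
        not-last : r ≢ Rf
        mark≤    : κ ≤ m
        symbol≤  : ∀ x → u x ≤ b

    -- The up tile at the right end of row r passes on the state st (r - 2).
    record ValidR (Rf r κ : ℕ) (st : ℕ → Bool) (u : ℕ → ℕ) : Set where
      field
        positive   : 1 ≤ r
        end-state  : r < Rf → st (pred (pred r)) ≡ false
        last-state : r ≡ Rf → st (pred (pred r)) ≡ true
        blank      : ∀ x → r ≤ suc x → u x ≡ 0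
        mark≤      : κ ≤ m
        symbol≤    : ∀ x → u x ≤ b

    Valid : ℕ → ℕ → Row → Set
    Valid Rf r S          = r ≡ 0
    Valid Rf r (L κ u)    = ValidL Rf r κ u
    Valid Rf r (R κ st u) = ValidR Rf r κ st u

-- Local analysis: which tile can attach at a position.

module LocalGrowth where

  open Bonds
  open Positions
  open Geometry
  open TileSet
  open import Data.Bool using (Bool; true; false)
  open import Data.Empty using (⊥-elim)
  open import Data.Fin using (zero; suc)
  open import Data.List.Membership.Propositional using (_∈_)
  open import Data.List.Relation.Unary.Any using (here; there)
  open import Data.Nat using (ℕ; zero; suc; pred; _+_; _≤_; _<_)
  import Data.Nat.Properties as ℕₚ
  open import Data.Product using (_×_; _,_)
  open import Data.Sum using (_⊎_; inj₁; inj₂)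
  open import Relation.Binary.PropositionalEquality
  open import Relation.Nullary using (¬_)
  open import Relation.Nullary.Decidable using (True; toWitness)

  module Local (b m : ℕ) (digit : ℕ → ℕ) (parity : Bool) where
    open Machine b m digit parity

    -- The contribution of side s to the bond of a tile, at a position whose
    -- target tile is t′ and whose inputs satisfy P.
    Contribution : Tile → Tile → (Side → Set) → Side → ℕ → Set
    Contribution t t′ P s n = n ≡ 0 ⊎ (glueOn t s ≡ glueOn t′ s × P s × n ≡ strength (glueOn t′ s))

    InputsUp InputsDown : (Side → Set) → Row → ℕ → ℕ → Set
    InputsUp P ρ i j   = ∀ s → UpInput ρ i j s → P s
    InputsDown P ρ i j = ∀ s → DownInput (next ρ) i j s → P s

    -- Without a contribution from the input the sum is 0; with it, that single strong glue names
    -- the kind.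
    up-determined : ∀ ρ i j {P : Side → Set} k → North k → ∀ {a b c} →
      Contribution (toTile k) (upTile ρ i j) (λ s → UpInput ρ i j s × P s) zero a →
      Contribution (toTile k) (upTile ρ i j) (λ s → UpInput ρ i j s × P s) (suc zero) b →
      Contribution (toTile k) (upTile ρ i j) (λ s → UpInput ρ i j s × P s) (suc (suc zero)) c →
      20 ≤ a + (b + c) →
      toTile k ≡ upTile ρ i j × (∃[ s ] UpInput ρ i j s × P s) × InputsUp P ρ i j
    up-determined ρ i j k n (inj₂ (_ , (() , _) , _)) _ _ _
    up-determined ρ i j k n (inj₁ refl) (inj₁ refl) (inj₁ refl) h = ⊥-elim (too-weak 0 h)
    up-determined _ _ _ k n (inj₁ _) (inj₂ (e , (R-start , p) , _)) _ _ with refl ← match-uMark k n e =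
      refl , (_ , R-start , p) , λ { _ R-start → p }
    up-determined _ _ zero k n (inj₁ _) (inj₂ (e , (L-sweep , p) , _)) _ _ with refl ← match-uStart k n e =
      refl , (_ , L-sweep , p) , λ { _ L-sweep → p }
    up-determined _ _ (suc j) k n (inj₁ _) (inj₂ (e , (L-sweep , p) , _)) _ _ with refl ← match-uL k n e =
      refl , (_ , L-sweep , p) , λ { _ L-sweep → p }
    up-determined (R κ st u) zero (suc x) k n (inj₁ _) (inj₁ _) (inj₂ (e , (R-sweep , p) , _)) _
      with refl ← match-uEnd k (st (pred x)) n e = refl , (_ , R-sweep , p) , λ { _ R-sweep → p }
    up-determined (R κ st u) (suc i) (suc x) k n (inj₁ _) (inj₁ _) (inj₂ (e , (R-sweep , p) , _)) _
      with refl ← match-uR k (st x) n e = refl , (_ , R-sweep , p) , λ { _ R-sweep → p }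
    up-determined _ _ _ k n (inj₁ _) (inj₁ _) (inj₂ (e , (L-start , p) , _)) _ with refl ← match-uRM k n e =
      refl , (_ , L-start , p) , λ { _ L-start → p }

    no-left-input : ∀ p → ¬ DownInput (first p) zero zero (suc zero)
    no-left-input false ()
    no-left-input true  ()

    no-right-input : ∀ p → ¬ DownInput (first p) zero zero (suc (suc zero))
    no-right-input false ()
    no-right-input true  ()

    -- Evidence that a down position lies in the triangle: either the row above is not the last one,
    -- or a neighbour in the position's own row is already present.
    data Sides (P : Side → Set) (ρ : Row) (i j r Rf : ℕ) : Set where
      row-start : r ≢ Rf → P zero → Sides P ρ i j r Rf
      row-inner : P zero → (s : Side) → s ≢ zero → DownInput (next ρ) i j s → P s → Sides P ρ i j r Rf

    -- At a row start the hypotenuse is the only input and is strong or φ. Elsewhere a single input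
    -- gives at most 14, so both contribute, and the pair of glues, state and symbol, names the
    -- kind.
    down-determined : ∀ Rf → 1 ≤ Rf → ∀ ρ i j → Valid Rf (i + j) ρ → ∀ {P : Side → Set} k → South k → ∀ {a b c} →
      Contribution (toTile k) (downTile ρ i j) (λ s → DownInput (next ρ) i j s × P s) zero a →
      Contribution (toTile k) (downTile ρ i j) (λ s → DownInput (next ρ) i j s × P s) (suc zero) b →
      Contribution (toTile k) (downTile ρ i j) (λ s → DownInput (next ρ) i j s × P s) (suc (suc zero)) c →
      20 ≤ a + (b + c) →
      toTile k ≡ downTile ρ i j × Sides P ρ i j (i + j) Rf × InputsDown P ρ i j
    down-determined Rf 1≤Rf S zero zero v k n (inj₂ (e , (top , p) , _)) _ _ _
      with refl ← match-dSeed k n e = refl , row-start (λ { refl → ℕₚ.1+n≰n 1≤Rf }) p , inputs parity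
      where
      inputs : ∀ q s → DownInput (first q) zero zero s → _
      inputs _     _ top = p
    down-determined Rf _ S zero zero v k n (inj₁ refl) (inj₁ refl) (inj₁ refl) h = ⊥-elim (too-weak 0 h)
    down-determined Rf _ S zero zero v k n _ (inj₂ (_ , (i , _) , _)) _ _ = ⊥-elim (no-left-input parity i)
    down-determined Rf _ S zero zero v k n _ _ (inj₂ (_ , (i , _) , _)) _ = ⊥-elim (no-right-input parity i)
    down-determined Rf _ (L κ u) i j v k n _ _ (inj₂ (_ , (() , _) , _)) _
    down-determined Rf _ (L κ u) i j v k n (inj₁ refl) (inj₁ refl) (inj₁ refl) h = ⊥-elim (too-weak 0 h)
    down-determined Rf _ (L κ u) i j v k n (inj₁ refl) (inj₂ (_ , (R-sweep , _) , refl)) (inj₁ refl) h = ⊥-elim (too-weak 13 h)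
    down-determined Rf _ (L κ u) zero zero v k n _ _ _ _ with () ← ValidL.positive v
    down-determined Rf _ (L κ u) (suc i) zero v k n (inj₂ (e , (top , p) , _)) _ _ _
      with refl ← match-dStartR k n e = refl , row-start (ValidL.not-last v) p , λ { _ top → p }
    down-determined Rf _ (L κ u) zero (suc x) v k n (inj₂ (_ , (top , _) , refl)) (inj₁ refl) (inj₁ refl) h = ⊥-elim (too-weak 12 h)
    down-determined Rf _ (L κ u) (suc i) (suc x) v k n (inj₂ (_ , (top , _) , refl)) (inj₁ refl) (inj₁ refl) h = ⊥-elim (too-weak 10 h)
    down-determined Rf _ (L κ u) zero (suc x) v k n (inj₂ (e , (top , p) , _)) (inj₂ (e′ , (R-sweep , p′) , _)) _ _
      with refl ← match-dEnd k _ n e e′ = refl , row-inner p (suc zero) (λ ()) R-sweep p′ , λ { _ top → p ; _ R-sweep → p′ }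
    down-determined Rf _ (L κ u) (suc i) (suc x) v k n (inj₂ (e , (top , p) , _)) (inj₂ (e′ , (R-sweep , p′) , _)) _ _
      with refl ← match-dR k _ n e e′ = refl , row-inner p (suc zero) (λ ()) R-sweep p′ , λ { _ top → p ; _ R-sweep → p′ }
    down-determined Rf _ (R κ st u) i j v k n _ (inj₂ (_ , (() , _) , _)) _ _
    down-determined Rf _ (R κ st u) i j v k n (inj₁ refl) (inj₁ refl) (inj₁ refl) h = ⊥-elim (too-weak 0 h)
    down-determined Rf _ (R κ st u) i j v k n (inj₁ refl) (inj₁ refl) (inj₂ (_ , (L-sweep , _) , refl)) h = ⊥-elim (too-weak 14 h)
    down-determined Rf _ (R κ st u) zero zero v k n _ _ _ _ with () ← ValidR.positive v
    down-determined Rf _ (R κ st u) (suc i) zero v k n (inj₂ (_ , (top , _) , refl)) (inj₁ refl) (inj₁ refl) h = ⊥-elim (too-weak 11 h)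
    down-determined Rf _ (R κ st u) (suc i) (suc x) v k n (inj₂ (_ , (top , _) , refl)) (inj₁ refl) (inj₁ refl) h = ⊥-elim (too-weak 10 h)
    down-determined Rf _ (R κ st u) (suc i) zero v k n (inj₂ (e , (top , p) , _)) (inj₁ _) (inj₂ (e′ , (L-sweep , p′) , _)) _
      with refl ← match-dMark k n e = refl , row-inner p (suc (suc zero)) (λ ()) L-sweep p′ , λ { _ top → p ; _ L-sweep → p′ }
    down-determined Rf _ (R κ st u) (suc i) (suc x) v k n (inj₂ (e , (top , p) , _)) (inj₁ _) (inj₂ (e′ , (L-sweep , p′) , _)) _
      with refl ← match-dL k n e e′ = refl , row-inner p (suc (suc zero)) (λ ()) L-sweep p′ , λ { _ top → p ; _ L-sweep → p′ }
    down-determined Rf _ (R κ st u) zero (suc y) v k n (inj₂ (e , (top , p) , refl)) (inj₁ refl) (inj₁ refl) h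
      with st (pred y) in s
    -- A pending carry leaves φ on this edge, so no row starts here.
    ... | true = ⊥-elim (too-weak 0 h)
    ... | false with refl ← match-dStartL k n e =
      -- The new row begins one cell beyond the tape of the row above, where the symbol is the blank
      -- that `dStartL` presumes.
      cong (λ σ → tile startLG (upLG σ) upRightMarkG south) (sym (ValidR.blank v y ℕₚ.≤-refl)) ,
      row-start (λ last → false≢true (trans (sym s) (ValidR.last-state v last))) p , λ { _ top → p }
      where
      false≢true : false ≢ true
      false≢true ()
    down-determined Rf _ (R κ st u) zero (suc y) v k n _ _ (inj₂ (_ , (() , _) , _)) h

    private
      c≤ : ∀ {c n} {_ : True (c ℕₚ.≤? n)} → c ≤ n
      c≤ {_} {_} {h} = toWitness h

    kind-up : ∀ {Rf} ρ i j → Valid Rf (i + j) ρ → ∃[ k ] k ∈ kinds × upTile ρ i j ≡ toTile k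
    kind-up S i j v = seed , constant∈ (here refl) , refl
    kind-up (L κ u) zero zero v with () ← ValidL.positive v
    kind-up (L κ u) (suc i) zero v = uStart κ , mark∈ (there (here refl)) (ValidL.mark≤ v) , refl
    kind-up (L κ u) zero (suc x) v = uRM , constant∈ (there (here refl)) , refl
    kind-up (L κ u) (suc i) (suc x) v =
      uL (u x) , symbol∈ (there (there (there (there (here refl))))) (ValidL.symbol≤ v x) , refl
    kind-up (R κ st u) zero zero v with () ← ValidR.positive v
    kind-up (R κ st u) (suc i) zero v = uMark κ , mark∈ (here refl) (ValidR.mark≤ v) , refl
    kind-up (R κ st u) zero (suc x) v = uEnd (st (pred x)) , ends (st (pred x)) , refl
      where
      ends : ∀ s → uEnd s ∈ kinds
      ends false = constant∈ (there (there (there (there (here refl)))))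
      ends true  = constant∈ (there (there (there (there (there (here refl))))))
    kind-up (R κ st u) (suc i) (suc x) v = uR (st x) (u x) , carries (st x) , refl
      where
      carries : ∀ s → uR s (u x) ∈ kinds
      carries false = symbol∈ (here refl) (ValidR.symbol≤ v x)
      carries true  = symbol∈ (there (here refl)) (ValidR.symbol≤ v x)

    kind-down : ∀ {Rf} ρ i j → Valid Rf (i + j) ρ → i + j < Rf → ∃[ k ] k ∈ kinds × downTile ρ i j ≡ toTile k
    kind-down S zero zero v _ = dSeed , constant∈ (there (there (here refl))) , refl
    kind-down (L κ u) zero zero v _ with () ← ValidL.positive v
    kind-down (L κ u) (suc i) zero v _ = dStartR κ , mark∈ (there (there (here refl))) (ValidL.mark≤ v) , refl
    kind-down (L κ u) zero (suc x) v _ = dEnd _ , ends _ , refl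
      where
      ends : ∀ s → dEnd s ∈ kinds
      ends false = constant∈ (there (there (there (there (there (there (here refl)))))))
      ends true  = constant∈ (there (there (there (there (there (there (there (here refl))))))))
    kind-down (L κ u) (suc i) (suc x) v _ = dR _ (u x) , carries _ , refl
      where
      carries : ∀ s → dR s (u x) ∈ kinds
      carries false = symbol∈ (there (there (here refl))) (ValidL.symbol≤ v x)
      carries true  = symbol∈ (there (there (there (here refl)))) (ValidL.symbol≤ v x)
    kind-down (R κ st u) zero zero v _ with () ← ValidR.positive v
    kind-down (R κ st u) (suc i) zero v _ = dMark κ , mark∈ (there (there (there (here refl)))) (ValidR.mark≤ v) , refl
    kind-down (R κ st u) zero (suc y) v r<Rf = dStartL , constant∈ (there (there (there (here refl)))) ,
      cong₂ (λ s σ → tile (endG s) (upLG σ) upRightMarkG south) (ValidR.end-state v r<Rf) (ValidR.blank v y ℕₚ.≤-refl)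
    kind-down (R κ st u) (suc i) (suc x) v _ =
      dL (u x) , symbol∈ (there (there (there (there (there (here refl)))))) (ValidR.symbol≤ v x) , refl

    up-input : ∀ {Rf} ρ i j → Valid Rf (i + j) ρ → i + j ≡ 0 ⊎ ∃[ s ] UpInput ρ i j s
    up-input S          i       j       v = inj₁ v
    up-input (L κ u)    zero    zero    v = inj₁ refl
    up-input (L κ u)    zero    (suc j) v = inj₂ (_ , L-start)
    up-input (L κ u)    (suc i) j       v = inj₂ (_ , L-sweep)
    up-input (R κ st u) zero    zero    v = inj₁ refl
    up-input (R κ st u) (suc i) zero    v = inj₂ (_ , R-start)
    up-input (R κ st u) i       (suc j) v = inj₂ (_ , R-sweep)

    up-strength : ∀ ρ i j {s} → UpInput ρ i j s → 20 ≤ strength (glueOn (upTile ρ i j) s)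
    up-strength _ _       _       R-start = c≤
    up-strength _ _       _       L-start = c≤
    up-strength _ _       zero    L-sweep = c≤
    up-strength _ _       (suc j) L-sweep = c≤
    up-strength _ zero    _       R-sweep = c≤
    up-strength (R κ st u) (suc i) (suc j) R-sweep with st j
    ... | false = c≤
    ... | true  = c≤

    down-strength : ∀ {Rf} ρ i j → Valid Rf (i + j) ρ → i + j < Rf → ∀ {s} → DownInput (next ρ) i j s →
      10 ≤ strength (glueOn (downTile ρ i j) s)
    down-strength S          zero    zero    v _ {suc zero}       d = ⊥-elim (no-left-input parity d)
    down-strength S          zero    zero    v _ {suc (suc zero)} d = ⊥-elim (no-right-input parity d)
    down-strength S          i       j       v _ {zero} _ = c≤
    down-strength (L κ u)    i       zero    v _ {zero} _ = c≤
    down-strength (L κ u)    zero    (suc x) v _ {zero} _ = c≤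
    down-strength (L κ u)    (suc i) (suc x) v _ {zero} _ = c≤
    down-strength (L κ u)    i       (suc x) v _ {suc zero} R-sweep = c≤
    down-strength (R κ st u) i       zero    v _ {zero} _ = c≤
    down-strength (R κ st u) zero    (suc x) v h {zero} _ rewrite ValidR.end-state v h = c≤
    down-strength (R κ st u) (suc i) (suc x) v _ {zero} _ = c≤
    down-strength (R κ st u) (suc i) j       v _ {suc (suc zero)} L-sweep = c≤

    -- Sufficiency of the inputs: either the hypotenuse holds the tile alone, or a second input
    -- makes the total at least 10 + 10.
    down-supported : ∀ {Rf} ρ i j → Valid Rf (i + j) ρ → i + j < Rf →
      20 ≤ strength (bottomG ρ i j) ⊎ ∃[ s ] s ≢ zero × DownInput (next ρ) i j s
    down-supported S          i       j       v _ = inj₁ c≤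
    down-supported (L κ u)    i       zero    v _ = inj₁ c≤
    down-supported (L κ u)    i       (suc x) v _ = inj₂ (_ , (λ ()) , R-sweep)
    down-supported (R κ st u) zero    zero    v _ with () ← ValidR.positive v
    down-supported (R κ st u) zero    (suc x) v h rewrite ValidR.end-state v h = inj₁ c≤
    down-supported (R κ st u) (suc i) j       v _ = inj₂ (_ , (λ ()) , L-sweep)

-- Global growth: from local attachment to determinism.

module Assemblies where

  open Bonds
  open Positions
  open Geometry
  open TileSet
  open LocalGrowth
  open import Data.Bool using (Bool)
  open import Data.Empty using (⊥-elim)
  open import Data.Fin using (zero; suc)
  open import Data.List using (List; []; _∷_; map; upTo; cartesianProductWith; _++_; deduplicate)
  open import Data.List.Membership.Propositional using (_∈_; _∉_)
  open import Data.List.Membership.Propositional.Properties using (∈-map⁺; ∈-map⁻; ∈-++⁺ˡ; ∈-++⁺ʳ; ∈-cartesianProductWith⁺; ∈-upTo⁺; ∈-deduplicate⁺; ∈-deduplicate⁻)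
  open import Data.List.Relation.Unary.All as All using (All; []; _∷_)
  import Data.List.Relation.Unary.All.Properties as Allₚ
  open import Data.List.Relation.Unary.AllPairs as AllPairs using (AllPairs; []; _∷_)
  import Data.List.Relation.Unary.AllPairs.Properties as AllPairsₚ
  open import Data.List.Relation.Unary.Any using (here; there)
  open import Data.List.Relation.Unary.Unique.Propositional using (Unique)
  open import Data.List.Relation.Unary.Unique.DecPropositional.Properties using (deduplicate-!)
  open import Data.Maybe using (just)
  open import Data.Maybe.Properties using (just-injective)
  open import Data.Nat as ℕ using (ℕ; zero; suc; _+_; _≤_; _<_; z≤n; s≤s)
  open import Data.Nat.ListAction using (sum)
  import Data.Nat.Properties as ℕₚ
  open import Data.Product using (_×_; _,_; proj₁; proj₂)
  open import Data.Product.Properties using (≡-dec)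
  open import Data.Sum using (_⊎_; inj₁; inj₂)
  open import Function using (_∘_)
  open import Function.Bundles using (mk⇔)
  open import Relation.Binary.Construct.Closure.ReflexiveTransitive as Star using (Star; ε; _◅_; _◅◅_)
  open import Relation.Binary.Definitions using (DecidableEquality)
  open import Relation.Binary.PropositionalEquality
  open import Relation.Nullary using (Dec; yes; no)
  open import Relation.Nullary.Decidable using (toWitness; map′; _×-dec_; dec-true)

  _≟ᵈ_ : DecidableEquality Direction
  d ≟ᵈ d′ = map′ (λ e → trans (sym (decode-code d)) (trans (cong decode e) (decode-code d′))) (cong code) (code d ℕ.≟ code d′)
    where
    code : Direction → ℕ
    code east  = 0
    code north = 1
    code west  = 2
    code south = 3
    decode : ℕ → Direction
    decode 0 = east
    decode 1 = north
    decode 2 = west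
    decode _ = south
    decode-code : ∀ d → decode (code d) ≡ d
    decode-code east  = refl
    decode-code north = refl
    decode-code west  = refl
    decode-code south = refl

  _≟ᵍ_ : DecidableEquality Glue
  φ        ≟ᵍ φ        = yes refl
  φ        ≟ᵍ glue _ _ = no λ ()
  glue _ _ ≟ᵍ φ        = no λ ()
  glue a n ≟ᵍ glue b m = map′ (λ { refl → refl }) (λ { refl → refl }) (≡-dec ℕ._≟_ ℕ._≟_ (a , n) (b , m))

  _≟ᵗ_ : DecidableEquality Tile
  tile a b c d ≟ᵗ tile a′ b′ c′ d′ =
    map′ (λ { (refl , refl , refl , refl) → refl }) (λ { refl → refl , refl , refl , refl })
         ((a ≟ᵍ a′) ×-dec (b ≟ᵍ b′) ×-dec (c ≟ᵍ c′) ×-dec (d ≟ᵈ d′))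

  _≟ᵖ_ : DecidableEquality Pos
  up i j   ≟ᵖ up k l   = map′ (λ { refl → refl }) (λ { refl → refl }) (≡-dec ℕ._≟_ ℕ._≟_ (i , j) (k , l))
  down i j ≟ᵖ down k l = map′ (λ { refl → refl }) (λ { refl → refl }) (≡-dec ℕ._≟_ ℕ._≟_ (i , j) (k , l))
  up _ _   ≟ᵖ down _ _ = no λ ()
  down _ _ ≟ᵖ up _ _   = no λ ()

  open import Data.List.Membership.DecPropositional _≟ᵖ_ using (_∈?_)

  g-cases : ∀ x y → g x y ≡ 0 ⊎ (x ≡ y × g x y ≡ strength y)
  g-cases φ          y          = inj₁ refl
  g-cases (glue _ _) φ          = inj₁ refl
  g-cases (glue a n) (glue b m) with ≡-dec ℕ._≟_ ℕ._≟_ (a , n) (b , m)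
  ... | yes refl = inj₂ (refl , refl)
  ... | no  _    = inj₁ refl

  g-self : ∀ x → g x x ≡ strength x
  g-self φ          = refl
  g-self (glue a n) rewrite dec-true (≡-dec ℕ._≟_ ℕ._≟_ (a , n) (a , n)) refl = refl

  neighbour-sym : ∀ p s {q} → neighbour p s ≡ just q → neighbour q s ≡ just p
  neighbour-sym (up i j)       zero             refl = refl
  neighbour-sym (up (suc i) j) (suc zero)       refl = refl
  neighbour-sym (up i (suc j)) (suc (suc zero)) refl = refl
  neighbour-sym (down i j)     zero             refl = refl
  neighbour-sym (down i j)     (suc zero)       refl = refl
  neighbour-sym (down i j)     (suc (suc zero)) refl = refl

  module Growth (b m : ℕ) (digit : ℕ → ℕ) (parity : Bool) (Rf : ℕ) (1≤Rf : 1 ≤ Rf)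
                (valid : ∀ r → Machine.Valid b m digit parity Rf r (Machine.row b m digit parity r)) where
    open Machine b m digit parity
    open Local b m digit parity

    -- `left` uses `suc (i + j)` instead of `i + suc j`, so that both legs of a down tile refer to
    -- `next (row (i + j))` by computation. The price is the transport `tileOf-up` for up tiles.
    bottom right left : ℕ → ℕ → Glue
    bottom i j       = bottomG (row (i + j)) i j
    right  i j       = rightG (row (i + j)) i j
    left   i zero    = φ
    left   i (suc j) = leftG (row (suc (i + j))) i (suc j)

    right-boundary : ∀ j → right 0 j ≡ φ
    right-boundary j = at-zero (row j)
      where
      at-zero : ∀ ρ → rightG ρ 0 j ≡ φ
      at-zero S         = refl
      at-zero (L _ _)   = refl
      at-zero (R _ _ _) = refl

    left-boundary : ∀ i → left i 0 ≡ φ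
    left-boundary i = refl

    open Lattice bottom right left right-boundary left-boundary
    open Occupancy bottom right left right-boundary left-boundary

    directionOf-tileOf : ∀ p → Tile.direction (tileOf p) ≡ directionOf p
    directionOf-tileOf (up _ _)   = refl
    directionOf-tileOf (down _ _) = refl

    tileOf-up : ∀ i j → tileOf (up i j) ≡ upTile (row (i + j)) i j
    tileOf-up i j = cong (λ x → tile (bottom i j) (right i j) x north) (left-up i j)
      where
      at-zero : ∀ ρ i → leftG ρ i 0 ≡ φ
      at-zero S         i = refl
      at-zero (L _ _)   i = refl
      at-zero (R _ _ _) i = refl
      left-up : ∀ i j → left i j ≡ leftG (row (i + j)) i j
      left-up i zero    = sym (at-zero (row (i + 0)) i)
      left-up i (suc j) = cong (λ r → leftG (row r) i (suc j)) (sym (ℕₚ.+-suc i j))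

    system : System
    system = record
      -- Deduplication yields distinct tiles without an injectivity proof for `toTile` and can only
      -- lower the size.
      { tiles       = deduplicate _≟ᵗ_ (map toTile kinds)
      ; unique      = deduplicate-! _≟ᵗ_ (map toTile kinds)
      ; seed        = toTile seed
      ; seed∈tiles  = ∈-deduplicate⁺ _≟ᵗ_ (∈-map⁺ toTile (constant∈ {seed} (here refl)))
      ; temperature = 20
      }
    open System system using (tiles)

    toTile∈tiles : ∀ {k t} → k ∈ kinds → t ≡ toTile k → t ∈ tiles
    toTile∈tiles k∈ refl = ∈-deduplicate⁺ _≟ᵗ_ {xs = map toTile kinds} (∈-map⁺ toTile {xs = kinds} k∈)

    tiles-kind : ∀ {t} → t ∈ tiles → ∃[ k ] t ≡ toTile k
    tiles-kind t∈ with ∈-map⁻ toTile {xs = kinds} (∈-deduplicate⁻ _≟ᵗ_ (map toTile kinds) t∈)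
    ... | k , _ , e = k , e

    vertical-toTile : ∀ k → Vertical (Tile.direction (toTile k))
    vertical-toTile seed        = north
    vertical-toTile uRM         = north
    vertical-toTile (uEnd _)    = north
    vertical-toTile (uR _ _)    = north
    vertical-toTile (uL _)      = north
    vertical-toTile (uMark _)   = north
    vertical-toTile (uStart _)  = north
    vertical-toTile dSeed       = south
    vertical-toTile dStartL     = south
    vertical-toTile (dEnd _)    = south
    vertical-toTile (dR _ _)    = south
    vertical-toTile (dL _)      = south
    vertical-toTile (dStartR _) = south
    vertical-toTile (dMark _)   = south

    Input : Pos → Side → Set
    Input (up i j)   s = UpInput (row (i + j)) i j s
    Input (down i j) s = DownInput (row (suc (i + j))) i j s

    input-neighbour : ∀ p {s} → Input p s → ∃[ q ] neighbour p s ≡ just q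
    input-neighbour (up i j)   x = for (row (i + j)) i j x
      where
      for : ∀ ρ i j {s} → UpInput ρ i j s → ∃[ q ] neighbour (up i j) s ≡ just q
      for _ _ _ R-start = _ , refl
      for _ _ _ R-sweep = _ , refl
      for _ _ _ L-start = _ , refl
      for _ _ _ L-sweep = _ , refl
    input-neighbour (down i j) {zero}           x = _ , refl
    input-neighbour (down i j) {suc zero}       x = _ , refl
    input-neighbour (down i j) {suc (suc zero)} x = _ , refl

    row-suc : ∀ i j → row (suc (i + j)) ≡ row (i + suc j)
    row-suc i j = cong row (sym (ℕₚ.+-suc i j))

    down-or-up : ∀ i j s q → neighbour (down i j) s ≡ just q → Input (down i j) s ⊎ Input q s
    down-or-up i j zero _ refl = inj₁ top
    down-or-up i j (suc zero) _ refl = for (row (suc (i + j))) j (valid (suc (i + j)))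
      where
      for : ∀ ρ j′ → Valid Rf (suc (i + j)) ρ → DownInput ρ i j′ (suc zero) ⊎ UpInput ρ (suc i) j′ (suc zero)
      for S          j       ()
      for (L κ u)    j       _ = inj₂ L-sweep
      for (R κ st u) zero    _ = inj₂ R-start
      for (R κ st u) (suc j) _ = inj₁ R-sweep
    down-or-up i j (suc (suc zero)) _ refl =
      subst (λ ρ → DownInput (row (suc (i + j))) i j (suc (suc zero)) ⊎ UpInput ρ i (suc j) (suc (suc zero))) (row-suc i j)
        (for (row (suc (i + j))) i (valid (suc (i + j))))
      where
      for : ∀ ρ i′ → Valid Rf (suc (i + j)) ρ →
        DownInput ρ i′ j (suc (suc zero)) ⊎ UpInput ρ i′ (suc j) (suc (suc zero))
      for S          i       ()
      for (L κ u)    zero    _ = inj₂ L-start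
      for (L κ u)    (suc i) _ = inj₁ L-sweep
      for (R κ st u) i       _ = inj₂ R-sweep

    -- This gives positive strength on every edge of the triangle, and it restricts the bonds of a
    -- new tile to its inputs.
    orientation : ∀ p s q → neighbour p s ≡ just q → Input p s ⊎ Input q s
    orientation (down i j) s q nb = down-or-up i j s q nb
    orientation (up i j)   s q nb = flip q (neighbour-sym (up i j) s nb)
      where
      flip : ∀ q → neighbour q s ≡ just (up i j) → Input (up i j) s ⊎ Input q s
      flip (down k l) nb′ with down-or-up k l s (up i j) nb′
      ... | inj₁ x = inj₂ x
      ... | inj₂ x = inj₁ x
      flip (up k l) nb′ = ⊥-elim (up-up k l s nb′)
        where
        up-up : ∀ k l s {i j} → neighbour (up k l) s ≢ just (up i j)
        up-up k       l       zero             ()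
        up-up (suc k) l       (suc zero)       ()
        up-up k       (suc l) (suc (suc zero)) ()

    input-strength : ∀ p → InTriangle Rf p → ∀ {s} → Input p s → 10 ≤ strength (glueOn (tileOf p) s)
    input-strength (up i j) _ {s} x = subst (λ t → 10 ≤ strength (glueOn t s)) (sym (tileOf-up i j))
      (ℕₚ.≤-trans (toWitness {a? = 10 ℕₚ.≤? 20} _) (up-strength (row (i + j)) i j x))
    input-strength (down i j) (down h) x = down-strength (row (i + j)) i j (valid (i + j)) h x

    shared-strength : ∀ p q s → InTriangle Rf p → InTriangle Rf q → neighbour p s ≡ just q →
      0 < strength (glueOn (tileOf p) s)
    shared-strength p q s p∈ q∈ nb with orientation p s q nb
    ... | inj₁ x = ℕₚ.≤-trans (s≤s z≤n) (input-strength p p∈ x)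
    ... | inj₂ x = subst (λ y → 0 < strength y) (glue-neighbour p s q nb) (ℕₚ.≤-trans (s≤s z≤n) (input-strength q q∈ x))

    -- Configurations, the invariant of growth.

    Link : List Pos → Pos → Pos → Set
    Link ps p q = p ∈ ps × q ∈ ps × ∃[ s ] neighbour p s ≡ just q × 0 < strength (glueOn (tileOf p) s)

    -- `closed` is the heart: it says that no position was filled before its inputs. `linked` keeps
    -- a bonded path to the apex, from which connectedness follows.
    record Config (ps : List Pos) : Set where
      field
        distinct : Unique ps
        inside   : ∀ {p} → p ∈ ps → InTriangle Rf p
        closed   : ∀ {p} s {q} → p ∈ ps → Input p s → neighbour p s ≡ just q → q ∈ ps
        apex     : up 0 0 ∈ ps
        linked   : ∀ {p} → p ∈ ps → Star (Link ps) p (up 0 0)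
    open Config

    initial-config : Config (up 0 0 ∷ [])
    initial-config = record
      { distinct = [] ∷ []
      ; inside   = λ { (here refl) → up z≤n }
      ; closed   = λ { s (here refl) () nb }
      ; apex     = here refl
      ; linked   = λ { (here refl) → ε }
      }

    some-input : ∀ p → p ≢ up 0 0 → ∃[ s ] Input p s
    some-input (down i j) _ = zero , top
    some-input (up i j)   p≢0 with up-input (row (i + j)) i j (valid (i + j))
    ... | inj₂ x = x
    ... | inj₁ e = ⊥-elim (p≢0 (cong₂ up (ℕₚ.m+n≡0⇒m≡0 i e) (ℕₚ.m+n≡0⇒n≡0 i e)))

    InputsIn : List Pos → Pos → Set
    InputsIn ps p = ∀ s {q} → Input p s → neighbour p s ≡ just q → q ∈ ps

    extend : ∀ {ps p} → Config ps → p ∉ ps → InTriangle Rf p → InputsIn ps p → Config (p ∷ ps)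
    extend {ps} {p} c p∉ p∈△ inputs = record
      { distinct = All.tabulate (λ q∈ e → p∉ (subst (_∈ ps) (sym e) q∈)) ∷ distinct c
      ; inside   = λ { (here refl) → p∈△ ; (there q∈) → inside c q∈ }
      ; closed   = λ { s (here refl) x nb → there (inputs s x nb) ; s (there q∈) x nb → there (closed c s q∈ x nb) }
      ; apex     = there (apex c)
      ; linked   = λ { (here refl) → attached (some-input p λ { refl → p∉ (apex c) }) ; (there q∈) → old q∈ }
      }
      where
      old : ∀ {q} → q ∈ ps → Star (Link (p ∷ ps)) q (up 0 0)
      old q∈ = Star.map (λ { (x , y , l) → there x , there y , l }) (linked c q∈)
      attached : ∃[ s ] Input p s → Star (Link (p ∷ ps)) p (up 0 0)
      attached (s , x) with input-neighbour p x
      ... | q , nb = (here refl , there q∈ , s , nb , ℕₚ.≤-trans (s≤s z≤n) (input-strength p p∈△ x)) ◅ old q∈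
        where q∈ = inputs s x nb

    module _ {ps : List Pos} (c : Config ps) where

      Reached : Pos → Side → Set
      Reached p s = ∃[ q ] neighbour p s ≡ just q × q ∈ ps

      -- If the side were an input of the neighbour `q`, then `closed` would put `p` into the
      -- configuration together with `q`. So the bond uses an input of `p`.
      via-contribution : ∀ t p s n → p ∉ ps → Via t p ps s n → Contribution t (tileOf p) (λ s → Input p s × Reached p s) s n
      via-contribution t p s n p∉ (inj₁ e) = inj₁ e
      via-contribution t p s n p∉ (inj₂ (q , q∈ , nb , e)) with g-cases (glueOn t s) (glueOn (tileOf p) s) | orientation p s q nb
      ... | inj₁ z        | _      = inj₁ (trans e z)
      ... | inj₂ (x , st) | inj₁ i = inj₂ (x , (i , q , nb , q∈) , trans e st)
      ... | inj₂ _        | inj₂ i = ⊥-elim (p∉ (closed c s q∈ i (neighbour-sym p s nb)))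

      reached-inputs : ∀ p → (∀ s → Input p s → Reached p s) → InputsIn ps p
      reached-inputs p f s {q} x nb with f s x
      ... | q′ , nb′ , q′∈ = subst (_∈ ps) (just-injective (trans (sym nb′) nb)) q′∈

      sound-at : ∀ k p → directionOf p ≡ Tile.direction (toTile k) → p ∉ ps → ∀ {x y z} → 20 ≤ x + (y + z) →
        Via (toTile k) p ps zero x → Via (toTile k) p ps (suc zero) y → Via (toTile k) p ps (suc (suc zero)) z →
        toTile k ≡ tileOf p × InTriangle Rf p × InputsIn ps p
      sound-at k (up i j) d p∉ h va vb vc
        with up-determined (row (i + j)) i j {Reached (up i j)} k (sym d)
               (contrib zero va) (contrib (suc zero) vb) (contrib (suc (suc zero)) vc) h
        where
        contrib : ∀ s {n} → Via (toTile k) (up i j) ps s n →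
          Contribution (toTile k) (upTile (row (i + j)) i j) (λ s → Input (up i j) s × Reached (up i j) s) s n
        contrib s {n} v = subst (λ t → Contribution (toTile k) t (λ s → Input (up i j) s × Reached (up i j) s) s n)
          (tileOf-up i j) (via-contribution (toTile k) (up i j) s n p∉ v)
      ... | e , (s , x , r) , inputs = trans e (sym (tileOf-up i j)) , in-△ s r , reached-inputs (up i j) inputs
        where
        in-△ : ∀ s → Reached (up i j) s → InTriangle Rf (up i j)
        in-△ s (q , nb , q∈) = for i j s nb (inside c q∈)
          where
          for : ∀ i j s {q} → neighbour (up i j) s ≡ just q → InTriangle Rf q → InTriangle Rf (up i j)
          for i       j       zero             refl (down h) = up (ℕₚ.<⇒≤ h)
          for (suc i) j       (suc zero)       refl (down h) = up h
          for i       (suc j) (suc (suc zero)) refl (down h) = up (subst (_≤ Rf) (sym (ℕₚ.+-suc i j)) h)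
      sound-at k (down i j) d p∉ h va vb vc
        with down-determined Rf 1≤Rf (row (i + j)) i j (valid (i + j)) {Reached (down i j)} k (sym d)
               (contrib zero va) (contrib (suc zero) vb) (contrib (suc (suc zero)) vc) h
        where
        contrib : ∀ s {n} → Via (toTile k) (down i j) ps s n →
          Contribution (toTile k) (tileOf (down i j)) (λ s → Input (down i j) s × Reached (down i j) s) s n
        contrib s {n} v = via-contribution (toTile k) (down i j) s n p∉ v
      ... | e , sides , inputs = e , down (in-△ sides) , reached-inputs (down i j) inputs
        where
        top-inside : Reached (down i j) zero → i + j ≤ Rf
        top-inside (_ , refl , q∈) with inside c q∈
        ... | up h = h
        side-inside : ∀ s → s ≢ zero → Reached (down i j) s → suc (i + j) ≤ Rf
        side-inside zero s≢0 _ = ⊥-elim (s≢0 refl)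
        side-inside (suc zero) _ (_ , refl , q∈) with inside c q∈
        ... | up h = h
        side-inside (suc (suc zero)) _ (_ , refl , q∈) with inside c q∈
        ... | up h = subst (_≤ Rf) (ℕₚ.+-suc i j) h
        in-△ : Sides (Reached (down i j)) (row (i + j)) i j (i + j) Rf → suc (i + j) ≤ Rf
        in-△ (row-start ne r)       = ℕₚ.≤∧≢⇒< (top-inside r) ne
        in-△ (row-inner _ s ne _ r) = side-inside s ne r

      -- The reason why choices are harmless: whatever the temperature admits is the intended tile,
      -- at a position of the triangle whose inputs are present.
      sticks : ∀ {t v} → t ∈ tiles → CanStick 20 (t at v) (map place ps) →
        ∃[ p ] p ∉ ps × t at v ≡ place p × Config (p ∷ ps)
      sticks {t} {v} t∈ can with tiles-kind t∈
      ... | k , refl with bound (toTile k) v ps (vertical-toTile k) (distinct c) nonzero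
        where
        nonzero : sum (map (bond (toTile k at v)) (map place ps)) ≢ 0
        nonzero e = too-weak 0 (subst (20 ≤_) e (CanStick.strong can))
      ... | p , d , refl , _ , _ , _ , e , va , vb , vc = p , p∉ , cong (_at vertexOf p) (proj₁ sound) ,
            extend c p∉ (proj₁ (proj₂ sound)) (proj₂ (proj₂ sound))
        where
        p∉ : p ∉ ps
        p∉ p∈ = All.lookup (CanStick.free can) (∈-map⁺ place p∈)
          (overlap-self (toTile k) (tileOf p) (vertexOf p) (trans (sym d) (sym (directionOf-tileOf p))) (vertical-toTile k))
        sound = sound-at k p d p∉ (subst (20 ≤_) e (CanStick.strong can)) va vb vc

    module _ {ps : List Pos} (c : Config ps) {p : Pos} (p∉ : p ∉ ps) (p∈△ : InTriangle Rf p) (inputs : InputsIn ps p) where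

      private
        via : Side → ℕ
        via s = viaSum s (place p) ps

        present : ∀ {s} → Input p s → strength (glueOn (tileOf p) s) ≤ via s
        present {s} x with input-neighbour p x
        ... | q , nb = subst (_≤ via s)
          (trans (bondVia-shared s {place p} {place q} (share-neighbour p s q nb))
            (trans (cong (g (glueOn (tileOf p) s)) (glue-neighbour p s q nb)) (g-self (glueOn (tileOf p) s))))
          (≤-sum (λ r → bondVia s (place p) (place r)) (inputs s x nb))

        one : ∀ s → via s ≤ via zero + (via (suc zero) + via (suc (suc zero)))
        one zero             = ℕₚ.m≤m+n _ _
        one (suc zero)       = ℕₚ.≤-trans (ℕₚ.m≤m+n _ (via (suc (suc zero)))) (ℕₚ.m≤n+m _ (via zero))
        one (suc (suc zero)) = ℕₚ.≤-trans (ℕₚ.m≤n+m _ (via (suc zero))) (ℕₚ.m≤n+m _ (via zero))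

        two : ∀ s → s ≢ zero → via zero + via s ≤ via zero + (via (suc zero) + via (suc (suc zero)))
        two zero             s≢0 = ⊥-elim (s≢0 refl)
        two (suc zero)       _   = ℕₚ.+-monoʳ-≤ (via zero) (ℕₚ.m≤m+n _ _)
        two (suc (suc zero)) _   = ℕₚ.+-monoʳ-≤ (via zero) (ℕₚ.m≤n+m _ _)

        supported : ∀ p → p ∉ ps → InTriangle Rf p → (∀ {s} → Input p s → strength (glueOn (tileOf p) s) ≤ via s) →
          20 ≤ via zero + (via (suc zero) + via (suc (suc zero)))
        supported (up i j) p∉ _ present with some-input (up i j) (λ e → p∉ (subst (_∈ ps) (sym e) (apex c)))
        ... | s , x = ℕₚ.≤-trans (subst (λ t → 20 ≤ strength (glueOn t s)) (sym (tileOf-up i j)) (up-strength (row (i + j)) i j x))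
                        (ℕₚ.≤-trans (present x) (one s))
        supported (down i j) p∉ (down h) present with down-supported (row (i + j)) i j (valid (i + j)) h
        ... | inj₁ strong = ℕₚ.≤-trans strong (ℕₚ.≤-trans (present top) (one zero))
        ... | inj₂ (s , s≢0 , x) = ℕₚ.≤-trans
          (ℕₚ.+-mono-≤ (ℕₚ.≤-trans (down-strength (row (i + j)) i j (valid (i + j)) h top) (present top))
                       (ℕₚ.≤-trans (down-strength (row (i + j)) i j (valid (i + j)) h x) (present x)))
          (two s s≢0)

        vertical : Vertical (Tile.direction (tileOf p))
        vertical = vertical-tileOf p

        is-tile : ∀ p → InTriangle Rf p → tileOf p ∈ tiles
        is-tile (up i j) _ with kind-up (row (i + j)) i j (valid (i + j))
        ... | k , k∈ , e = toTile∈tiles k∈ (trans (tileOf-up i j) e)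
        is-tile (down i j) (down h) with kind-down (row (i + j)) i j (valid (i + j)) h
        ... | k , k∈ , e = toTile∈tiles k∈ e

      -- Converse to `sticks`: once the inputs of a position are present, its tile can be attached
      -- at once.
      grow : Step system (map place ps) (map place (p ∷ ps))
      grow = stick (is-tile p p∈△) record
        { free   = Allₚ.map⁺ (All.tabulate λ {q} q∈ o → p∉ (subst (_∈ ps) (sym (apart q o)) q∈))
        ; strong = subst (20 ≤_) (sym (bond-sum (tileOf p) (vertexOf p) ps vertical)) (supported p p∉ p∈△ present)
        }
        where
        apart : ∀ q → Overlap (place p) (place q) → p ≡ q
        apart q = overlap-unique (tileOf p) (tileOf q) p q (directionOf-tileOf p) (directionOf-tileOf q)

    -- Completing an arbitrary configuration.

    _⟶_ : List Pos → List Pos → Set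
    ps ⟶ qs = Star (Step system) (map place ps) (map place qs) × Config qs × (∀ {p} → p ∈ ps → p ∈ qs)

    -- Quantified over all configurations rather than the seed only, so that every partial assembly
    -- can be completed and reachability of several positions composes.
    Reach : Pos → Set
    Reach p = ∀ {ps} → Config ps → ∃[ qs ] ps ⟶ qs × p ∈ qs

    reach-all : ∀ ps → All Reach ps → ∀ {qs} → Config qs → ∃[ rs ] qs ⟶ rs × All (_∈ rs) ps
    reach-all []       []       {qs} c = qs , (ε , c , λ z → z) , []
    reach-all (p ∷ ps) (r ∷ rs) {qs} c with reach-all ps rs c
    ... | xs , (s , c′ , mono) , all∈ with r c′
    ... | ys , (s′ , c″ , mono′) , p∈ = ys , (s ◅◅ s′ , c″ , mono′ ∘ mono) , p∈ ∷ All.map mono′ all∈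

    attach : ∀ {p} qs → InTriangle Rf p → (∀ s {q} → Input p s → neighbour p s ≡ just q → q ∈ qs) → All Reach qs → Reach p
    attach {p} qs p∈△ inputs rs c with reach-all qs rs c
    ... | xs , (s , c′ , mono) , all∈ = place-at (p ∈? xs)
      where
      inputs∈ : InputsIn xs p
      inputs∈ s x nb = All.lookup all∈ (inputs s x nb)
      place-at : Dec (p ∈ xs) → ∃[ ys ] _ ⟶ ys × p ∈ ys
      place-at (yes p∈) = xs , (s , c′ , mono) , p∈
      place-at (no  p∉) = p ∷ xs , (s ◅◅ (grow c′ p∉ p∈△ inputs∈ ◅ ε) , extend c′ p∉ p∈△ inputs∈ , there ∘ mono) , here refl

    module RowReach (r : ℕ) (r<Rf : r < Rf) (above : ∀ i j → i + j ≡ r → Reach (up i j)) where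

      private
        down-in : ∀ {i j} → i + j ≡ r → InTriangle Rf (down i j)
        down-in refl = down r<Rf

        up-in : ∀ {i j} → i + j ≡ suc r → InTriangle Rf (up i j)
        up-in e = up (subst (_≤ Rf) (sym e) r<Rf)

        here-row : ∀ i j → i + j ≡ r → ∀ {ρ} → row (suc r) ≡ ρ → row (suc (i + j)) ≡ ρ
        here-row _ _ refl e = e

        here-row-up : ∀ i j → i + j ≡ suc r → ∀ {ρ} → row (suc r) ≡ ρ → row (i + j) ≡ ρ
        here-row-up _ _ e e′ = trans (cong row e) e′

      module _ {κ st u} (R-row : row (suc r) ≡ R κ st u) where

        private
          from : ∀ {ρ i j s q} → ρ ≡ R κ st u → UpInput ρ i (suc j) s → neighbour (up i (suc j)) s ≡ just q → q ∈ down i j ∷ []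
          from refl R-sweep refl = here refl

          from-start : ∀ {ρ i s q} → ρ ≡ R κ st u → UpInput ρ (suc i) zero s → neighbour (up (suc i) zero) s ≡ just q → q ∈ down i zero ∷ []
          from-start refl R-start refl = here refl

          to-start : ∀ {ρ i s q} → ρ ≡ R κ st u → DownInput ρ i zero s → neighbour (down i zero) s ≡ just q → q ∈ up i zero ∷ []
          to-start refl top refl = here refl

          to : ∀ {ρ i j s q} → ρ ≡ R κ st u → DownInput ρ i (suc j) s → neighbour (down i (suc j)) s ≡ just q →
            q ∈ up i (suc j) ∷ up (suc i) (suc j) ∷ []
          to refl top     refl = here refl
          to refl R-sweep refl = there (here refl)

        -- Induction along the rightward sweep: each position depends on positions of the row above
        -- and on smaller `j` in its own row.
        reach-R : ∀ j i → i + j ≡ suc r → Reach (up i j)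
        reach-R-down : ∀ j i → i + j ≡ r → Reach (down i j)
        reach-R zero    (suc i) e = attach (down i zero ∷ []) (up-in e) (λ s → from-start (here-row-up (suc i) zero e R-row))
          (reach-R-down zero i (ℕₚ.suc-injective e) ∷ [])
        reach-R (suc j) i       e = attach (down i j ∷ []) (up-in e) (λ s → from (here-row-up i (suc j) e R-row))
          (reach-R-down j i (ℕₚ.suc-injective (trans (sym (ℕₚ.+-suc i j)) e)) ∷ [])
        reach-R-down zero    i e = attach (up i zero ∷ []) (down-in e) (λ s → to-start (here-row i zero e R-row))
          (above i zero e ∷ [])
        reach-R-down (suc j) i e = attach (up i (suc j) ∷ up (suc i) (suc j) ∷ []) (down-in e) (λ s → to (here-row i (suc j) e R-row))
          (above i (suc j) e ∷ up-next ∷ [])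
          where
          -- The up triangle to the left in the same row, attached to the down triangle before it;
          -- written out so that the recursion is on the smaller `j`.
          up-next : Reach (up (suc i) (suc j))
          up-next = attach (down (suc i) j ∷ []) (up-in (cong suc e)) (λ s → from (here-row-up (suc i) (suc j) (cong suc e) R-row))
            (reach-R-down j (suc i) (trans (sym (ℕₚ.+-suc i j)) e) ∷ [])

      module _ {κ u} (L-row : row (suc r) ≡ L κ u) where

        private
          from : ∀ {ρ i j s q} → ρ ≡ L κ u → UpInput ρ (suc i) j s → neighbour (up (suc i) j) s ≡ just q → q ∈ down i j ∷ []
          from refl L-sweep refl = here refl

          from-start : ∀ {ρ j s q} → ρ ≡ L κ u → UpInput ρ zero (suc j) s → neighbour (up zero (suc j)) s ≡ just q → q ∈ down zero j ∷ []
          from-start refl L-start refl = here refl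

          to-start : ∀ {ρ j s q} → ρ ≡ L κ u → DownInput ρ zero j s → neighbour (down zero j) s ≡ just q → q ∈ up zero j ∷ []
          to-start refl top refl = here refl

          to : ∀ {ρ i j s q} → ρ ≡ L κ u → DownInput ρ (suc i) j s → neighbour (down (suc i) j) s ≡ just q →
            q ∈ up (suc i) j ∷ up (suc i) (suc j) ∷ []
          to refl top     refl = here refl
          to refl L-sweep refl = there (here refl)

        reach-L : ∀ i j → i + j ≡ suc r → Reach (up i j)
        reach-L-down : ∀ i j → i + j ≡ r → Reach (down i j)
        reach-L zero    (suc j) e = attach (down zero j ∷ []) (up-in e) (λ s → from-start (here-row-up zero (suc j) e L-row))
          (reach-L-down zero j (ℕₚ.suc-injective e) ∷ [])
        reach-L (suc i) j       e = attach (down i j ∷ []) (up-in e) (λ s → from (here-row-up (suc i) j e L-row))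
          (reach-L-down i j (ℕₚ.suc-injective e) ∷ [])
        reach-L-down zero    j e = attach (up zero j ∷ []) (down-in e) (λ s → to-start (here-row zero j e L-row))
          (above zero j e ∷ [])
        reach-L-down (suc i) j e = attach (up (suc i) j ∷ up (suc i) (suc j) ∷ []) (down-in e) (λ s → to (here-row (suc i) j e L-row))
          (above (suc i) j e ∷ up-next ∷ [])
          where
          e′ : suc i + suc j ≡ suc r
          e′ = cong suc (trans (ℕₚ.+-suc i j) e)
          up-next : Reach (up (suc i) (suc j))
          up-next = attach (down i (suc j) ∷ []) (up-in {suc i} {suc j} e′) (λ s → from (here-row-up (suc i) (suc j) e′ L-row))
            (reach-L-down i (suc j) (trans (ℕₚ.+-suc i j) e) ∷ [])

      reach-row : (∀ i j → i + j ≡ suc r → Reach (up i j)) × (∀ i j → i + j ≡ r → Reach (down i j))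
      reach-row with row (suc r) in e | valid (suc r)
      ... | L _ _   | _ = reach-L e , reach-L-down e
      ... | R _ _ _ | _ = (λ i j → reach-R e j i) , (λ i j → reach-R-down e j i)

    reach-ups : ∀ r → r ≤ Rf → ∀ i j → i + j ≡ r → Reach (up i j)
    reach-ups zero    _ zero zero refl {ps} c = ps , (ε , c , λ z → z) , apex c
    reach-ups (suc r) h = proj₁ (RowReach.reach-row r h (reach-ups r (ℕₚ.<⇒≤ h)))

    reach : ∀ {p} → InTriangle Rf p → Reach p
    reach {up i j}   (up h)   = reach-ups (i + j) h i j refl
    reach {down i j} (down h) = proj₂ (RowReach.reach-row (i + j) h (reach-ups (i + j) (ℕₚ.<⇒≤ h))) i j refl

    Full : List Pos → Set
    Full ps = ∀ {p} → InTriangle Rf p → p ∈ ps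

    inTriangle? : ∀ p → Dec (InTriangle Rf p)
    inTriangle? (up i j)   = map′ up (λ { (up h) → h }) (i + j ℕₚ.≤? Rf)
    inTriangle? (down i j) = map′ down (λ { (down h) → h }) (suc (i + j) ℕₚ.≤? Rf)

    fill-list : ∀ cs {ps} → Config ps → ∃[ qs ] ps ⟶ qs × (∀ {p} → p ∈ cs → InTriangle Rf p → p ∈ qs)
    fill-list []       {ps} c = ps , (ε , c , λ z → z) , λ ()
    fill-list (p ∷ cs) c with fill-list cs c
    ... | qs , (s , c′ , mono) , all with inTriangle? p
    ...   | no  p∉△ = qs , (s , c′ , mono) , λ { (here refl) h → ⊥-elim (p∉△ h) ; (there q∈) h → all q∈ h }
    ...   | yes p∈△ with reach p∈△ c′
    ...     | rs , (s′ , c″ , mono′) , p∈ = rs , (s ◅◅ s′ , c″ , mono′ ∘ mono) ,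
                λ { (here refl) _ → p∈ ; (there q∈) h → mono′ (all q∈ h) }

    candidates : List Pos
    candidates = cartesianProductWith up (upTo (suc Rf)) (upTo (suc Rf)) ++ cartesianProductWith down (upTo (suc Rf)) (upTo (suc Rf))

    candidates-complete : ∀ {p} → InTriangle Rf p → p ∈ candidates
    candidates-complete (up {i} {j} h) = ∈-++⁺ˡ (∈-cartesianProductWith⁺ up
      (∈-upTo⁺ (s≤s (ℕₚ.≤-trans (ℕₚ.m≤m+n i j) h))) (∈-upTo⁺ (s≤s (ℕₚ.≤-trans (ℕₚ.m≤n+m j i) h))))
    candidates-complete (down {i} {j} h) = ∈-++⁺ʳ (cartesianProductWith up (upTo (suc Rf)) (upTo (suc Rf))) (∈-cartesianProductWith⁺ down
      (∈-upTo⁺ (s≤s (ℕₚ.≤-trans (ℕₚ.m≤m+n i j) (ℕₚ.<⇒≤ h)))) (∈-upTo⁺ (s≤s (ℕₚ.≤-trans (ℕₚ.m≤n+m j i) (ℕₚ.<⇒≤ h)))))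

    fill : ∀ {ps} → Config ps → ∃[ qs ] ps ⟶ qs × Full qs
    fill c with fill-list candidates c
    ... | qs , s , all = qs , s , λ h → all (candidates-complete h) h

    link-sym : ∀ {ps p q} → Link ps p q → Link ps q p
    link-sym {p = p} (p∈ , q∈ , s , nb , h) =
      q∈ , p∈ , s , neighbour-sym p s nb , subst (λ x → 0 < strength x) (sym (glue-neighbour p s _ nb)) h

    strengthAt-neighbour : ∀ p s q → neighbour p s ≡ just q → strengthAt (place p) s (place q) s ≡ strength (glueOn (tileOf p) s)
    strengthAt-neighbour p s q nb = trans (cong (g (glueOn (tileOf p) s)) (glue-neighbour p s q nb)) (g-self (glueOn (tileOf p) s))

    config-superTile : ∀ {ps} → Config ps → IsSuperTile (map place ps)
    config-superTile {ps} c = record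
      { disjoint  = AllPairsₚ.map⁺ (AllPairs.map (λ {p} {q} p≢q o →
          p≢q (overlap-unique (tileOf p) (tileOf q) p q (directionOf-tileOf p) (directionOf-tileOf q) o)) (distinct c))
      ; connected = λ p q p∈ q∈ → connect (∈-map⁻ place p∈) (∈-map⁻ place q∈)
      }
      where
      Linked′ : Placed → Placed → Set
      Linked′ p q = p ∈ map place ps × q ∈ map place ps × ∃[ i ] ∃[ j ] Share p i q j × 0 < strengthAt p i q j
      linked′ : ∀ {p q} → Link ps p q → Linked′ (place p) (place q)
      linked′ {p} {q} (p∈ , q∈ , s , nb , h) = ∈-map⁺ place p∈ , ∈-map⁺ place q∈ , s , s ,
        share-neighbour p s q nb , subst (0 <_) (sym (strengthAt-neighbour p s q nb)) h
      connect : ∀ {p q} → ∃[ p′ ] p′ ∈ ps × p ≡ place p′ → ∃[ q′ ] q′ ∈ ps × q ≡ place q′ → Star Linked′ p q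
      connect (p , p∈ , refl) (q , q∈ , refl) =
        Star.gmap place linked′ (linked c p∈ ◅◅ Star.reverse link-sym (linked c q∈))

    full-terminal : ∀ {ps} → Config ps → Full ps → Terminal system (map place ps)
    full-terminal c full t v t∈ can with sticks c t∈ can
    ... | p , p∉ , _ , c′ = p∉ (full (inside c′ (here refl)))

    reachable-config : ∀ {ps S} → Config ps → Star (Step system) (map place ps) S → ∃[ qs ] S ≡ map place qs × Config qs
    reachable-config {ps} c ε = ps , refl , c
    reachable-config {ps} c (stick t∈ can ◅ steps) with sticks c t∈ can
    ... | p , p∉ , refl , c′ = reachable-config c′ steps

    -- Terminal assemblies, determinism and full bonding.

    full-produce : ∀ {ps} → Config ps → Full ps → Star (Step system) (initial system) (map place ps) → Produce system (map place ps)
    full-produce c full steps = record { reachable = steps ; superTile = config-superTile c ; terminal = full-terminal c full }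

    -- Filling a terminal configuration cannot take a step, so the filled configuration has the same
    -- tiles as the given one.
    terminal-full : ∀ {ps} → Config ps → Terminal system (map place ps) → Full ps
    terminal-full {ps} c terminal {p} p∈△ with fill c
    ... | qs , (steps , _ , _) , full = stuck steps refl (full p∈△)
      where
      stuck : ∀ {qs S} → Star (Step system) S (map place qs) → S ≡ map place ps → p ∈ qs → p ∈ ps
      stuck (stick t∈ can ◅ _) refl _ = ⊥-elim (terminal _ _ t∈ can)
      stuck {qs} ε e p∈ with ∈-map⁻ place (subst (place p ∈_) e (∈-map⁺ place p∈))
      ... | p′ , p′∈ , e′ = subst (_∈ ps) (sym (place-injective p p′ e′)) p′∈

    deterministic : Deterministic system
    deterministic = record { unique-produce = same ; completes = complete }
      where
      produce-config : ∀ {S} → Produce system S → ∃[ ps ] S ≡ map place ps × Config ps × Full ps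
      produce-config P with reachable-config initial-config (Produce.reachable P)
      ... | ps , refl , c = ps , refl , c , terminal-full c (Produce.terminal P)
      ⊆ : ∀ {ps qs} → Config ps → Full qs → ∀ {x} → x ∈ map place ps → x ∈ map place qs
      ⊆ c full x∈ with ∈-map⁻ place x∈
      ... | p , p∈ , refl = ∈-map⁺ place (full (inside c p∈))
      same : ∀ A B → Produce system A → Produce system B → A ≈ B
      same _ _ P P′ with produce-config P | produce-config P′
      ... | ps , refl , c , full | qs , refl , c′ , full′ = λ _ → mk⇔ (⊆ c full′) (⊆ c′ full)
      complete : ∀ A → Star (Step system) (initial system) A → ∃[ P ] Star (Step system) A P × Produce system P
      complete _ steps with reachable-config initial-config steps
      ... | ps , refl , c with fill c
      ... | qs , (steps′ , c′ , _) , full = map place qs , steps′ , full-produce c′ full (steps ◅◅ steps′)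

    -- A down triangle has a neighbour on every side, and a segment determines the position
    -- bordering it. For an up triangle the roles are exchanged.
    share⇒neighbour : ∀ p s q → Share (place p) s (place q) s → neighbour p s ≡ just q
    share⇒neighbour (down i j) s q e = from-just (always s)
      where
      always : ∀ s → ∃[ r ] neighbour (down i j) s ≡ just r
      always zero             = _ , refl
      always (suc zero)       = _ , refl
      always (suc (suc zero)) = _ , refl
      from-just : ∃[ r ] neighbour (down i j) s ≡ just r → neighbour (down i j) s ≡ just q
      from-just (r , nb) = trans nb (cong just (segment-injective s r q
        (reverse-injective (trans (sym (share-neighbour (down i j) s r nb)) e))))
    share⇒neighbour (up i j) s q e = flip q e (proj₁ (share⇒opposite (tileOf (up i j)) (vertexOf (up i j)) s (tileOf q) (vertexOf q) s north (vertical-tileOf q) e))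
      where
      flip : ∀ q → Share (place (up i j)) s (place q) s → Opposite north (Tile.direction (tileOf q)) → neighbour (up i j) s ≡ just q
      flip (down k l) e _ = neighbour-sym (down k l) s (share⇒neighbour (down k l) s (up i j) (sym (cong reverse e)))

    fullyBonded : ∀ {ps} → Config ps → FullyBonded (map place ps)
    fullyBonded {ps} c x y x∈ y∈ i j share = bonded (∈-map⁻ place x∈) (∈-map⁻ place y∈) share
      where
      bonded : ∀ {x y} → ∃[ p ] p ∈ ps × x ≡ place p → ∃[ q ] q ∈ ps × y ≡ place q → Share x i y j → 0 < strengthAt x i y j
      bonded (p , p∈ , refl) (q , q∈ , refl) share
        with proj₂ (share⇒opposite (tileOf p) (vertexOf p) i (tileOf q) (vertexOf q) j (vertical-tileOf p) (vertical-tileOf q) share)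
      ... | refl = subst (0 <_) (sym (strengthAt-neighbour p i q nb)) (shared-strength p q i (inside c p∈) (inside c q∈) nb)
        where nb = share⇒neighbour p i q share

    producesFullTriangle : ProducesFullTriangle system (suc Rf)
    producesFullTriangle with fill initial-config
    ... | qs , (steps , c , _) , full =
      map place qs , full-produce c full steps , (origin , occupies Rf qs (inside c) full) , fullyBonded c

-- Arithmetic of the counter.

module Counting where

  open Bonds
  open Positions
  open Geometry
  open TileSet
  open import Data.Bool using (Bool; true; false)
  open import Data.Empty using (⊥-elim)
  open import Data.Nat using (ℕ; zero; suc; pred; _+_; _*_; _^_; _∸_; _≤_; _<_; _<?_; z≤n; s≤s; NonZero; >-nonZero⁻¹)
  open import Data.Nat.DivMod using (_/_; _%_; m≡m%n+[m/n]*n; m%n<n; m<n*o⇒m/o<n)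
  import Data.Nat.Properties as ℕₚ
  open import Data.Nat.Tactic.RingSolver using (solve-∀)
  open import Data.Product using (_×_; _,_; proj₁; proj₂)
  open import Function using (_∘_)
  open import Relation.Binary.PropositionalEquality
  open import Relation.Nullary using (yes; no)

  -- The tape as a numeral in base b, least significant digit first, blanks being
  -- ignored: value of the first n cells and number of numerals of this shape.
  module Numeral (b : ℕ) where

    digitOf weight : ℕ → ℕ
    digitOf zero    = 0
    digitOf (suc d) = d
    weight zero    = 1
    weight (suc _) = b

    value capacity : ℕ → (ℕ → ℕ) → ℕ
    value zero    u = 0
    value (suc n) u = value n u + digitOf (u n) * capacity n u
    capacity zero    u = 1
    capacity (suc n) u = capacity n u * weight (u n)

    value<capacity : ∀ n u → (∀ x → u x ≤ b) → value n u < capacity n u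
    value<capacity zero    u u≤b = s≤s z≤n
    value<capacity (suc n) u u≤b = bound (u n) (u≤b n)
      where
      c = capacity n u
      bound : ∀ σ → σ ≤ b → value n u + digitOf σ * c < c * weight σ
      bound zero    _   = subst₂ _<_ (sym (ℕₚ.+-identityʳ (value n u))) (sym (ℕₚ.*-identityʳ c)) (value<capacity n u u≤b)
      bound (suc d) d<b = ℕₚ.≤-trans (ℕₚ.+-monoˡ-< (d * c) (value<capacity n u u≤b))
        (subst (suc d * c ≤_) (ℕₚ.*-comm b c) (ℕₚ.*-monoˡ-≤ c d<b))

    capacity-cons : ∀ n u → capacity (suc n) u ≡ weight (u 0) * capacity n (u ∘ suc)
    capacity-cons zero    u = ℕₚ.*-comm 1 (weight (u 0))
    capacity-cons (suc n) u = trans (cong (_* weight (u (suc n))) (capacity-cons n u)) (ℕₚ.*-assoc (weight (u 0)) _ _)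

    -- `value` grows at the most significant end, as the sweep proceeds; a rightward row inserts a
    -- cell at the least significant end, which calls for this second recursion.
    value-cons : ∀ n u → value (suc n) u ≡ digitOf (u 0) + weight (u 0) * value n (u ∘ suc)
    value-cons zero    u = lemma (digitOf (u 0)) (weight (u 0))
      where
      lemma : ∀ d w → d * 1 ≡ d + w * 0
      lemma = solve-∀
    value-cons (suc n) u = begin
      value (suc n) u + digitOf (u (suc n)) * capacity (suc n) u
        ≡⟨ cong₂ (λ v c → v + digitOf (u (suc n)) * c) (value-cons n u) (capacity-cons n u) ⟩
      (digitOf (u 0) + weight (u 0) * value n (u ∘ suc)) + digitOf (u (suc n)) * (weight (u 0) * capacity n (u ∘ suc))
        ≡⟨ lemma (digitOf (u 0)) (weight (u 0)) (value n (u ∘ suc)) (digitOf (u (suc n))) (capacity n (u ∘ suc)) ⟩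
      digitOf (u 0) + weight (u 0) * (value n (u ∘ suc) + digitOf (u (suc n)) * capacity n (u ∘ suc))  ∎
      where
      open ≡-Reasoning
      lemma : ∀ d w v e c → (d + w * v) + e * (w * c) ≡ d + w * (v + e * c)
      lemma = solve-∀

  module Digits (b : ℕ) {{_ : NonZero b}} where

    -- The integer part of `V / b ^ j`.
    quotient : ℕ → ℕ → ℕ
    quotient V zero    = V
    quotient V (suc j) = quotient (V / b) j

    quotient-/ : ∀ V j → quotient V (suc j) ≡ quotient V j / b
    quotient-/ V zero    = refl
    quotient-/ V (suc j) = quotient-/ (V / b) j

    quotient-0 : ∀ m V → V < b ^ m → quotient V m ≡ 0
    quotient-0 zero    zero V<1   = refl
    quotient-0 zero    (suc V) (s≤s ())
    quotient-0 (suc m) V V<b^m = quotient-0 m (V / b) (m<n*o⇒m/o<n (subst (V <_) (ℕₚ.*-comm b (b ^ m)) V<b^m))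

  first-left : ∀ b m digit parity → Machine.row b m digit parity (suc (bit parity)) ≡ L m (λ _ → 0)
  first-left b m digit false = refl
  first-left b m digit true  = refl

  -- The hypothesis on `V` leaves room for exactly `c` increments; the next one overflows.
  module Counter (b m V c : ℕ) {{_ : NonZero b}} (V+1+c≡b^m : V + suc c ≡ b ^ m) (parity : Bool) where
    open Digits b
    open Numeral b

    digit : ℕ → ℕ
    digit j = quotient V j % b

    digit<b : ∀ j → digit j < b
    digit<b j = m%n<n (quotient V j) b

    quotient-step : ∀ j → quotient V j ≡ digit j + b * quotient V (suc j)
    quotient-step j = begin
      quotient V j                                ≡⟨ m≡m%n+[m/n]*n (quotient V j) b ⟩
      digit j + (quotient V j / b) * b            ≡⟨ cong (digit j +_) (ℕₚ.*-comm (quotient V j / b) b) ⟩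
      digit j + b * (quotient V j / b)            ≡⟨ cong (λ q → digit j + b * q) (sym (quotient-/ V j)) ⟩
      digit j + b * quotient V (suc j)            ∎
      where open ≡-Reasoning

    open Machine b m digit parity

    V<b^m : V < b ^ m
    V<b^m = subst (V <_) V+1+c≡b^m (ℕₚ.m<m+n V (s≤s z≤n))

    1≤b : 1 ≤ b
    1≤b = >-nonZero⁻¹ b

    mark : ℕ → ℕ
    mark zero    = m
    mark (suc t) = pred (mark t)

    tape : ℕ → ℕ → ℕ
    states : ℕ → ℕ → Bool
    tape zero    x = 0
    tape (suc t) x = proj₂ (sweep (mark t) (tape t) x)
    states t x = proj₁ (sweep (mark t) (tape t) x)

    mark≤m : ∀ t → mark t ≤ m
    mark≤m zero    = ℕₚ.≤-refl
    mark≤m (suc t) = ℕₚ.≤-trans ℕₚ.pred[n]≤n (mark≤m t)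

    step-symbol≤ : ∀ s σ → σ ≤ b → proj₂ (step s σ) ≤ b
    step-symbol≤ false σ       h = h
    step-symbol≤ true  zero    h = h
    step-symbol≤ true  (suc d) h with suc d <? b
    ... | yes d<b = d<b
    ... | no  _   = 1≤b

    load-symbol≤ : ∀ κ → proj₂ (load κ) ≤ b
    load-symbol≤ zero    = z≤n
    load-symbol≤ (suc κ) = digit<b κ

    tape≤b : ∀ t x → tape t x ≤ b
    tape≤b zero    x       = z≤n
    tape≤b (suc t) zero    = load-symbol≤ (mark t)
    tape≤b (suc t) (suc x) = step-symbol≤ (states t x) (tape t x) (tape≤b t x)

    step-blank : ∀ s → step s 0 ≡ (s , 0)
    step-blank false = refl
    step-blank true  = refl

    tape-blank : ∀ t x → t ≤ x → tape t x ≡ 0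
    tape-blank zero    x       _       = refl
    tape-blank (suc t) (suc x) (s≤s h) = trans (cong (proj₂ ∘ step (states t x)) (tape-blank t x h)) (cong proj₂ (step-blank (states t x)))

    -- A row may be longer than the written part of the tape. The cells beyond it are blank and pass
    -- the state on, so the right end sees `states t t`.
    states-stable : ∀ t x → states t (x + t) ≡ states t t
    states-stable t zero    = refl
    states-stable t (suc x) = begin
      proj₁ (step (states t (x + t)) (tape t (x + t)))  ≡⟨ cong (proj₁ ∘ step (states t (x + t))) (tape-blank t (x + t) (ℕₚ.m≤n+m t x)) ⟩
      proj₁ (step (states t (x + t)) 0)                 ≡⟨ cong proj₁ (step-blank (states t (x + t))) ⟩
      states t (x + t)                                  ≡⟨ states-stable t x ⟩
      states t t                                        ∎
      where open ≡-Reasoning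

    -- Carry balance of one cell: the outgoing carry is worth `weight σ` units. A blank has weight 1
    -- and digit 0, so it hands the carry on unchanged.
    step-value : ∀ s σ → σ ≤ b → digitOf σ + bit s ≡ digitOf (proj₂ (step s σ)) + weight σ * bit (proj₁ (step s σ))
    step-value false σ       h = cong (digitOf σ +_) (sym (ℕₚ.*-zeroʳ (weight σ)))
    step-value true  zero    h = refl
    step-value true  (suc d) h with suc d <? b
    ... | yes d<b = trans (ℕₚ.+-comm d 1) (trans (sym (ℕₚ.+-identityʳ (suc d))) (cong (suc d +_) (sym (ℕₚ.*-zeroʳ b))))
    ... | no  d≮b = trans (ℕₚ.+-comm d 1) (trans (ℕₚ.≤-antisym h (ℕₚ.≮⇒≥ d≮b)) (sym (ℕₚ.*-identityʳ b)))

    step-weight : ∀ s σ → weight (proj₂ (step s σ)) ≡ weight σ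
    step-weight false σ       = refl
    step-weight true  zero    = refl
    step-weight true  (suc d) with suc d <? b
    ... | yes _ = refl
    ... | no  _ = refl

    -- A sweep adds its initial carry to the numeral on the tape.
    module _ (t : ℕ) where

      shifted : ℕ → ℕ
      shifted x = tape (suc t) (suc x)

      sweep-capacity : ∀ n → capacity n shifted ≡ capacity n (tape t)
      sweep-capacity zero    = refl
      sweep-capacity (suc n) = cong₂ _*_ (sweep-capacity n) (step-weight (states t n) (tape t n))

      sweep-value : ∀ n → value n (tape t) + bit (states t 0) ≡ value n shifted + capacity n (tape t) * bit (states t n)
      sweep-value zero    = sym (ℕₚ.+-identityʳ (bit (states t 0)))
      sweep-value (suc n) = begin
        (v + d * k) + s₀          ≡⟨ arrange v d k s₀ ⟩
        (v + s₀) + k * d          ≡⟨ cong (_+ k * d) (sweep-value n) ⟩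
        (v′ + k * s) + k * d      ≡⟨ factor v′ k s d ⟩
        v′ + k * (d + s)          ≡⟨ cong (λ z → v′ + k * z) (step-value (states t n) (tape t n) (tape≤b t n)) ⟩
        v′ + k * (d′ + w * s′)    ≡⟨ expand v′ k d′ w s′ ⟩
        (v′ + d′ * k) + (k * w) * s′  ≡⟨ cong (λ z → (v′ + d′ * z) + (k * w) * s′) (sym (sweep-capacity n)) ⟩
        (v′ + d′ * capacity n shifted) + (k * w) * s′  ∎
        where
        open ≡-Reasoning
        v = value n (tape t)
        v′ = value n shifted
        k = capacity n (tape t)
        d = digitOf (tape t n)
        d′ = digitOf (shifted n)
        w = weight (tape t n)
        s₀ = bit (states t 0)
        s = bit (states t n)
        s′ = bit (states t (suc n))
        arrange : ∀ v d k s → (v + d * k) + s ≡ (v + s) + k * d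
        arrange = solve-∀
        factor : ∀ v k s d → (v + k * s) + k * d ≡ v + k * (d + s)
        factor = solve-∀
        expand : ∀ v k d w s → v + k * (d + w * s) ≡ (v + d * k) + (k * w) * s
        expand = solve-∀

    loading-state : ∀ t {κ} → mark t ≡ suc κ → ∀ x → states t x ≡ false
    loading-state t e zero    rewrite e = refl
    loading-state t e (suc x) rewrite loading-state t e x = refl

    loaded-symbol : ∀ t {κ} → mark t ≡ suc κ → tape (suc t) 0 ≡ suc (digit κ)
    loaded-symbol t e rewrite e = refl

    counting-state : ∀ t → mark t ≡ 0 → states t 0 ≡ true
    counting-state t e rewrite e = refl

    counting-symbol : ∀ t → mark t ≡ 0 → tape (suc t) 0 ≡ 0
    counting-symbol t e rewrite e = refl

    -- Digits enter at the least significant end, the most significant one first. After `t` rows the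
    -- tape therefore holds the leading `t` of the `m` digits of `V`.
    loading : ∀ t κ → t + κ ≡ m → mark t ≡ κ × value t (tape t) ≡ quotient V κ × capacity t (tape t) ≡ b ^ t
    loading zero    κ refl = refl , sym (quotient-0 m V V<b^m) , refl
    loading (suc t) κ e with loading t (suc κ) (trans (ℕₚ.+-suc t κ) e)
    ... | mark≡ , value≡ , capacity≡ = cong pred mark≡ , value-suc , capacity-suc
      where
      open ≡-Reasoning
      shifted-value : value t (shifted t) ≡ value t (tape t)
      shifted-value = begin
        value t (shifted t)                                                       ≡⟨ sym (ℕₚ.+-identityʳ _) ⟩
        value t (shifted t) + 0                                                   ≡⟨ cong (value t (shifted t) +_) (sym (ℕₚ.*-zeroʳ (capacity t (tape t)))) ⟩
        value t (shifted t) + capacity t (tape t) * 0                             ≡⟨ cong (λ s → value t (shifted t) + capacity t (tape t) * bit s) (sym (loading-state t mark≡ t)) ⟩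
        value t (shifted t) + capacity t (tape t) * bit (states t t)              ≡⟨ sym (sweep-value t t) ⟩
        value t (tape t) + bit (states t 0)                                       ≡⟨ cong (λ s → value t (tape t) + bit s) (loading-state t mark≡ 0) ⟩
        value t (tape t) + 0                                                      ≡⟨ ℕₚ.+-identityʳ _ ⟩
        value t (tape t)                                                          ∎
      value-suc : value (suc t) (tape (suc t)) ≡ quotient V κ
      value-suc = begin
        value (suc t) (tape (suc t))                                                          ≡⟨ value-cons t (tape (suc t)) ⟩
        digitOf (tape (suc t) 0) + weight (tape (suc t) 0) * value t (shifted t)              ≡⟨ cong₂ (λ σ v → digitOf σ + weight σ * v) (loaded-symbol t mark≡) (trans shifted-value value≡) ⟩
        digit κ + b * quotient V (suc κ)                                                      ≡⟨ sym (quotient-step κ) ⟩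
        quotient V κ                                                                          ∎
      capacity-suc : capacity (suc t) (tape (suc t)) ≡ b ^ suc t
      capacity-suc = trans (capacity-cons t (tape (suc t)))
        (cong₂ (λ σ k → weight σ * k) (loaded-symbol t mark≡) (trans (sweep-capacity t t) capacity≡))

    -- The blanks inserted while counting have weight 1, which is why the capacity stays at `b ^ m`.
    Counted : ℕ → Set
    Counted i = mark (i + m) ≡ 0 × value (i + m) (tape (i + m)) ≡ V + i × capacity (i + m) (tape (i + m)) ≡ b ^ m

    module Increment (i : ℕ) (counted : Counted i) where

      t = i + m
      w = value t (shifted t)

      sum≡ : V + suc i ≡ w + b ^ m * bit (states t t)
      sum≡ = begin
        V + suc i                                          ≡⟨ trans (ℕₚ.+-suc V i) (ℕₚ.+-comm 1 (V + i)) ⟩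
        (V + i) + 1                                        ≡⟨ cong₂ (λ v s → v + bit s) (sym (proj₁ (proj₂ counted))) (sym (counting-state t (proj₁ counted))) ⟩
        value t (tape t) + bit (states t 0)                ≡⟨ sweep-value t t ⟩
        w + capacity t (tape t) * bit (states t t)         ≡⟨ cong (λ k → w + k * bit (states t t)) (proj₂ (proj₂ counted)) ⟩
        w + b ^ m * bit (states t t)                       ∎
        where open ≡-Reasoning

      w<b^m : w < b ^ m
      w<b^m = subst (w <_) (trans (sweep-capacity t t) (proj₂ (proj₂ counted))) (value<capacity t (shifted t) (λ x → tape≤b (suc t) (suc x)))

      -- An outgoing carry would force `V + suc i` up to `b ^ m`, which equals `V + suc c`.
      no-overflow : i < c → states t t ≡ false
      no-overflow i<c with states t t | sum≡
      ... | false | _ = refl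
      ... | true  | e = ⊥-elim (ℕₚ.<⇒≱ (subst₂ _<_ e V+1+c≡b^m (ℕₚ.+-monoʳ-< V (s≤s i<c)))
        (subst (λ z → b ^ m ≤ w + z) (sym (ℕₚ.*-identityʳ (b ^ m))) (ℕₚ.m≤n+m (b ^ m) w)))

      -- Without an outgoing carry the tape would have the value `V + suc c`, that is `b ^ m`,
      -- beyond its capacity.
      overflow : i ≡ c → states t t ≡ true
      overflow refl with states t t | sum≡
      ... | true  | _ = refl
      ... | false | e = ⊥-elim (ℕₚ.<-irrefl (trans (sym (trans e (trans (cong (w +_) (ℕₚ.*-zeroʳ (b ^ m))) (ℕₚ.+-identityʳ w)))) V+1+c≡b^m) w<b^m)

      advance : i < c → Counted (suc i)
      advance i<c = cong pred (proj₁ counted) , value-suc , capacity-suc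
        where
        open ≡-Reasoning
        blank = counting-symbol t (proj₁ counted)
        value-suc : value (suc t) (tape (suc t)) ≡ V + suc i
        value-suc = begin
          value (suc t) (tape (suc t))                                               ≡⟨ value-cons t (tape (suc t)) ⟩
          digitOf (tape (suc t) 0) + weight (tape (suc t) 0) * w                     ≡⟨ cong (λ σ → digitOf σ + weight σ * w) blank ⟩
          1 * w                                                                      ≡⟨ ℕₚ.*-identityˡ w ⟩
          w                                                                          ≡⟨ sym (ℕₚ.+-identityʳ w) ⟩
          w + 0                                                                      ≡⟨ cong (w +_) (sym (ℕₚ.*-zeroʳ (b ^ m))) ⟩
          w + b ^ m * 0                                                              ≡⟨ cong (λ s → w + b ^ m * bit s) (sym (no-overflow i<c)) ⟩
          w + b ^ m * bit (states t t)                                               ≡⟨ sym sum≡ ⟩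
          V + suc i                                                                  ∎
        capacity-suc : capacity (suc t) (tape (suc t)) ≡ b ^ m
        capacity-suc = trans (capacity-cons t (tape (suc t))) (trans (cong (λ σ → weight σ * capacity t (shifted t)) blank)
          (trans (ℕₚ.*-identityˡ _) (trans (sweep-capacity t t) (proj₂ (proj₂ counted)))))

    counting : ∀ i → i ≤ c → Counted i
    counting zero    _   with loading m 0 (ℕₚ.+-identityʳ m)
    ... | mark≡ , value≡ , capacity≡ = mark≡ , trans value≡ (sym (ℕₚ.+-identityʳ V)) , capacity≡
    counting (suc i) i<c = Increment.advance i (counting i (ℕₚ.<⇒≤ i<c)) i<c

    steps : ℕ
    steps = c + m

    carry-before : ∀ t → t < steps → states t t ≡ false
    carry-before t t<T with t <? m
    ... | yes t<m = loading-state t (proj₁ (loading t (suc (m ∸ suc t)) (trans (ℕₚ.+-suc t _) (ℕₚ.m+[n∸m]≡n t<m)))) t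
    ... | no  t≮m = subst (λ t → states t t ≡ false) i+m≡t (Increment.no-overflow i (counting i (ℕₚ.<⇒≤ i<c)) i<c)
      where
      i = t ∸ m
      i+m≡t : i + m ≡ t
      i+m≡t = ℕₚ.m∸n+n≡m (ℕₚ.≮⇒≥ t≮m)
      i<c : i < c
      i<c = ℕₚ.+-cancelʳ-< m i c (subst (_< c + m) (sym i+m≡t) t<T)

    carry-at : states steps steps ≡ true
    carry-at = Increment.overflow c (counting c ℕₚ.≤-refl) refl

    -- Row 1 + base t is the t-th row of type L, row 2 + base t the t-th of type R
    -- that loads or counts.
    base : ℕ → ℕ
    base zero    = bit parity
    base (suc t) = suc (suc (base t))

    last : ℕ
    last = suc (suc (base steps))

    base≥ : ∀ t → ∃[ x ] base t ≡ x + t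
    base≥ zero    = bit parity , sym (ℕₚ.+-identityʳ (bit parity))
    base≥ (suc t) with base≥ t
    ... | x , e = suc x , cong suc (trans (cong suc e) (sym (ℕₚ.+-suc x t)))

    states-base : ∀ t → states t (base t) ≡ states t t
    states-base t with base≥ t
    ... | x , e = trans (cong (states t) e) (states-stable t x)

    base-mono : ∀ s {t} → s ≤ t → base s ≤ base t
    base-mono zero    {zero}  h       = ℕₚ.≤-refl
    base-mono zero    {suc t} h       = ℕₚ.≤-trans (base-mono zero {t} z≤n) (ℕₚ.≤-trans (ℕₚ.n≤1+n _) (ℕₚ.n≤1+n _))
    base-mono (suc s) {suc t} (s≤s h) = s≤s (s≤s (base-mono s h))

    base-cancel-< : ∀ {s t} → base s < base t → s < t
    base-cancel-< {s} {t} h with s <? t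
    ... | yes s<t = s<t
    ... | no  s≮t = ⊥-elim (ℕₚ.<⇒≱ h (base-mono t (ℕₚ.≮⇒≥ s≮t)))

    base-injective : ∀ {s t} → base s ≡ base t → s ≡ t
    base-injective {zero}  {zero}  e = refl
    base-injective {zero}  {suc t} e = ⊥-elim (ℕₚ.<-irrefl e (s≤s (ℕₚ.≤-trans (base-mono zero {t} z≤n) (ℕₚ.n≤1+n _))))
    base-injective {suc s} {zero}  e = ⊥-elim (ℕₚ.<-irrefl (sym e) (s≤s (ℕₚ.≤-trans (base-mono zero {s} z≤n) (ℕₚ.n≤1+n _))))
    base-injective {suc s} {suc t} e = cong suc (base-injective (ℕₚ.suc-injective (ℕₚ.suc-injective e)))

    -- All values of `base` have the parity of `bit parity`. This shows that the last row is not of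
    -- type L.
    base≢1+base : ∀ s t → base s ≢ suc (base t)
    base≢1+base zero    t       e = ℕₚ.<-irrefl e (s≤s (base-mono zero {t} z≤n))
    base≢1+base (suc s) zero    e = ℕₚ.<-irrefl (sym (ℕₚ.suc-injective e)) (s≤s (base-mono zero {s} z≤n))
    base≢1+base (suc s) (suc t) e = base≢1+base s t (ℕₚ.suc-injective (ℕₚ.suc-injective e))

    row-left : ∀ t → row (suc (base t)) ≡ L (mark t) (tape t)
    row-left zero    = first-left b m digit parity
    row-left (suc t) = cong (next ∘ next) (row-left t)

    row-right : ∀ t → row (suc (suc (base t))) ≡ R (mark (suc t)) (states t) (tape (suc t))
    row-right t = cong next (row-left t)

    data Shape : ℕ → Set where
      seed  : Shape 0
      extra : parity ≡ true → Shape 1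
      left  : ∀ t → Shape (suc (base t))
      right : ∀ t → Shape (suc (suc (base t)))

    shape-1 : ∀ p → parity ≡ p → Shape 1
    shape-1 false e = subst (λ p → Shape (suc p)) (cong bit e) (left 0)
    shape-1 true  e = extra e

    shape-suc : ∀ {r} → Shape (suc r) → Shape (suc (suc r))
    shape-suc (extra e) = subst (λ p → Shape (suc p)) (cong bit e) (left 0)
    shape-suc (left t)  = right t
    shape-suc (right t) = left (suc t)

    shape-of : ∀ r → Shape r
    shape-of zero          = seed
    shape-of (suc zero)    = shape-1 parity refl
    shape-of (suc (suc r)) = shape-suc (shape-of (suc r))

    1≤last : 1 ≤ last
    1≤last = s≤s z≤n

    valid : ∀ r → Valid last r (row r)
    valid r with shape-of r
    ... | seed    = refl
    ... | extra e = subst (Valid last 1) (sym (cong first e)) record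
      { positive   = s≤s z≤n
      ; end-state  = λ _ → refl
      ; last-state = λ ()
      ; blank      = λ _ _ → refl
      ; mark≤      = ℕₚ.≤-refl
      ; symbol≤    = λ _ → z≤n
      }
    ... | left t  = subst (Valid last (suc (base t))) (sym (row-left t)) record
      { positive = s≤s z≤n
      ; not-last = λ e → base≢1+base t steps (ℕₚ.suc-injective e)
      ; mark≤    = mark≤m t
      ; symbol≤  = tape≤b t
      }
    ... | right t = subst (Valid last (suc (suc (base t)))) (sym (row-right t)) record
      { positive   = s≤s z≤n
      ; end-state  = λ h → trans (states-base t) (carry-before t (base-cancel-< (ℕₚ.≤-pred (ℕₚ.≤-pred h))))
      ; last-state = λ e → trans (cong (λ t → states t (base t)) (base-injective {t} {steps} (ℕₚ.suc-injective (ℕₚ.suc-injective e))))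
                             (trans (states-base steps) carry-at)
      ; blank      = λ x h → tape-blank (suc t) x (ℕₚ.≤-trans (s≤s (t≤base t)) (ℕₚ.≤-pred h))
      ; mark≤      = mark≤m (suc t)
      ; symbol≤    = tape≤b (suc t)
      }
      where
      t≤base : ∀ t → t ≤ base t
      t≤base t with base≥ t
      ... | x , e = subst (t ≤_) (sym e) (ℕₚ.m≤n+m t x)

-- Number of rows, number of tiles and choice of the base.

module TileCount where

  open Bonds
  open Positions
  open Geometry
  open TileSet
  open LocalGrowth
  open Assemblies
  open Counting
  open import Data.Bool using (true; false)
  open import Data.List using (List; []; _∷_; _++_; length; map; upTo; cartesianProductWith)
  open import Data.List.Properties using (length-deduplicate; length-map; length-++; length-upTo)
  open import Data.Nat using (ℕ; zero; suc; _+_; _*_; _^_; _∸_; _≤_; _<_; z≤n; s≤s; NonZero; ⌊_/2⌋; ⌈_/2⌉; >-nonZero)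
  open import Data.Nat.DivMod using (_/_; m≡m%n+[m/n]*n; m%n<n; m/n≤m; m/n*n≤m)
  open import Data.Nat.Logarithm using (⌊log₂_⌋; ⌊log₂⌋-mono-≤; ⌊log₂⌊n/2⌋⌋≡⌊log₂n⌋∸1; ⌊log₂[2^n]⌋≡n)
  import Data.Nat.Properties as ℕₚ
  open import Data.Nat.Tactic.RingSolver using (solve-∀)
  open import Data.Product using (_×_; _,_)
  open import Relation.Binary.PropositionalEquality

  n<2^[1+⌊log₂n⌋] : ∀ n → n < 2 ^ suc ⌊log₂ n ⌋
  n<2^[1+⌊log₂n⌋] n = ℕₚ.≰⇒> λ h → ℕₚ.1+n≰n (subst (_≤ ⌊log₂ n ⌋) (⌊log₂[2^n]⌋≡n (suc ⌊log₂ n ⌋)) (⌊log₂⌋-mono-≤ h))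

  ⌊log₂⌋-< : ∀ k n → 1 ≤ n → n < 2 ^ k → ⌊log₂ n ⌋ < k
  ⌊log₂⌋-< zero    (suc n)       _   (s≤s ())
  ⌊log₂⌋-< (suc k) (suc zero)    _   _  = s≤s z≤n
  ⌊log₂⌋-< (suc k) n@(suc (suc _)) _ h = s≤s (ℕₚ.≤-trans (ℕₚ.m≤n+m∸n ⌊log₂ n ⌋ 1)
    (subst (λ l → suc l ≤ k) (⌊log₂⌊n/2⌋⌋≡⌊log₂n⌋∸1 n) (⌊log₂⌋-< k ⌊ n /2⌋ (s≤s z≤n) half)))
    where
    half : ⌊ n /2⌋ < 2 ^ k
    half = ℕₚ.≰⇒> λ 2^k≤ → ℕₚ.<⇒≱ h (subst₂ _≤_ (cong (2 ^ k +_) (sym (ℕₚ.+-identityʳ (2 ^ k)))) (ℕₚ.⌊n/2⌋+⌈n/2⌉≡n n)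
      (ℕₚ.+-mono-≤ 2^k≤ (ℕₚ.≤-trans 2^k≤ (ℕₚ.⌊n/2⌋≤⌈n/2⌉ n))))

  2^⌊log₂n⌋≤n : ∀ n → 1 ≤ n → 2 ^ ⌊log₂ n ⌋ ≤ n
  2^⌊log₂n⌋≤n n 1≤n = ℕₚ.≮⇒≥ λ h → ℕₚ.<-irrefl refl (⌊log₂⌋-< ⌊log₂ n ⌋ n 1≤n h)

  n<2^n : ∀ n → n < 2 ^ n
  n<2^n zero    = s≤s z≤n
  n<2^n (suc n) = ℕₚ.+-mono-≤-< (ℕₚ.≤-trans (s≤s z≤n) (n<2^n n)) (ℕₚ.≤-trans (n<2^n n) (ℕₚ.≤-reflexive (sym (ℕₚ.+-identityʳ _))))

  -- Leaves room for the loading rows: with `ℓ` the logarithm of `N` and `m ≤ 2 + ℓ`, it gives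
  -- `3 + 2 m ≤ 7 + 2 ℓ ≤ 2 ^ ℓ ≤ N`.
  7+2n≤2^n : ∀ n → 4 ≤ n → 7 + 2 * n ≤ 2 ^ n
  7+2n≤2^n n 4≤n = subst (λ n → 7 + 2 * n ≤ 2 ^ n) (ℕₚ.m∸n+n≡m 4≤n) (from-4 (n ∸ 4))
    where
    from-4 : ∀ k → 7 + 2 * (k + 4) ≤ 2 ^ (k + 4)
    from-4 zero    = ℕₚ.m≤m+n 15 1
    from-4 (suc k) = ℕₚ.≤-trans (ℕₚ.≤-trans (ℕₚ.m≤m+n _ (5 + 2 * (k + 4))) (ℕₚ.≤-reflexive (arrange k))) (ℕₚ.*-monoʳ-≤ 2 (from-4 k))
      where
      arrange : ∀ k → (7 + 2 * (suc k + 4)) + (5 + 2 * (k + 4)) ≡ 2 * (7 + 2 * (k + 4))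
      arrange = solve-∀

  length-kinds : ∀ b m digit parity → length (Machine.kinds b m digit parity) ≡ 18 + 6 * b + 4 * m
  length-kinds b m digit parity = begin
    length (constants ++ (symbolKinds ++ markKinds))    ≡⟨ length-++ constants {symbolKinds ++ markKinds} ⟩
    8 + length (symbolKinds ++ markKinds)               ≡⟨ cong (8 +_) (length-++ symbolKinds {markKinds}) ⟩
    8 + (length symbolKinds + length markKinds)         ≡⟨ cong (8 +_) (cong₂ _+_ (families symbolFamilies b) (families markFamilies m)) ⟩
    8 + (6 * suc b + 4 * suc m)                         ≡⟨ arrange b m ⟩
    18 + 6 * b + 4 * m                                  ∎
    where
    open ≡-Reasoning
    open Machine b m digit parity
    open Kinds
    families : ∀ (fs : List (ℕ → Kind)) n → length (cartesianProductWith (λ f x → f x) fs (upTo (suc n))) ≡ length fs * suc n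
    families []       n = refl
    families (f ∷ fs) n = trans (length-++ (map f (upTo (suc n))))
      (cong₂ _+_ (trans (length-map f (upTo (suc n))) (length-upTo (suc n))) (families fs n))
    arrange : ∀ b m → 8 + (6 * suc b + 4 * suc m) ≡ 18 + 6 * b + 4 * m
    arrange = solve-∀

  base-formula : ∀ b m V c {{_ : NonZero b}} (e : V + suc c ≡ b ^ m) parity t → Counter.base b m V c e parity t ≡ bit parity + 2 * t
  base-formula b m V c e parity zero    = sym (ℕₚ.+-identityʳ _)
  base-formula b m V c e parity (suc t) = trans (cong (λ x → suc (suc x)) (base-formula b m V c e parity t)) (arrange (bit parity) t)
    where
    arrange : ∀ p t → suc (suc (p + 2 * t)) ≡ p + 2 * suc t
    arrange = solve-∀

  parityOf : ∀ n → ∃[ p ] ∃[ c ] bit p + 2 * c ≡ n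
  parityOf zero = false , 0 , refl
  parityOf (suc n) with parityOf n
  ... | false , c , e = true , c , cong suc e
  ... | true  , c , e = false , suc c , trans (arrange c) (cong suc e)
    where
    arrange : ∀ c → 2 * suc c ≡ suc (1 + 2 * c)
    arrange = solve-∀

  -- A counter with m digits in base b fits whenever b ^ m exceeds the number of
  -- rows; two rows are spent per loaded digit and per increment.
  assembles : ∀ b m {{_ : NonZero b}} N → 3 + 2 * m ≤ N → N ≤ b ^ m →
    ∃[ 𝒯 ] Deterministic 𝒯 × System.size 𝒯 ≤ 18 + 6 * b + 4 * m × ProducesFullTriangle 𝒯 N
  assembles b m N 3+2m≤N N≤b^m with parityOf (N ∸ (3 + 2 * m))
  ... | parity , c , e = system , deterministic , size≤ , subst (ProducesFullTriangle system) last≡N producesFullTriangle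
    where
    -- The seed row, the optional row, and `c + m + 1` pairs of rows.
    N≡ : 3 + (bit parity + 2 * (c + m)) ≡ N
    N≡ = trans (arrange (bit parity) c m) (trans (cong (_+ (3 + 2 * m)) e) (ℕₚ.m∸n+n≡m 3+2m≤N))
      where
      arrange : ∀ p c m → 3 + (p + 2 * (c + m)) ≡ (p + 2 * c) + (3 + 2 * m)
      arrange = solve-∀
    1+c≤b^m : suc c ≤ b ^ m
    1+c≤b^m = ℕₚ.≤-trans (ℕₚ.≤-trans (ℕₚ.≤-trans (s≤s (ℕₚ.m≤m+n c (c + (bit parity + 2 + 2 * m)))) (ℕₚ.≤-reflexive (arrange (bit parity) c m))) (ℕₚ.≤-reflexive N≡)) N≤b^m
      where
      arrange : ∀ p c m → suc (c + (c + (p + 2 + 2 * m))) ≡ 3 + (p + 2 * (c + m))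
      arrange = solve-∀
    V = b ^ m ∸ suc c
    V+1+c≡b^m : V + suc c ≡ b ^ m
    V+1+c≡b^m = ℕₚ.m∸n+n≡m 1+c≤b^m
    open Counter b m V c V+1+c≡b^m parity using (digit; last; 1≤last; valid; base; steps)
    open Growth b m digit parity last 1≤last valid
    last≡N : suc last ≡ N
    last≡N = trans (cong (λ x → suc (suc (suc x))) (base-formula b m V c V+1+c≡b^m parity steps)) N≡
    size≤ : System.size system ≤ 18 + 6 * b + 4 * m
    size≤ = ℕₚ.≤-trans (length-deduplicate _≟ᵗ_ (map toTile kinds))
      (ℕₚ.≤-reflexive (trans (length-map toTile kinds) (length-kinds b m digit parity)))
      where open Machine b m digit parity

  -- A power of two as base turns `b ^ m` into `2 ^ (q * m)`. Halving the exponent `k` makes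
  -- `b * b ≤ ℓ`, so that `b * k` stays linear in `ℓ`, while `q` remains proportional to `k`, as the
  -- bound on `m * k` requires.
  construct : ∀ N → 16 ≤ N → ∃[ 𝒯 ] Deterministic 𝒯 × System.size 𝒯 * ⌊log₂ ⌊log₂ N ⌋ ⌋ ≤ 72 * ⌊log₂ N ⌋ × ProducesFullTriangle 𝒯 N
  construct N 16≤N = conclude (assembles b m N 3+2m≤N N≤b^m)
    where
    ℓ = ⌊log₂ N ⌋
    k = ⌊log₂ ℓ ⌋
    q = ⌊ k /2⌋
    4≤ℓ : 4 ≤ ℓ
    4≤ℓ = subst (_≤ ℓ) (⌊log₂[2^n]⌋≡n 4) (⌊log₂⌋-mono-≤ 16≤N)
    2≤k : 2 ≤ k
    2≤k = subst (_≤ k) (⌊log₂[2^n]⌋≡n 2) (⌊log₂⌋-mono-≤ 4≤ℓ)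
    1≤q : 1 ≤ q
    1≤q = ℕₚ.⌊n/2⌋-mono 2≤k
    instance
      q≢0 : NonZero q
      q≢0 = >-nonZero 1≤q
      b≢0 : NonZero (2 ^ q)
      b≢0 = ℕₚ.m^n≢0 2 q
    b = 2 ^ q
    -- Rounded up past the quotient, so that `q * m` is at least `1 + ℓ` and `b ^ m` exceeds `N`.
    m = suc (suc ℓ / q)
    1≤ℓ : 1 ≤ ℓ
    1≤ℓ = ℕₚ.≤-trans (s≤s z≤n) 4≤ℓ
    1≤N : 1 ≤ N
    1≤N = ℕₚ.≤-trans (s≤s z≤n) 16≤N
    2^k≤ℓ : 2 ^ k ≤ ℓ
    2^k≤ℓ = 2^⌊log₂n⌋≤n ℓ 1≤ℓ
    k≤ℓ : k ≤ ℓ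
    k≤ℓ = ℕₚ.≤-trans (ℕₚ.<⇒≤ (n<2^n k)) 2^k≤ℓ
    2q≤k : q + q ≤ k
    2q≤k = subst (q + q ≤_) (ℕₚ.⌊n/2⌋+⌈n/2⌉≡n k) (ℕₚ.+-monoʳ-≤ q (ℕₚ.⌊n/2⌋≤⌈n/2⌉ k))
    -- Halving loses at most 1, and `1 ≤ q` absorbs it: `k ≤ 2 q + 1 ≤ 3 q`.
    k≤3q : k ≤ 3 * q
    k≤3q = subst (_≤ 3 * q) (ℕₚ.⌊n/2⌋+⌈n/2⌉≡n k) (ℕₚ.≤-trans (ℕₚ.+-monoʳ-≤ q (ℕₚ.≤-trans (⌈n/2⌉≤1+⌊n/2⌋ k) (ℕₚ.+-monoˡ-≤ q 1≤q)))
      (ℕₚ.≤-reflexive (arrange q)))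
      where
      arrange : ∀ q → q + (q + q) ≡ 3 * q
      arrange = solve-∀
      ⌈n/2⌉≤1+⌊n/2⌋ : ∀ n → ⌈ n /2⌉ ≤ suc ⌊ n /2⌋
      ⌈n/2⌉≤1+⌊n/2⌋ zero          = z≤n
      ⌈n/2⌉≤1+⌊n/2⌋ (suc zero)    = s≤s z≤n
      ⌈n/2⌉≤1+⌊n/2⌋ (suc (suc n)) = s≤s (⌈n/2⌉≤1+⌊n/2⌋ n)
    m≤2+ℓ : m ≤ 2 + ℓ
    m≤2+ℓ = s≤s (m/n≤m (suc ℓ) q)
    3+2m≤N : 3 + 2 * m ≤ N
    3+2m≤N = ℕₚ.≤-trans (ℕₚ.≤-trans (ℕₚ.+-monoʳ-≤ 3 (ℕₚ.*-monoʳ-≤ 2 m≤2+ℓ)) (ℕₚ.≤-reflexive (arrange ℓ)))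
      (ℕₚ.≤-trans (7+2n≤2^n ℓ 4≤ℓ) (2^⌊log₂n⌋≤n N 1≤N))
      where
      arrange : ∀ l → 3 + 2 * (2 + l) ≡ 7 + 2 * l
      arrange = solve-∀
    1+ℓ≤qm : suc ℓ ≤ q * m
    1+ℓ≤qm = subst₂ _≤_ (sym (m≡m%n+[m/n]*n (suc ℓ) q)) (arrange q (suc ℓ / q)) (ℕₚ.+-monoˡ-≤ ((suc ℓ / q) * q) (ℕₚ.<⇒≤ (m%n<n (suc ℓ) q)))
      where
      arrange : ∀ q d → q + d * q ≡ q * suc d
      arrange = solve-∀
    N≤b^m : N ≤ b ^ m
    N≤b^m = ℕₚ.≤-trans (ℕₚ.<⇒≤ (n<2^[1+⌊log₂n⌋] N))
      (ℕₚ.≤-trans (ℕₚ.^-monoʳ-≤ 2 1+ℓ≤qm) (ℕₚ.≤-reflexive (sym (ℕₚ.^-*-assoc 2 q m))))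
    -- By `q < 2 ^ q`, the product is at most `3 * 2 ^ (q + q) ≤ 3 * 2 ^ k ≤ 3 * ℓ`.
    b*k≤3ℓ : b * k ≤ 3 * ℓ
    b*k≤3ℓ = ℕₚ.≤-trans (ℕₚ.*-monoʳ-≤ b (ℕₚ.≤-trans k≤3q (ℕₚ.*-monoʳ-≤ 3 (ℕₚ.<⇒≤ (n<2^n q)))))
      (ℕₚ.≤-trans (ℕₚ.≤-reflexive (trans (arrange b) (cong (3 *_) (sym (ℕₚ.^-distribˡ-+-* 2 q q)))))
        (ℕₚ.*-monoʳ-≤ 3 (ℕₚ.≤-trans (ℕₚ.^-monoʳ-≤ 2 2q≤k) 2^k≤ℓ)))
      where
      arrange : ∀ b → b * (3 * b) ≡ 3 * (b * b)
      arrange = solve-∀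
    m*k≤9ℓ : m * k ≤ 9 * ℓ
    m*k≤9ℓ = ℕₚ.≤-trans (ℕₚ.*-monoʳ-≤ m k≤3q) (ℕₚ.≤-trans (ℕₚ.≤-reflexive (arrange q (suc ℓ / q)))
      (ℕₚ.≤-trans (ℕₚ.*-monoʳ-≤ 3 (ℕₚ.+-mono-≤ (ℕₚ.≤-trans (ℕₚ.≤-trans (ℕₚ.m≤m+n q q) 2q≤k) k≤ℓ)
        (ℕₚ.≤-trans (m/n*n≤m (suc ℓ) q) (ℕₚ.+-monoˡ-≤ ℓ 1≤ℓ)))) (ℕₚ.≤-reflexive (arrange′ ℓ))))
      where
      arrange : ∀ q d → suc d * (3 * q) ≡ 3 * (q + d * q)
      arrange = solve-∀
      arrange′ : ∀ l → 3 * (l + (l + l)) ≡ 9 * l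
      arrange′ = solve-∀
    conclude : ∃[ 𝒯 ] Deterministic 𝒯 × System.size 𝒯 ≤ 18 + 6 * b + 4 * m × ProducesFullTriangle 𝒯 N →
      ∃[ 𝒯 ] Deterministic 𝒯 × System.size 𝒯 * k ≤ 72 * ℓ × ProducesFullTriangle 𝒯 N
    conclude (𝒯 , det , size≤ , full) = 𝒯 , det , ℕₚ.≤-trans (ℕₚ.*-monoˡ-≤ k size≤) bound , full
      where
      bound : (18 + 6 * b + 4 * m) * k ≤ 72 * ℓ
      bound = ℕₚ.≤-trans (ℕₚ.≤-reflexive (arrange b m k))
        (ℕₚ.≤-trans (ℕₚ.+-mono-≤ (ℕₚ.+-mono-≤ (ℕₚ.*-monoʳ-≤ 18 k≤ℓ) (ℕₚ.*-monoʳ-≤ 6 b*k≤3ℓ)) (ℕₚ.*-monoʳ-≤ 4 m*k≤9ℓ))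
          (ℕₚ.≤-reflexive (arrange′ ℓ)))
        where
        arrange : ∀ b m k → (18 + 6 * b + 4 * m) * k ≡ 18 * k + 6 * (b * k) + 4 * (m * k)
        arrange = solve-∀
        arrange′ : ∀ l → 18 * l + 6 * (3 * l) + 4 * (9 * l) ≡ 72 * l
        arrange′ = solve-∀

open TileCount using (construct)

corollary14 : ∃[ C ] ∃[ N₀ ] ∀ (N : ℕ) → N₀ ≤ N →
    ∃[ 𝒯 ] Deterministic 𝒯
    × System.size 𝒯 * ⌊log₂ ⌊log₂ N ⌋ ⌋ ≤ C * ⌊log₂ N ⌋
    × ProducesFullTriangle 𝒯 N
-- 72 is 18 + 6 · 3 + 4 · 9, from the tile count and the bounds on `k`, `b * k` and `m * k`. From 16
-- on the iterated logarithm is at least 2, so its half `q` is positive.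
corollary14 = 72 , 16 , construct
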